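{- Let $n = pq$, where $p, q$ are positive integers with $\gcd(p,q) = 1$. Let $s, t \in \{1, \ldots, n-1\}$ be such that $$2s,\ 2t,\ 2(s+t),\ 3s-t,\ 3t-s,\ 3s+t,\ 3t+s,\ 4s,\ 4t \not\equiv 0 \pmod n.$$ If $s = \frac{p-q}{2}$ and $t = \frac{p+q}{2}$, or $s = \frac{p^2-q}{2}$ and $t = \frac{p^2+q}{2}$, then $\mathcal{N}(C_n(s,t))$ is homotopy equivalent to a torus.
   Context: For an integer $n\ge 2$ and $s,t\in\{1,\ldots,n-1\}$, the circulant graph $C_n(s,t)$ is the simple graph with vertex set $\{1,2,\ldots,n\}$ in which two vertices $x,y$ are adjacent if and only if $x-y \pmod n$ lies in $\{s, t, n-s, n-t\}$. The neighborhood complex $\mathcal{N}(G)$ of a graph $G$ is the (abstract) simplicial complex whose vertices are all non-isolated vertices of $G$ and whose simplices are those subsets of $V(G)$ which have a common neighbor in $G$. Topological statements about a simplicial complex refer to its geometric realization. The torus is $S^1\times S^1$. -}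

module Defs where

open import Data.Fin.Base using (Fin; zero; suc; toℕ)
open import Data.Fin.Subset using (Subset; ⁅_⁆; _⊆_) renaming (_∈_ to _∈ₛ_)
open import Data.Fin.Subset.Properties using (x∈⁅y⁆⇒x≡y)
open import Data.Integer.Base as ℤ using (ℤ; +_; -[1+_]; +[1+_])
open import Data.Integer.Properties as ℤ using ()
open import Data.List.Base using (List; []; _∷_)
open import Data.List.Membership.Propositional using (_∈_)
open import Data.List.Relation.Unary.Any using (here; there)
open import Data.Nat.Base as ℕ using (ℕ; zero; suc; _∸_; NonZero; >-nonZero)
open import Data.Nat.DivMod as ℕ using (m%n≤n)
open import Data.Nat.Properties as ℕ using ()
open import Data.Product.Base using (Σ-syntax; ∃-syntax; _×_; _,_; proj₁; proj₂)
open import Data.Rational.Base as ℚ using (ℚ; 0ℚ; 1ℚ; ½; 1/_)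
open import Data.Rational.Properties as ℚ using ()
open import Data.Rational.Solver using (module +-*-Solver)
open import Data.Sum.Base using (inj₁; inj₂)
open import Data.Vec.Functional as Vector using (Vector; _++_)
open import Function.Base using (id; _∘_)
open import Relation.Binary.Core using (Rel)
open import Relation.Binary.Definitions using (Symmetric; Irreflexive)
open import Relation.Binary.PropositionalEquality
  using (_≡_; refl; sym; trans; cong; cong₂; subst; subst₂)
open import Relation.Nullary using (¬_; contradiction)
open import Level using (0ℓ)

Eventually : (ℕ → Set) → Set
Eventually P = ∃[ N ] (∀ n → N ℕ.≤ n → P n)

IsCauchy : (ℕ → ℚ) → Set
IsCauchy x = ∀ ε → 0ℚ ℚ.< ε →
  ∃[ N ] (∀ m n → N ℕ.≤ m → N ℕ.≤ n → ℚ.∣ x m ℚ.- x n ∣ ℚ.< ε)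

-- The reals are Cauchy sequences of rationals modulo null sequences; the
-- quotient is not formed, _≃_ below being the equality.
record ℝ : Set where
  constructor mkℝ
  field
    seq    : ℕ → ℚ
    cauchy : IsCauchy seq

open ℝ public

infix 4 _≃_ _<_ _≤_

_≃_ : Rel ℝ 0ℓ
x ≃ y = ∀ ε → 0ℚ ℚ.< ε → Eventually λ n → ℚ.∣ seq x n ℚ.- seq y n ∣ ℚ.< ε

_<_ : Rel ℝ 0ℓ
x < y = ∃[ ε ] 0ℚ ℚ.< ε × Eventually λ n → seq x n ℚ.+ ε ℚ.≤ seq y n

_≤_ : Rel ℝ 0ℓ
x ≤ y = ∀ ε → 0ℚ ℚ.< ε → Eventually λ n → seq x n ℚ.≤ seq y n ℚ.+ ε

half>0 : ∀ {ε} → 0ℚ ℚ.< ε → 0ℚ ℚ.< ½ ℚ.* ε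
half>0 {ε} ε>0 = subst (ℚ._< ½ ℚ.* ε) (ℚ.*-zeroʳ ½) (ℚ.*-monoʳ-<-pos ½ ε>0)

half+half : ∀ ε → ½ ℚ.* ε ℚ.+ ½ ℚ.* ε ≡ ε
half+half ε = trans (sym (ℚ.*-distribʳ-+ ε ½ ½)) (ℚ.*-identityˡ ε)

⊔≤ˡ : ∀ {m n k} → m ℕ.⊔ n ℕ.≤ k → m ℕ.≤ k
⊔≤ˡ {m} {n} = ℕ.≤-trans (ℕ.m≤m⊔n m n)

⊔≤ʳ : ∀ {m n k} → m ℕ.⊔ n ℕ.≤ k → n ℕ.≤ k
⊔≤ʳ {m} {n} = ℕ.≤-trans (ℕ.m≤n⊔m m n)

*-dist : ∀ a b c d → ℚ.∣ a ℚ.* b ℚ.- c ℚ.* d ∣ ℚ.≤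
         ℚ.∣ a ∣ ℚ.* ℚ.∣ b ℚ.- d ∣ ℚ.+ ℚ.∣ d ∣ ℚ.* ℚ.∣ a ℚ.- c ∣
*-dist a b c d = subst₂ ℚ._≤_
  (cong ℚ.∣_∣ (solve 4 (λ a b c d →
      a :* (b :- d) :+ d :* (a :- c) := a :* b :- c :* d) refl a b c d))
  (cong₂ ℚ._+_ (ℚ.∣p*q∣≡∣p∣*∣q∣ a (b ℚ.- d)) (ℚ.∣p*q∣≡∣p∣*∣q∣ d (a ℚ.- c)))
  (ℚ.∣p+q∣≤∣p∣+∣q∣ (a ℚ.* (b ℚ.- d)) (d ℚ.* (a ℚ.- c)))
  where open +-*-Solver

∣∣-bound : ∀ a b {e} → ℚ.∣ a ℚ.- b ∣ ℚ.< e → ℚ.∣ a ∣ ℚ.< ℚ.∣ b ∣ ℚ.+ e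
∣∣-bound a b {e} h = ℚ.≤-<-trans
  (subst (λ z → ℚ.∣ z ∣ ℚ.≤ ℚ.∣ b ∣ ℚ.+ ℚ.∣ a ℚ.- b ∣)
    (solve 2 (λ a b → b :+ (a :- b) := a) refl a b)
    (ℚ.∣p+q∣≤∣p∣+∣q∣ b (a ℚ.- b)))
  (ℚ.+-monoʳ-< ℚ.∣ b ∣ h)
  where open +-*-Solver

eventualBound : ∀ (x : ℝ) →
  Σ[ B ∈ ℚ ] ℚ.Positive B × Eventually λ n → ℚ.∣ seq x n ∣ ℚ.≤ B
eventualBound x with cauchy x 1ℚ (ℚ.positive⁻¹ 1ℚ)
... | N , h = B , ℚ.positive B>0 ,
    N , λ n N≤n → ℚ.<⇒≤ (∣∣-bound (seq x n) (seq x N) (h n N N≤n ℕ.≤-refl))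
  where
  B : ℚ
  B = ℚ.∣ seq x N ∣ ℚ.+ 1ℚ
  B>0 : 0ℚ ℚ.< B
  B>0 = ℚ.+-mono-≤-< (ℚ.0≤∣p∣ (seq x N)) (ℚ.positive⁻¹ 1ℚ)

scale : ∀ B .{{_ : ℚ.Positive B}} ε → 0ℚ ℚ.< ε →
        Σ[ δ ∈ ℚ ] 0ℚ ℚ.< δ × (∀ a b → a ℚ.≤ B → 0ℚ ℚ.≤ b → b ℚ.< δ → a ℚ.* b ℚ.< ε)
scale B ε ε>0 = δ , δ>0 , λ a b a≤B b≥0 b<δ → ℚ.≤-<-trans
    (ℚ.*-monoʳ-≤-nonNeg b {{ℚ.nonNegative b≥0}} a≤B)
    (subst (B ℚ.* b ℚ.<_) Bδ≡ε (ℚ.*-monoʳ-<-pos B b<δ))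
  where
  instance
    B≢0 : ℚ.NonZero B
    B≢0 = ℚ.pos⇒nonZero B
    B⁻¹>0 : ℚ.Positive (1/ B)
    B⁻¹>0 = ℚ.1/pos⇒pos B
  δ : ℚ
  δ = 1/ B ℚ.* ε
  δ>0 : 0ℚ ℚ.< δ
  δ>0 = subst (ℚ._< δ) (ℚ.*-zeroʳ (1/ B)) (ℚ.*-monoʳ-<-pos (1/ B) ε>0)
  Bδ≡ε : B ℚ.* δ ≡ ε
  Bδ≡ε = trans (sym (ℚ.*-assoc B (1/ B) ε))
           (trans (cong (ℚ._* ε) (ℚ.*-inverseʳ B)) (ℚ.*-identityˡ ε))

map-cauchy : ∀ (f : ℚ → ℚ) →
  (∀ a b → ℚ.∣ f a ℚ.- f b ∣ ℚ.≤ ℚ.∣ a ℚ.- b ∣) →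
  ∀ (x : ℝ) → IsCauchy (λ n → f (seq x n))
map-cauchy f lip x ε ε>0 with cauchy x ε ε>0
... | N , h = N , λ m n N≤m N≤n → ℚ.≤-<-trans (lip (seq x m) (seq x n)) (h m n N≤m N≤n)

neg-lip : ∀ a b → ℚ.∣ ℚ.- a ℚ.- ℚ.- b ∣ ℚ.≤ ℚ.∣ a ℚ.- b ∣
neg-lip a b = ℚ.≤-reflexive (trans
  (cong ℚ.∣_∣ (solve 2 (λ a b → :- a :- :- b := :- (a :- b)) refl a b))
  (ℚ.∣-p∣≡∣p∣ (a ℚ.- b)))
  where open +-*-Solver

∣∣-lip₁ : ∀ a b → ℚ.∣ a ∣ ℚ.- ℚ.∣ b ∣ ℚ.≤ ℚ.∣ a ℚ.- b ∣
∣∣-lip₁ a b = subst₂ ℚ._≤_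
  refl
  (solve 2 (λ d b → d :+ b :- b := d) refl ℚ.∣ a ℚ.- b ∣ ℚ.∣ b ∣)
  (ℚ.+-monoˡ-≤ (ℚ.- ℚ.∣ b ∣)
    (subst (λ z → ℚ.∣ z ∣ ℚ.≤ ℚ.∣ a ℚ.- b ∣ ℚ.+ ℚ.∣ b ∣)
      (solve 2 (λ a b → a :- b :+ b := a) refl a b)
      (ℚ.∣p+q∣≤∣p∣+∣q∣ (a ℚ.- b) b)))
  where open +-*-Solver

∣∣-lip : ∀ a b → ℚ.∣ ℚ.∣ a ∣ ℚ.- ℚ.∣ b ∣ ∣ ℚ.≤ ℚ.∣ a ℚ.- b ∣
∣∣-lip a b with ℚ.∣p∣≡p∨∣p∣≡-p (ℚ.∣ a ∣ ℚ.- ℚ.∣ b ∣)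
... | inj₁ e = subst (ℚ._≤ ℚ.∣ a ℚ.- b ∣) (sym e) (∣∣-lip₁ a b)
... | inj₂ e = subst₂ ℚ._≤_
    (trans (solve 2 (λ p q → q :- p := :- (p :- q)) refl ℚ.∣ a ∣ ℚ.∣ b ∣) (sym e))
    (trans (cong ℚ.∣_∣ (solve 2 (λ a b → b :- a := :- (a :- b)) refl a b)) (ℚ.∣-p∣≡∣p∣ (a ℚ.- b)))
    (∣∣-lip₁ b a)
  where open +-*-Solver

infixl 6 _+_ _-_
infixl 7 _*_
infix  8 -_

fromℚ : ℚ → ℝ
fromℚ q = mkℝ (λ _ → q) λ ε ε>0 →
  0 , λ _ _ _ _ → subst (ℚ._< ε) (sym (cong ℚ.∣_∣ (ℚ.+-inverseʳ q))) ε>0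

0ℝ 1ℝ : ℝ
0ℝ = fromℚ 0ℚ
1ℝ = fromℚ 1ℚ

_+_ : ℝ → ℝ → ℝ
x + y = mkℝ (λ n → seq x n ℚ.+ seq y n) +-cauchy
  where
  +-cauchy : IsCauchy (λ n → seq x n ℚ.+ seq y n)
  +-cauchy ε ε>0 with cauchy x (½ ℚ.* ε) (half>0 ε>0) | cauchy y (½ ℚ.* ε) (half>0 ε>0)
  ... | M , hx | N , hy = M ℕ.⊔ N , λ m n ≤m ≤n → ℚ.≤-<-trans
      (subst (λ z → ℚ.∣ z ∣ ℚ.≤ ℚ.∣ seq x m ℚ.- seq x n ∣ ℚ.+ ℚ.∣ seq y m ℚ.- seq y n ∣)
        (solve 4 (λ a b c d → (a :- b) :+ (c :- d) := (a :+ c) :- (b :+ d)) refl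
          (seq x m) (seq x n) (seq y m) (seq y n))
        (ℚ.∣p+q∣≤∣p∣+∣q∣ (seq x m ℚ.- seq x n) (seq y m ℚ.- seq y n)))
      (subst (_ ℚ.<_) (half+half ε)
        (ℚ.+-mono-< (hx m n (⊔≤ˡ ≤m) (⊔≤ˡ ≤n)) (hy m n (⊔≤ʳ {M} ≤m) (⊔≤ʳ {M} ≤n))))
    where open +-*-Solver

-_ : ℝ → ℝ
- x = mkℝ (λ n → ℚ.- seq x n) (map-cauchy ℚ.-_ neg-lip x)

_-_ : ℝ → ℝ → ℝ
x - y = x + - y

*-cauchy : ∀ x y → IsCauchy (λ n → seq x n ℚ.* seq y n)
*-cauchy x y ε ε>0 =
  let A , A>0 , K , x≤A = eventualBound x
      B , B>0 , L , y≤B = eventualBound y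
      α , α>0 , hA = scale A {{A>0}} (½ ℚ.* ε) (half>0 ε>0)
      β , β>0 , hB = scale B {{B>0}} (½ ℚ.* ε) (half>0 ε>0)
      M , hy = cauchy y α α>0
      N , hx = cauchy x β β>0
  in (K ℕ.⊔ L) ℕ.⊔ (M ℕ.⊔ N) , λ m n ≤m ≤n →
    *-dist-< (seq x m) (seq y m) (seq x n) (seq y n)
      (hA ℚ.∣ seq x m ∣ ℚ.∣ seq y m ℚ.- seq y n ∣
        (x≤A m (⊔≤ˡ {K} {L} (⊔≤ˡ ≤m))) (ℚ.0≤∣p∣ (seq y m ℚ.- seq y n))
        (hy m n (⊔≤ˡ {M} (⊔≤ʳ {K ℕ.⊔ L} ≤m)) (⊔≤ˡ {M} (⊔≤ʳ {K ℕ.⊔ L} ≤n))))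
      (hB ℚ.∣ seq y n ∣ ℚ.∣ seq x m ℚ.- seq x n ∣
        (y≤B n (⊔≤ʳ {K} (⊔≤ˡ ≤n))) (ℚ.0≤∣p∣ (seq x m ℚ.- seq x n))
        (hx m n (⊔≤ʳ {M} (⊔≤ʳ {K ℕ.⊔ L} ≤m)) (⊔≤ʳ {M} (⊔≤ʳ {K ℕ.⊔ L} ≤n))))
  where
  *-dist-< : ∀ a b c d →
    ℚ.∣ a ∣ ℚ.* ℚ.∣ b ℚ.- d ∣ ℚ.< ½ ℚ.* ε → ℚ.∣ d ∣ ℚ.* ℚ.∣ a ℚ.- c ∣ ℚ.< ½ ℚ.* ε →
    ℚ.∣ a ℚ.* b ℚ.- c ℚ.* d ∣ ℚ.< ε
  *-dist-< a b c d h k = ℚ.≤-<-trans (*-dist a b c d)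
    (subst (ℚ.∣ a ∣ ℚ.* ℚ.∣ b ℚ.- d ∣ ℚ.+ ℚ.∣ d ∣ ℚ.* ℚ.∣ a ℚ.- c ∣ ℚ.<_)
      (half+half ε) (ℚ.+-mono-< h k))

_*_ : ℝ → ℝ → ℝ
x * y = mkℝ (λ n → seq x n ℚ.* seq y n) (*-cauchy x y)

∣_∣ : ℝ → ℝ
∣ x ∣ = mkℝ (λ n → ℚ.∣ seq x n ∣) (map-cauchy ℚ.∣_∣ ∣∣-lip x)

sum : ∀ {n} → Vector ℝ n → ℝ
sum = Vector.foldr _+_ 0ℝ

-- A subspace of ℝ^dim, given by its points and their coordinates.  Points
-- with equal coordinates count as equal; a continuous map respects this
-- equality by the ε-δ condition.
record Space : Set₁ where
  field
    Point : Set
    dim   : ℕ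
    coord : Point → Vector ℝ dim

open Space public

SamePoint : ∀ X → Rel (Point X) 0ℓ
SamePoint X x y = ∀ i → coord X x i ≃ coord X y i

-- Distance less than ε in the maximum metric, which induces the Euclidean
-- topology and its product topologies.
Near : ∀ X → ℝ → Rel (Point X) 0ℓ
Near X ε x y = ∀ i → ∣ coord X x i - coord X y i ∣ < ε

record ContinuousMap (X Y : Space) : Set where
  field
    fun        : Point X → Point Y
    continuous : ∀ x ε → 0ℝ < ε →
                 ∃[ δ ] 0ℝ < δ × (∀ y → Near X δ x y → Near Y ε (fun x) (fun y))

open ContinuousMap public

idMap : ∀ X → ContinuousMap X X
idMap X = record { fun = id ; continuous = λ x ε ε>0 → ε , ε>0 , λ y → id }

infixr 9 _∘ᶜ_

_∘ᶜ_ : ∀ {X Y Z} → ContinuousMap Y Z → ContinuousMap X Y → ContinuousMap X Z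
g ∘ᶜ f = record
  { fun        = fun g ∘ fun f
  ; continuous = λ x ε ε>0 →
      let η , η>0 , hg = continuous g (fun f x) ε ε>0
          δ , δ>0 , hf = continuous f x η η>0
      in δ , δ>0 , λ y x~y → hg (fun f y) (hf y x~y)
  }

infixr 2 _×ˢ_

_×ˢ_ : Space → Space → Space
X ×ˢ Y = record
  { Point = Point X × Point Y
  ; dim   = dim X ℕ.+ dim Y
  ; coord = λ (x , y) → coord X x ++ coord Y y
  }

UnitInterval : Space
UnitInterval = record
  { Point = Σ[ t ∈ ℝ ] (0ℝ ≤ t × t ≤ 1ℝ)
  ; dim   = 1
  ; coord = λ (t , _) _ → t
  }

const-≤ : ∀ {a b} → a ℚ.≤ b → fromℚ a ≤ fromℚ b
const-≤ {a} {b} a≤b ε ε>0 = 0 , λ _ _ → subst (ℚ._≤ b ℚ.+ ε) (ℚ.+-identityʳ a)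
  (ℚ.+-mono-≤ a≤b (ℚ.<⇒≤ ε>0))

I₀ I₁ : Point UnitInterval
I₀ = 0ℝ , const-≤ (ℚ.≤-refl {0ℚ}) , const-≤ (ℚ.nonNegative⁻¹ 1ℚ)
I₁ = 1ℝ , const-≤ (ℚ.nonNegative⁻¹ 1ℚ) , const-≤ (ℚ.≤-refl {1ℚ})

record Homotopy {X Y : Space} (f g : ContinuousMap X Y) : Set where
  field
    map      : ContinuousMap (X ×ˢ UnitInterval) Y
    startsAt : ∀ x → SamePoint Y (fun map (x , I₀)) (fun f x)
    endsAt   : ∀ x → SamePoint Y (fun map (x , I₁)) (fun g x)

infix 4 _≃ₕ_

record _≃ₕ_ (X Y : Space) : Set where
  field
    to      : ContinuousMap X Y
    from    : ContinuousMap Y X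
    from∘to : Homotopy (from ∘ᶜ to) (idMap X)
    to∘from : Homotopy (to ∘ᶜ from) (idMap Y)

Circle : Space
Circle = record
  { Point = Σ[ z ∈ ℝ × ℝ ] proj₁ z * proj₁ z + proj₂ z * proj₂ z ≃ 1ℝ
  ; dim   = 2
  ; coord = λ ((x , y) , _) → x Vector.∷ y Vector.∷ Vector.[]
  }

Torus : Space
Torus = Circle ×ˢ Circle

-- The empty set is allowed as a simplex; it contributes no points to the
-- geometric realization.
record SimplicialComplex (n : ℕ) : Set₁ where
  field
    Vertex     : Fin n → Set
    Simplex    : Subset n → Set
    singletons : ∀ {v} → Vertex v → Simplex ⁅ v ⁆
    vertices   : ∀ {σ v} → Simplex σ → v ∈ₛ σ → Vertex v
    faces      : ∀ {σ τ} → Simplex σ → τ ⊆ σ → Simplex τ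

open SimplicialComplex public

-- Barycentric coordinates.  The last condition says that the support of α
-- is a simplex: faces of simplices being simplices, it is enough that every
-- set of vertices on which α is positive is one.  In this form the support
-- need not be decidable.
∥_∥ : ∀ {n} → SimplicialComplex n → Space
∥_∥ {n} K = record
  { Point = Σ[ α ∈ Vector ℝ n ]
              (∀ v → 0ℝ ≤ α v) ×
              sum α ≃ 1ℝ ×
              (∀ σ → (∀ v → v ∈ₛ σ → 0ℝ < α v) → Simplex K σ)
  ; dim   = n
  ; coord = proj₁
  }

record SimpleGraph (n : ℕ) : Set₁ where
  field
    Adj        : Rel (Fin n) 0ℓ
    adj-sym    : Symmetric Adj
    adj-irrefl : Irreflexive _≡_ Adj

open SimpleGraph public

neighborhoodComplex : ∀ {n} → SimpleGraph n → SimplicialComplex n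
neighborhoodComplex G = record
  { Vertex     = λ v → ∃[ x ] Adj G v x
  ; Simplex    = λ σ → ∃[ x ] (∀ v → v ∈ₛ σ → Adj G v x)
  ; singletons = λ { {v} (x , v~x) →
                   x , λ w w∈ → subst (λ u → Adj G u x) (sym (x∈⁅y⁆⇒x≡y v w∈)) v~x }
  ; vertices   = λ (x , σ~x) v∈σ → x , σ~x _ v∈σ
  ; faces      = λ (x , σ~x) τ⊆σ → x , λ v v∈τ → σ~x v (τ⊆σ v∈τ)
  }

neg-% : ∀ i d .{{_ : NonZero d}} {r} → i ℤ.%ℕ d ≡ r → 1 ℕ.≤ r →
        (ℤ.- i) ℤ.%ℕ d ≡ d ∸ r
neg-% (+ zero) (suc d) refl ()
neg-% +[1+ a ] d refl 1≤r with suc a ℕ.% d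
... | suc k = refl
neg-% -[1+ a ] d eq 1≤r with suc a ℕ.% d | m%n≤n (suc a) d
neg-% -[1+ a ] d refl () | zero  | _
neg-% -[1+ a ] d refl 1≤r | suc k | k<d = sym (ℕ.m∸[m∸n]≡n k<d)

difference-swap : ∀ i j → j ℤ.- i ≡ ℤ.- (i ℤ.- j)
difference-swap i j = trans (ℤ.+-comm j (ℤ.- i)) (sym (trans
  (ℤ.neg-distrib-+ i (ℤ.- j)) (cong (λ k → ℤ.- i ℤ.+ k) (ℤ.neg-involutive j))))

connections : ℕ → ℕ → ℕ → List ℕ
connections n s t = s ∷ t ∷ n ∸ s ∷ n ∸ t ∷ []

-- The vertex k ∈ {1, …, n} is the element of Fin n with toℕ value k - 1;
-- this shift does not affect differences.
circulant : ∀ n s t → 1 ℕ.≤ s → s ℕ.< n → 1 ℕ.≤ t → t ℕ.< n → SimpleGraph n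
circulant n s t 1≤s s<n 1≤t t<n = record
  { Adj        = _~_
  ; adj-sym    = λ {x} {y} x~y → subst (_∈ connections n s t)
      (sym (trans (cong (ℤ._%ℕ n) (difference-swap (+ toℕ x) (+ toℕ y)))
                  (neg-% (+ toℕ x ℤ.- + toℕ y) n refl (positive x~y))))
      (opposite x~y)
  ; adj-irrefl = λ { {x} refl x~x → contradiction
      (subst (1 ℕ.≤_) (trans (cong (ℤ._%ℕ n) (ℤ.+-inverseʳ (+ toℕ x))) 0%) (positive x~x))
      λ () }
  }
  where
  instance
    n≢0 : NonZero n
    n≢0 = >-nonZero (ℕ.≤-<-trans ℕ.z≤n s<n)

  _~_ : Rel (Fin n) 0ℓ
  x ~ y = (+ toℕ x ℤ.- + toℕ y) ℤ.%ℕ n ∈ connections n s t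

  0% : (+ 0) ℤ.%ℕ n ≡ 0
  0% = ℕ.m<n⇒m%n≡m (ℕ.≤-<-trans ℕ.z≤n s<n)

  positive : ∀ {r} → r ∈ connections n s t → 1 ℕ.≤ r
  positive (here refl)                         = 1≤s
  positive (there (here refl))                 = 1≤t
  positive (there (there (here refl)))         = ℕ.m<n⇒0<n∸m s<n
  positive (there (there (there (here refl)))) = ℕ.m<n⇒0<n∸m t<n

  opposite : ∀ {r} → r ∈ connections n s t → n ∸ r ∈ connections n s t
  opposite (here refl)                 = there (there (here refl))
  opposite (there (here refl))         = there (there (there (here refl)))
  opposite (there (there (here refl))) = here (ℕ.m∸[m∸n]≡n (ℕ.<⇒≤ s<n))
  opposite (there (there (there (here refl)))) =
    there (here (ℕ.m∸[m∸n]≡n (ℕ.<⇒≤ t<n)))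

{-# OPTIONS --safe #-}
-- Put P = s + t, which is p or p², and q = t - s.  The neighbours of x are
-- x - t + {0, P, q, P + q}; by the Chinese remainder theorem they are the
-- corners of a unit square of the grid ℤ/q × ℤ/p, and every unit square arises.
-- So the neighbourhood complex is the categorical product of a q-cycle and a
-- p-cycle, where parity, coprimality, s ≥ 1 and 2(s + t) ≢ 0 force p, q ≥ 3.
-- Taking marginals, with the product of distributions as homotopy inverse,
-- identifies it with the product of the two cycles: the straight line from α
-- to the product of its marginals stays in each product simplex carrying α.
-- Finally a 4-cycle is homeomorphic to the circle by a rational
-- parametrisation, and subdividing an edge of an m-cycle is a homeomorphism
-- onto the (m + 1)-cycle.  All maps are given by formulas in +, *, ∣_∣ and
-- 1 / (1 + ∣_∣), hence constructively continuous; equations, weak inequalities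
-- and the support condition are ¬¬-stable, so these are proved by cases.
module Submission where

open import Data.Fin.Base using (Fin; zero; suc; toℕ; fromℕ<; splitAt; _↑ˡ_; _↑ʳ_)
open import Data.Fin.Patterns using (0F; 1F; 2F; 3F)
open import Data.Fin.Properties using (_≟_; suc-injective; toℕ-injective; toℕ-fromℕ<; toℕ<n; any?; all?)
open import Data.Fin.Subset using (Subset) renaming (_∈_ to _∈ₛ_)
open import Data.Fin.Subset.Properties using () renaming (_∈?_ to _∈ₛ?_)
open import Data.Nat.Base as ℕ using (ℕ; NonZero; >-nonZero)
open import Data.Nat.Properties as ℕ using ()
open import Data.Product.Base using (_×_; _,_; proj₁; proj₂; ∃-syntax; ∃₂; Σ-syntax)
open import Data.Sum.Base using (_⊎_; inj₁; inj₂; [_,_]′)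
open import Function.Base using (_∘_; id)
open import Relation.Binary.PropositionalEquality
  using (_≡_; _≢_; refl; sym; trans; cong; cong₂; subst; subst₂; module ≡-Reasoning)
open import Relation.Nullary using (¬_; Dec; yes; no; does; contradiction)
open import Relation.Nullary.Decidable using (_→-dec_; decidable-stable; ¬¬-excluded-middle)
open import Relation.Nullary.Negation using (¬¬-map)

-- The obstacle is constructive: neither the sign of a real nor the edge or square carrying a point
-- can be decided, so no map may branch on them. Maps are global formulas that happen to reduce to
-- the expected one on each simplex; case distinctions occur only below a double negation, in proofs
-- of stable statements. The 4-cycle is the anchor because its two pairs of opposite vertices give
-- signed coordinates a, b with |a| + |b| = 1. Radial projection of this square to the circle would
-- need a square root; a stereographic formula needs only denominators 1 + |z|, which never vanish.
-- Marginals undo multiplication exactly, since the factors have total mass 1, so only the other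
-- composite needs a homotopy. The grid asks of P only that p divides it and that it is invertible
-- mod q, which p and p² share. Parity enters through P = 2s + q.

module RealSpaces where

  open import Defs hiding (_+_; _*_; -_; _-_; ∣_∣; sum)
  import Defs as D
  open import Algebra.Bundles using (CommutativeRing)
  open import Algebra.Structures using (IsCommutativeRing)
  open import Algebra.Solver.Ring.AlmostCommutativeRing
    using (AlmostCommutativeRing; fromCommutativeRing; _-Raw-AlmostCommutative⟶_)
  import Algebra.Solver.Ring
  import Algebra.Properties.CommutativeMonoid.Sum
  import Algebra.Properties.Semiring.Sum
  open import Data.Bool.Base using (true)
  open import Data.Maybe.Base using (Maybe; just; nothing)
  open import Data.Rational.Base as ℚ using (ℚ; 0ℚ; 1ℚ; ½)
  open import Data.Rational.Properties as ℚ using ()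
  open import Data.Rational.Solver as ℚ using ()
  open import Data.Vec.Base as Vec using ()
  open import Data.Vec.Properties using ([]=⇒lookup; lookup⇒[]=; lookup∘tabulate)
  open import Data.Vec.Functional as Vector using (Vector; _++_)
  open import Data.Vec.Functional.Properties using (lookup-++ˡ; lookup-++ʳ)

  -- Cauchy reals as a commutative ring

  Null : (ℕ → ℚ) → Set
  Null a = ∀ ε → 0ℚ ℚ.< ε → Eventually λ n → ℚ.∣ a n ∣ ℚ.< ε

  -- The definition of x ≃ y unfolds too eagerly for x and y to be inferred.
  infix 4 _≈_
  record _≈_ (x y : ℝ) : Set where
    constructor mk≈
    field ≈⇒≃ : x ≃ y
  open _≈_ public

  record NonNeg (x : ℝ) : Set where
    constructor mkNonNeg
    field nonNeg⇒≤ : 0ℝ ≤ x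
  open NonNeg public

  null-ext : ∀ {a b} → (∀ n → a n ≡ b n) → Null a → Null b
  null-ext e h ε ε>0 = let N , k = h ε ε>0 in
    N , λ n N≤n → subst (λ z → ℚ.∣ z ∣ ℚ.< ε) (e n) (k n N≤n)

  null-≤ : ∀ {a b} → (∀ n → ℚ.∣ b n ∣ ℚ.≤ ℚ.∣ a n ∣) → Null a → Null b
  null-≤ e h ε ε>0 = let N , k = h ε ε>0 in
    N , λ n N≤n → ℚ.≤-<-trans (e n) (k n N≤n)

  null-+ : ∀ {a b} → Null a → Null b → Null (λ n → a n ℚ.+ b n)
  null-+ {a} {b} ha hb ε ε>0 =
    let M , ka = ha _ (half>0 ε>0)
        N , kb = hb _ (half>0 ε>0)
    in M ℕ.⊔ N , λ n ≤n → ℚ.≤-<-trans (ℚ.∣p+q∣≤∣p∣+∣q∣ (a n) (b n))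
         (subst (_ ℚ.<_) (half+half ε) (ℚ.+-mono-< (ka n (⊔≤ˡ ≤n)) (kb n (⊔≤ʳ {M} ≤n))))

  null-* : ∀ (x : ℝ) {b} → Null b → Null (λ n → seq x n ℚ.* b n)
  null-* x {b} hb ε ε>0 =
    let B , B>0 , M , x≤B = eventualBound x
        δ , δ>0 , h = scale B {{B>0}} ε ε>0
        N , k = hb δ δ>0
    in M ℕ.⊔ N , λ n ≤n → subst (ℚ._< ε) (sym (ℚ.∣p*q∣≡∣p∣*∣q∣ (seq x n) (b n)))
         (h _ _ (x≤B n (⊔≤ˡ ≤n)) (ℚ.0≤∣p∣ (b n)) (k n (⊔≤ʳ {M} ≤n)))

  ≈-pointwise : ∀ {x y} → (∀ n → seq x n ≡ seq y n) → x ≈ y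
  ≈-pointwise {x} {y} e = mk≈ λ ε ε>0 → 0 , λ n _ → subst (ℚ._< ε)
    (sym (cong ℚ.∣_∣ (trans (cong (ℚ._- seq y n) (e n)) (ℚ.+-inverseʳ (seq y n))))) ε>0

  ≈-refl : ∀ {x} → x ≈ x
  ≈-refl = ≈-pointwise λ n → refl

  ≈-sym : ∀ {x y} → x ≈ y → y ≈ x
  ≈-sym {x} {y} (mk≈ h) = mk≈ (null-≤ (λ n → ℚ.≤-reflexive
    (trans (cong ℚ.∣_∣ (difference (seq x n) (seq y n))) (ℚ.∣-p∣≡∣p∣ (seq x n ℚ.- seq y n)))) h)
    where
    open ℚ.+-*-Solver
    difference : ∀ a b → b ℚ.- a ≡ ℚ.- (a ℚ.- b)
    difference = solve 2 (λ a b → b :- a := :- (a :- b)) refl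

  ≈-trans : ∀ {x y z} → x ≈ y → y ≈ z → x ≈ z
  ≈-trans {x} {y} {z} (mk≈ h) (mk≈ k) = mk≈ (null-ext
    (λ n → solve 3 (λ a b c → a :- b :+ (b :- c) := a :- c) refl (seq x n) (seq y n) (seq z n))
    (null-+ h k))
    where open ℚ.+-*-Solver

  ≡⇒≈ : ∀ {x y} → x ≡ y → x ≈ y
  ≡⇒≈ refl = ≈-refl

  infixl 6 _+_ _-_
  infixl 7 _*_
  infix  8 -_

  -- The operations of Defs, sealed, since comparing their Cauchy moduli is slow.
  opaque
    _+_ _*_ : ℝ → ℝ → ℝ
    _+_ = D._+_
    _*_ = D._*_
    -_ ∣_∣ : ℝ → ℝ
    -_  = D.-_
    ∣_∣ = D.∣_∣

  _-_ : ℝ → ℝ → ℝ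
  x - y = x + - y

  sum : ∀ {n} → Vector ℝ n → ℝ
  sum = Vector.foldr _+_ 0ℝ

  opaque
    unfolding _+_

    sum-def : ∀ {n} (v : Vector ℝ n) → sum v ≡ D.sum v
    sum-def v = refl

  opaque
    unfolding _+_

    +-cong : ∀ {x y u v} → x ≈ y → u ≈ v → x + u ≈ y + v
    +-cong {x} {y} {u} {v} (mk≈ h) (mk≈ k) = mk≈ (null-ext
      (λ n → solve 4 (λ a b c d → a :- b :+ (c :- d) := a :+ c :- (b :+ d)) refl
        (seq x n) (seq y n) (seq u n) (seq v n))
      (null-+ h k))
      where open ℚ.+-*-Solver

    *-cong : ∀ {x y u v} → x ≈ y → u ≈ v → x * u ≈ y * v
    *-cong {x} {y} {u} {v} (mk≈ h) (mk≈ k) = mk≈ (null-ext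
      (λ n → solve 4 (λ a b c d → a :* (c :- d) :+ d :* (a :- b) := a :* c :- (b :* d)) refl
        (seq x n) (seq y n) (seq u n) (seq v n))
      (null-+ (null-* x k) (null-* v h)))
      where open ℚ.+-*-Solver

    neg-cong : ∀ {x y} → x ≈ y → - x ≈ - y
    neg-cong {x} {y} (mk≈ h) = mk≈ (null-≤ (λ n → neg-lip (seq x n) (seq y n)) h)

    ∣∣-cong : ∀ {x y} → x ≈ y → ∣ x ∣ ≈ ∣ y ∣
    ∣∣-cong {x} {y} (mk≈ h) = mk≈ (null-≤ (λ n → ∣∣-lip (seq x n) (seq y n)) h)

    +-assoc : ∀ x y z → x + y + z ≈ x + (y + z)
    +-assoc x y z = ≈-pointwise λ n → ℚ.+-assoc (seq x n) (seq y n) (seq z n)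

    +-comm : ∀ x y → x + y ≈ y + x
    +-comm x y = ≈-pointwise λ n → ℚ.+-comm (seq x n) (seq y n)

    +-identityˡ : ∀ x → 0ℝ + x ≈ x
    +-identityˡ x = ≈-pointwise λ n → ℚ.+-identityˡ (seq x n)

    +-identityʳ : ∀ x → x + 0ℝ ≈ x
    +-identityʳ x = ≈-pointwise λ n → ℚ.+-identityʳ (seq x n)

    +-inverseˡ : ∀ x → - x + x ≈ 0ℝ
    +-inverseˡ x = ≈-pointwise λ n → ℚ.+-inverseˡ (seq x n)

    +-inverseʳ : ∀ x → x + - x ≈ 0ℝ
    +-inverseʳ x = ≈-pointwise λ n → ℚ.+-inverseʳ (seq x n)

    *-assoc : ∀ x y z → x * y * z ≈ x * (y * z)
    *-assoc x y z = ≈-pointwise λ n → ℚ.*-assoc (seq x n) (seq y n) (seq z n)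

    *-comm : ∀ x y → x * y ≈ y * x
    *-comm x y = ≈-pointwise λ n → ℚ.*-comm (seq x n) (seq y n)

    *-identityˡ : ∀ x → 1ℝ * x ≈ x
    *-identityˡ x = ≈-pointwise λ n → ℚ.*-identityˡ (seq x n)

    *-identityʳ : ∀ x → x * 1ℝ ≈ x
    *-identityʳ x = ≈-pointwise λ n → ℚ.*-identityʳ (seq x n)

    *-distribˡ-+ : ∀ x y z → x * (y + z) ≈ x * y + x * z
    *-distribˡ-+ x y z = ≈-pointwise λ n → ℚ.*-distribˡ-+ (seq x n) (seq y n) (seq z n)

    *-distribʳ-+ : ∀ x y z → (y + z) * x ≈ y * x + z * x
    *-distribʳ-+ x y z = ≈-pointwise λ n → ℚ.*-distribʳ-+ (seq x n) (seq y n) (seq z n)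

  ℝ-isCommutativeRing : IsCommutativeRing _≈_ _+_ _*_ (-_) 0ℝ 1ℝ
  ℝ-isCommutativeRing = record
    { isRing = record
      { +-isAbelianGroup = record
        { isGroup = record
          { isMonoid = record
            { isSemigroup = record
              { isMagma = record
                { isEquivalence = record { refl = ≈-refl ; sym = ≈-sym ; trans = ≈-trans }
                ; ∙-cong = +-cong }
              ; assoc = +-assoc }
            ; identity = +-identityˡ , +-identityʳ }
          ; inverse = +-inverseˡ , +-inverseʳ
          ; ⁻¹-cong = neg-cong }
        ; comm = +-comm }
      ; *-cong = *-cong
      ; *-assoc = *-assoc
      ; *-identity = *-identityˡ , *-identityʳ
      ; distrib = *-distribˡ-+ , *-distribʳ-+ }
    ; *-comm = *-comm }

  ℝ-ring : CommutativeRing _ _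
  ℝ-ring = record { isCommutativeRing = ℝ-isCommutativeRing }

  ℝ-almostCommutativeRing : AlmostCommutativeRing _ _
  ℝ-almostCommutativeRing = fromCommutativeRing ℝ-ring

  opaque
    unfolding _+_

    fromℚ-+ : ∀ p q → fromℚ (p ℚ.+ q) ≈ fromℚ p + fromℚ q
    fromℚ-+ p q = ≈-pointwise λ _ → refl
    fromℚ-* : ∀ p q → fromℚ (p ℚ.* q) ≈ fromℚ p * fromℚ q
    fromℚ-* p q = ≈-pointwise λ _ → refl
    fromℚ-neg : ∀ p → fromℚ (ℚ.- p) ≈ - fromℚ p
    fromℚ-neg p = ≈-pointwise λ _ → refl

  fromℚ-morphism : ℚ.+-*-rawRing -Raw-AlmostCommutative⟶ ℝ-almostCommutativeRing
  fromℚ-morphism = record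
    { ⟦_⟧    = fromℚ
    ; +-homo = fromℚ-+
    ; *-homo = fromℚ-*
    ; -‿homo = fromℚ-neg
    ; 0-homo = ≈-refl
    ; 1-homo = ≈-refl
    }

  fromℚ-≟ : ∀ p q → Maybe (fromℚ p ≈ fromℚ q)
  fromℚ-≟ p q with p ℚ.≟ q
  ... | yes e = just (≡⇒≈ (cong fromℚ e))
  ... | no _  = nothing

  -- Coefficients are taken in ℚ, where equality is decidable, so that constants such as ½ are
  -- normalised although equality of reals is not decidable.
  module ℝ-Solver = Algebra.Solver.Ring ℚ.+-*-rawRing ℝ-almostCommutativeRing fromℚ-morphism fromℚ-≟

  module ≈-Reasoning where
    open import Relation.Binary.Reasoning.Setoid (CommutativeRing.setoid ℝ-ring) public

  ½ℝ : ℝ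
  ½ℝ = fromℚ ½

  -- Order

  half< : ∀ ε → 0ℚ ℚ.< ε → ½ ℚ.* ε ℚ.< ε
  half< ε ε>0 = subst₂ ℚ._<_ (ℚ.+-identityʳ _) (half+half ε) (ℚ.+-monoʳ-< (½ ℚ.* ε) (half>0 ε>0))

  p≤∣p∣ : ∀ p → p ℚ.≤ ℚ.∣ p ∣
  p≤∣p∣ p with ℚ.≤-total 0ℚ p
  ... | inj₁ 0≤p = ℚ.≤-reflexive (sym (ℚ.0≤p⇒∣p∣≡p 0≤p))
  ... | inj₂ p≤0 = ℚ.≤-trans p≤0 (ℚ.0≤∣p∣ p)

  ≤-from-distance : ∀ a b {e} → ℚ.∣ a ℚ.- b ∣ ℚ.< e → a ℚ.≤ b ℚ.+ e
  ≤-from-distance a b {e} h = subst (ℚ._≤ b ℚ.+ e)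
    (solve 2 (λ a b → b :+ (a :- b) := a) refl a b)
    (ℚ.+-monoʳ-≤ b (ℚ.≤-trans (p≤∣p∣ (a ℚ.- b)) (ℚ.<⇒≤ h)))
    where open ℚ.+-*-Solver

  +-cancelʳ-≤ : ∀ a b c → a ℚ.+ c ℚ.≤ b ℚ.+ c → a ℚ.≤ b
  +-cancelʳ-≤ a b c l = subst₂ ℚ._≤_ (cancel a) (cancel b) (ℚ.+-monoˡ-≤ (ℚ.- c) l)
    where
    open ℚ.+-*-Solver
    cancel : ∀ a → a ℚ.+ c ℚ.- c ≡ a
    cancel a = solve 2 (λ a c → a :+ c :- c := a) refl a c

  -- A substitute for trichotomy: past the modulus N for ε/4 the sequence stays within ε/4 of its
  -- term at N, and comparing that one rational with ε/2 decides. Above, all later terms are at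
  -- least ε/4; below, they are at most 3ε/4.
  positive-or-small : ∀ z ε → 0ℚ ℚ.< ε → (0ℝ < z) ⊎ Eventually λ n → seq z n ℚ.≤ ε
  positive-or-small z ε ε>0 = decide (cauchy z q q>0)
    where
    h q : ℚ
    h = ½ ℚ.* ε
    q = ½ ℚ.* h
    h>0 : 0ℚ ℚ.< h
    h>0 = half>0 ε>0
    q>0 : 0ℚ ℚ.< q
    q>0 = half>0 h>0
    h+q≤ε : h ℚ.+ q ℚ.≤ ε
    h+q≤ε = ℚ.≤-trans (ℚ.+-monoʳ-≤ h (ℚ.<⇒≤ (half< h h>0))) (ℚ.≤-reflexive (half+half ε))
    decide : ∃[ N ] (∀ m n → N ℕ.≤ m → N ℕ.≤ n → ℚ.∣ seq z m ℚ.- seq z n ∣ ℚ.< q) →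
             (0ℝ < z) ⊎ Eventually λ n → seq z n ℚ.≤ ε
    decide (N , c) with ℚ.≤-total (seq z N) h
    ... | inj₁ z≤h = inj₂ (N , λ n N≤n → ℚ.≤-trans
            (≤-from-distance (seq z n) (seq z N) (c n N N≤n ℕ.≤-refl))
            (ℚ.≤-trans (ℚ.+-monoˡ-≤ q z≤h) h+q≤ε))
    ... | inj₂ h≤z = inj₁ (q , q>0 , N , λ n N≤n →
            ℚ.≤-trans (ℚ.≤-reflexive (ℚ.+-identityˡ q)) (+-cancelʳ-≤ q (seq z n) q
              (ℚ.≤-trans (ℚ.≤-reflexive (half+half h))
                (ℚ.≤-trans h≤z (≤-from-distance (seq z N) (seq z n) (c N n ℕ.≤-refl N≤n))))))

  <⇒≉0 : ∀ {x} → 0ℝ < x → ¬ (x ≈ 0ℝ)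
  <⇒≉0 {x} (ε , ε>0 , M , h) (mk≈ k) with k ε ε>0
  ... | N , l = ℚ.<-irrefl refl (ℚ.≤-<-trans
        (subst (ℚ._≤ seq x n) (ℚ.+-identityˡ ε) (h n (ℕ.m≤m⊔n M N)))
        (ℚ.≤-<-trans (ℚ.≤-trans (p≤∣p∣ (seq x n)) (ℚ.≤-reflexive (cong ℚ.∣_∣ (sym (ℚ.+-identityʳ _)))))
          (l n (ℕ.m≤n⊔m M N))))
    where
    n = M ℕ.⊔ N

  not-positive⇒small : ∀ {z} → ¬ (0ℝ < z) → ∀ ε → 0ℚ ℚ.< ε → Eventually λ n → seq z n ℚ.≤ ε
  not-positive⇒small {z} z≯0 ε ε>0 with positive-or-small z ε ε>0
  ... | inj₁ z>0 = contradiction z>0 z≯0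
  ... | inj₂ small = small

  -- Lets the ring solver use a hypothesis l ≈ r: the first argument is a ring identity exhibiting u
  -- - v as the multiple c of l - r, and c is the certificate to be supplied by hand.
  by-eq : ∀ {u v} c {l r} → u ≈ v + c * (l - r) → l ≈ r → u ≈ v
  by-eq {u} {v} c {l} {r} e l≈r = begin
    u               ≈⟨ e ⟩
    v + c * (l - r) ≈⟨ +-cong ≈-refl (*-cong ≈-refl (+-cong l≈r ≈-refl)) ⟩
    v + c * (r - r) ≈⟨ solve 3 (λ v c r → v :+ c :* (r :- r) := v) ≈-refl v c r ⟩
    v               ∎
    where
    open ≈-Reasoning
    open ℝ-Solver

  difference≈0⇒≈ : ∀ {x y} → x - y ≈ 0ℝ → x ≈ y
  difference≈0⇒≈ {x} {y} x-y≈0 = by-eq 1ℝ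
    (solve 2 (λ x y → x := y :+ con 1ℚ :* (x :- y :- con 0ℚ)) ≈-refl x y) x-y≈0
    where open ℝ-Solver

  zero-product : ∀ {x} y → x ≈ 0ℝ → y * x ≈ 0ℝ
  zero-product y x≈0 = ≈-trans (*-cong ≈-refl x≈0)
    (solve 1 (λ y → y :* con 0ℚ := con 0ℚ) ≈-refl y)
    where open ℝ-Solver

  zero-sum : ∀ {x y} → x ≈ 0ℝ → y ≈ 0ℝ → x + y ≈ 0ℝ
  zero-sum x≈0 y≈0 = ≈-trans (+-cong x≈0 y≈0) (+-identityˡ 0ℝ)

  zero-sub : ∀ {x y} → x ≈ 0ℝ → y ≈ 0ℝ → x - y ≈ 0ℝ
  zero-sub x≈0 y≈0 = ≈-trans (+-cong x≈0 (neg-cong y≈0)) (+-inverseʳ 0ℝ)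

  opaque
    unfolding _+_

    ∣∣-zero : ∣ 0ℝ ∣ ≈ 0ℝ
    ∣∣-zero = ≈-pointwise λ _ → refl

    ∣∣-* : ∀ x y → ∣ x * y ∣ ≈ ∣ x ∣ * ∣ y ∣
    ∣∣-* x y = ≈-pointwise λ n → ℚ.∣p*q∣≡∣p∣*∣q∣ (seq x n) (seq y n)

    ∣∣-neg : ∀ x → ∣ - x ∣ ≈ ∣ x ∣
    ∣∣-neg x = ≈-pointwise λ n → ℚ.∣-p∣≡∣p∣ (seq x n)

    -- When positivity of the absolute value is refuted, `positive-or-small` leaves smallness for
    -- every ε. Equality with 0 thereby becomes a negative statement, which is the source of its
    -- stability.
    not-apart⇒≈0 : ∀ {x} → ¬ (0ℝ < ∣ x ∣) → x ≈ 0ℝ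
    not-apart⇒≈0 {x} h = mk≈ λ ε ε>0 →
      let N , k = not-positive⇒small {∣ x ∣} h (½ ℚ.* ε) (half>0 ε>0) in
      N , λ n N≤n → ℚ.≤-<-trans (subst (λ z → ℚ.∣ z ∣ ℚ.≤ ½ ℚ.* ε) (sym (ℚ.+-identityʳ (seq x n))) (k n N≤n))
        (half< ε ε>0)

    -- If a ≥ -d, then |a| is a, or it is -a ≤ d; either way |a| and a differ by at most 2d. Taking
    -- d = ε/4 gives ε/2, which leaves room for the strict bound.
    nonNeg⇒∣∣ : ∀ {x} → NonNeg x → ∣ x ∣ ≈ x
    nonNeg⇒∣∣ {x} (mkNonNeg h) = mk≈ λ ε ε>0 →
      let N , k = h (½ ℚ.* (½ ℚ.* ε)) (half>0 (half>0 ε>0)) in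
      N , λ n N≤n → ℚ.≤-<-trans
        (subst (_ ℚ.≤_) (half+half (½ ℚ.* ε)) (excess (seq x n) (ℚ.<⇒≤ (half>0 (half>0 ε>0))) (k n N≤n)))
        (half< ε ε>0)
      where
      open ℚ.+-*-Solver
      -a≤d : ∀ a {d} → 0ℚ ℚ.≤ a ℚ.+ d → ℚ.- a ℚ.≤ d
      -a≤d a {d} l = subst₂ ℚ._≤_ (ℚ.+-identityʳ (ℚ.- a))
        (solve 2 (λ a d → :- a :+ (a :+ d) := d) refl a d) (ℚ.+-monoʳ-≤ (ℚ.- a) l)
      excess : ∀ a {d} → 0ℚ ℚ.≤ d → 0ℚ ℚ.≤ a ℚ.+ d → ℚ.∣ ℚ.∣ a ∣ ℚ.- a ∣ ℚ.≤ d ℚ.+ d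
      excess a {d} 0≤d l with ℚ.∣p∣≡p∨∣p∣≡-p a
      ... | inj₁ e = subst (ℚ._≤ d ℚ.+ d)
              (sym (cong ℚ.∣_∣ (trans (cong (ℚ._- a) e) (ℚ.+-inverseʳ a)))) (ℚ.+-mono-≤ 0≤d 0≤d)
      ... | inj₂ e = ℚ.≤-trans (ℚ.∣p+q∣≤∣p∣+∣q∣ ℚ.∣ a ∣ (ℚ.- a)) (ℚ.+-mono-≤
              (ℚ.≤-trans (ℚ.≤-reflexive (trans (ℚ.∣∣p∣∣≡∣p∣ a) e)) (-a≤d a l))
              (ℚ.≤-trans (ℚ.≤-reflexive (trans (ℚ.∣-p∣≡∣p∣ a) e)) (-a≤d a l)))

    ∣∣-nonNeg : ∀ x → NonNeg ∣ x ∣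
    ∣∣-nonNeg x = mkNonNeg λ ε ε>0 → 0 , λ n _ → ℚ.+-mono-≤ (ℚ.0≤∣p∣ (seq x n)) (ℚ.<⇒≤ ε>0)

    nonNeg-+ : ∀ {x y} → NonNeg x → NonNeg y → NonNeg (x + y)
    nonNeg-+ {x} {y} (mkNonNeg h) (mkNonNeg k) = mkNonNeg λ ε ε>0 →
      let M , a = h _ (half>0 ε>0)
          N , b = k _ (half>0 ε>0)
      in M ℕ.⊔ N , λ n ≤n → subst (0ℚ ℚ.≤_) (regroup (seq x n) (seq y n) ε)
           (ℚ.+-mono-≤ (a n (⊔≤ˡ ≤n)) (b n (⊔≤ʳ {M} ≤n)))
      where
      open ℚ.+-*-Solver
      regroup : ∀ a b e → a ℚ.+ ½ ℚ.* e ℚ.+ (b ℚ.+ ½ ℚ.* e) ≡ a ℚ.+ b ℚ.+ e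
      regroup = solve 3 (λ a b e → a :+ con ½ :* e :+ (b :+ con ½ :* e) := a :+ b :+ e) refl

  nonNeg-resp-≈ : ∀ {x y} → x ≈ y → NonNeg x → NonNeg y
  nonNeg-resp-≈ {x} {y} x≈y (mkNonNeg h) = mkNonNeg λ ε ε>0 →
    let M , a = h _ (half>0 ε>0)
        N , b = ≈⇒≃ x≈y _ (half>0 ε>0)
    in M ℕ.⊔ N , λ n ≤n → ℚ.≤-trans (a n (⊔≤ˡ ≤n)) (ℚ.≤-trans
         (ℚ.+-monoˡ-≤ _ (≤-from-distance (seq x n) (seq y n) (b n (⊔≤ʳ {M} ≤n))))
         (ℚ.≤-reflexive (trans (ℚ.+-assoc (seq y n) _ _) (cong (seq y n ℚ.+_) (half+half ε)))))

  nonNeg-const : ∀ {q} → 0ℚ ℚ.≤ q → NonNeg (fromℚ q)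
  nonNeg-const 0≤q = mkNonNeg (const-≤ 0≤q)

  ∣∣⇒nonNeg : ∀ {x} → ∣ x ∣ ≈ x → NonNeg x
  ∣∣⇒nonNeg {x} e = nonNeg-resp-≈ e (∣∣-nonNeg x)

  nonNeg-* : ∀ {x y} → NonNeg x → NonNeg y → NonNeg (x * y)
  nonNeg-* {x} {y} h k = ∣∣⇒nonNeg (≈-trans (∣∣-* x y) (*-cong (nonNeg⇒∣∣ h) (nonNeg⇒∣∣ k)))

  nonNeg-sum : ∀ {n} (v : Vector ℝ n) → (∀ i → NonNeg (v i)) → NonNeg (sum v)
  nonNeg-sum {ℕ.zero} v h = nonNeg-const ℚ.≤-refl
  nonNeg-sum {ℕ.suc n} v h = nonNeg-+ (h zero) (nonNeg-sum (v ∘ suc) (h ∘ suc))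

  nonPos⇒∣∣ : ∀ {x} → NonNeg (- x) → ∣ x ∣ ≈ - x
  nonPos⇒∣∣ {x} h = ≈-trans (≈-sym (∣∣-neg x)) (nonNeg⇒∣∣ h)

  positive⇒nonNeg : ∀ {x} → 0ℝ < x → NonNeg x
  positive⇒nonNeg {x} (ε , ε>0 , N , h) = mkNonNeg λ δ δ>0 → N , λ n N≤n →
    ℚ.+-mono-≤ (ℚ.≤-trans (ℚ.≤-trans (ℚ.<⇒≤ ε>0) (ℚ.≤-reflexive (sym (ℚ.+-identityˡ ε)))) (h n N≤n))
      (ℚ.<⇒≤ δ>0)

  opaque
    unfolding _+_

    not-positive⇒nonPos : ∀ {x} → ¬ (0ℝ < x) → NonNeg (- x)
    not-positive⇒nonPos {x} h = mkNonNeg λ ε ε>0 →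
      let N , k = not-positive⇒small {x} h ε ε>0 in
      N , λ n N≤n → subst (ℚ._≤ ℚ.- seq x n ℚ.+ ε) (ℚ.+-inverseˡ (seq x n))
        (ℚ.+-monoʳ-≤ (ℚ.- seq x n) (k n N≤n))

    ≤⇒nonNeg : ∀ {x y} → x ≤ y → NonNeg (y - x)
    ≤⇒nonNeg {x} {y} h = mkNonNeg λ ε ε>0 → let N , k = h ε ε>0 in
      N , λ n N≤n → subst₂ ℚ._≤_ (ℚ.+-inverseˡ (seq x n))
        (solve 3 (λ a b e → :- a :+ (b :+ e) := b :- a :+ e) refl (seq x n) (seq y n) ε)
        (ℚ.+-monoʳ-≤ (ℚ.- seq x n) (k n N≤n))
      where open ℚ.+-*-Solver

  nonNeg-antisym : ∀ {x} → NonNeg x → NonNeg (- x) → x ≈ 0ℝ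
  nonNeg-antisym {x} h k = by-eq ½ℝ
    (solve 1 (λ x → x := con 0ℚ :+ con ½ :* (x :- :- x)) ≈-refl x)
    (≈-trans (≈-sym (nonNeg⇒∣∣ h)) (nonPos⇒∣∣ k))
    where open ℝ-Solver

  not-positive⇒≈0 : ∀ {x} → NonNeg x → ¬ (0ℝ < x) → x ≈ 0ℝ
  not-positive⇒≈0 h k = nonNeg-antisym h (not-positive⇒nonPos k)

  -- Hence equations and weak inequalities may be proved classically.
  ≈0-stable : ∀ {x} → ¬ ¬ (x ≈ 0ℝ) → x ≈ 0ℝ
  ≈0-stable ¬¬x≈0 = not-apart⇒≈0 λ 0<∣x∣ →
    ¬¬x≈0 λ x≈0 → <⇒≉0 0<∣x∣ (≈-trans (∣∣-cong x≈0) ∣∣-zero)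

  ≈-stable : ∀ {x y} → ¬ ¬ (x ≈ y) → x ≈ y
  ≈-stable h = difference≈0⇒≈ (≈0-stable λ k → h λ x≈y → k
    (≈-trans (+-cong x≈y ≈-refl) (+-inverseʳ _)))

  nonNeg-stable : ∀ {x} → ¬ ¬ NonNeg x → NonNeg x
  nonNeg-stable h = ∣∣⇒nonNeg (≈-stable λ k → h λ 0≤x → k (nonNeg⇒∣∣ 0≤x))

  -- The only case distinction on signs that is available; the double negation is harmless wherever
  -- the goal is stable.
  nonNeg-total : ∀ x → ¬ ¬ (NonNeg x ⊎ NonNeg (- x))
  nonNeg-total x k = k (inj₂ (not-positive⇒nonPos λ 0<x → k (inj₁ (positive⇒nonNeg 0<x))))

  sum-cong : ∀ {n} {u v : Vector ℝ n} → (∀ i → u i ≈ v i) → sum u ≈ sum v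
  sum-cong {ℕ.zero}  h = ≈-refl
  sum-cong {ℕ.suc n} h = +-cong (h zero) (sum-cong (h ∘ suc))

  sum-zero : ∀ {n} {v : Vector ℝ n} → (∀ i → v i ≈ 0ℝ) → sum v ≈ 0ℝ
  sum-zero {ℕ.zero}  h = ≈-refl
  sum-zero {ℕ.suc n} h = zero-sum (h zero) (sum-zero (h ∘ suc))

  -- Reciprocals

  -- Division in the form 1 / (1 + |a|) is total, bounded by 1 and 1-Lipschitz, so it extends
  -- termwise to Cauchy sequences without any apartness hypothesis.
  module Reciprocal (a : ℚ) where
    private instance
      1+∣a∣>0 : ℚ.Positive (1ℚ ℚ.+ ℚ.∣ a ∣)
      1+∣a∣>0 = ℚ.positive (ℚ.+-mono-<-≤ (ℚ.positive⁻¹ 1ℚ) (ℚ.0≤∣p∣ a))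
      1+∣a∣≢0 : ℚ.NonZero (1ℚ ℚ.+ ℚ.∣ a ∣)
      1+∣a∣≢0 = ℚ.pos⇒nonZero (1ℚ ℚ.+ ℚ.∣ a ∣)
      inverse>0 : ℚ.Positive (ℚ.1/ (1ℚ ℚ.+ ℚ.∣ a ∣))
      inverse>0 = ℚ.1/pos⇒pos (1ℚ ℚ.+ ℚ.∣ a ∣)

    value : ℚ
    value = ℚ.1/ (1ℚ ℚ.+ ℚ.∣ a ∣)

    nonNeg : 0ℚ ℚ.≤ value
    nonNeg = ℚ.<⇒≤ (ℚ.positive⁻¹ value)

    inverse : (1ℚ ℚ.+ ℚ.∣ a ∣) ℚ.* value ≡ 1ℚ
    inverse = ℚ.*-inverseʳ (1ℚ ℚ.+ ℚ.∣ a ∣)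

    ≤1 : ℚ.∣ value ∣ ℚ.≤ 1ℚ
    ≤1 = subst₂ ℚ._≤_ (trans (ℚ.*-identityˡ value) (sym (ℚ.0≤p⇒∣p∣≡p nonNeg))) inverse
      (ℚ.*-monoʳ-≤-nonNeg value {{ℚ.nonNegative nonNeg}}
        (subst (ℚ._≤ 1ℚ ℚ.+ ℚ.∣ a ∣) (ℚ.+-identityʳ 1ℚ) (ℚ.+-monoʳ-≤ 1ℚ (ℚ.0≤∣p∣ a))))

  -- Over a common denominator the difference is |b| - |a| times the product of the two reciprocals,
  -- and each of these is at most 1.
  reciprocal-lip : ∀ a b → ℚ.∣ Reciprocal.value a ℚ.- Reciprocal.value b ∣ ℚ.≤ ℚ.∣ a ℚ.- b ∣
  reciprocal-lip a b = begin
    ℚ.∣ A.value ℚ.- B.value ∣                              ≡⟨ cong ℚ.∣_∣ difference ⟩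
    ℚ.∣ (ℚ.∣ b ∣ ℚ.- ℚ.∣ a ∣) ℚ.* (A.value ℚ.* B.value) ∣   ≡⟨ ℚ.∣p*q∣≡∣p∣*∣q∣ (ℚ.∣ b ∣ ℚ.- ℚ.∣ a ∣) (A.value ℚ.* B.value) ⟩
    d ℚ.* ℚ.∣ A.value ℚ.* B.value ∣                        ≡⟨ cong (d ℚ.*_) (ℚ.∣p*q∣≡∣p∣*∣q∣ A.value B.value) ⟩
    d ℚ.* (ℚ.∣ A.value ∣ ℚ.* ℚ.∣ B.value ∣)                ≤⟨ ℚ.*-monoˡ-≤-nonNeg d {{0≤d}} product≤1 ⟩
    d ℚ.* 1ℚ                                              ≡⟨ ℚ.*-identityʳ d ⟩
    d                                                     ≤⟨ ∣∣-lip b a ⟩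
    ℚ.∣ b ℚ.- a ∣                                          ≡⟨ cong ℚ.∣_∣ (solve 2 (λ a b → b :- a :=
        :- (a :- b)) refl a b) ⟩
    ℚ.∣ ℚ.- (a ℚ.- b) ∣                                    ≡⟨ ℚ.∣-p∣≡∣p∣ (a ℚ.- b) ⟩
    ℚ.∣ a ℚ.- b ∣                                          ∎
    where
    open ℚ.≤-Reasoning
    open ℚ.+-*-Solver
    module A = Reciprocal a
    module B = Reciprocal b
    d : ℚ
    d = ℚ.∣ ℚ.∣ b ∣ ℚ.- ℚ.∣ a ∣ ∣
    0≤d : ℚ.NonNegative d
    0≤d = ℚ.nonNegative (ℚ.0≤∣p∣ (ℚ.∣ b ∣ ℚ.- ℚ.∣ a ∣))
    product≤1 : ℚ.∣ A.value ∣ ℚ.* ℚ.∣ B.value ∣ ℚ.≤ 1ℚ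
    product≤1 = ℚ.≤-trans
      (ℚ.*-monoʳ-≤-nonNeg ℚ.∣ B.value ∣ {{ℚ.nonNegative (ℚ.0≤∣p∣ B.value)}} A.≤1)
      (ℚ.≤-trans (ℚ.≤-reflexive (ℚ.*-identityˡ ℚ.∣ B.value ∣)) B.≤1)
    difference : A.value ℚ.- B.value ≡ (ℚ.∣ b ∣ ℚ.- ℚ.∣ a ∣) ℚ.* (A.value ℚ.* B.value)
    difference = trans
      (cong₂ ℚ._-_ (sym (trans (cong (ℚ._* A.value) B.inverse) (ℚ.*-identityˡ A.value)))
                   (sym (trans (cong (ℚ._* B.value) A.inverse) (ℚ.*-identityˡ B.value))))
      (solve 4 (λ x y u v → (con 1ℚ :+ y) :* v :* u :- (con 1ℚ :+ x) :* u :* v := (y :- x) :* (u :* v))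
        refl ℚ.∣ a ∣ ℚ.∣ b ∣ A.value B.value)

  opaque
    unfolding _+_

    1/1+∣_∣ : ℝ → ℝ
    1/1+∣ x ∣ = mkℝ (λ n → Reciprocal.value (seq x n)) (map-cauchy Reciprocal.value reciprocal-lip x)

    1/1+∣∣-inverse : ∀ x → (1ℝ + ∣ x ∣) * 1/1+∣ x ∣ ≈ 1ℝ
    1/1+∣∣-inverse x = ≈-pointwise λ n → Reciprocal.inverse (seq x n)

    1/1+∣∣-nonNeg : ∀ x → NonNeg 1/1+∣ x ∣
    1/1+∣∣-nonNeg x = mkNonNeg λ ε ε>0 → 0 , λ n _ →
      ℚ.+-mono-≤ (Reciprocal.nonNeg (seq x n)) (ℚ.<⇒≤ ε>0)

  1/1+∣∣-unique : ∀ {x y} → (1ℝ + ∣ x ∣) * y ≈ 1ℝ → 1/1+∣ x ∣ ≈ y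
  1/1+∣∣-unique {x} {y} e = begin
    i                         ≈⟨ solve 1 (λ i → i := con 1ℚ :* i) ≈-refl i ⟩
    1ℝ * i                    ≈⟨ *-cong (≈-sym e) ≈-refl ⟩
    (1ℝ + ∣ x ∣) * y * i      ≈⟨ solve 3 (λ a y i → (con 1ℚ :+ a) :* y :* i :=
        (con 1ℚ :+ a) :* i :* y) ≈-refl ∣ x ∣ y i ⟩
    (1ℝ + ∣ x ∣) * i * y      ≈⟨ *-cong (1/1+∣∣-inverse x) ≈-refl ⟩
    1ℝ * y                    ≈⟨ *-identityˡ y ⟩
    y                         ∎
    where
    open ≈-Reasoning
    open ℝ-Solver
    i : ℝ
    i = 1/1+∣ x ∣

  -- Continuity

  -- A rational tolerance and a weak inequality between terms let estimates be added term by term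
  -- without choosing slack; the real, strict `Near` is recovered once, in `continuous⇒ε-δ`.
  record Close (δ : ℚ) (x y : ℝ) : Set where
    constructor mkClose
    field eventually≤ : Eventually λ n → ℚ.∣ seq x n ℚ.- seq y n ∣ ℚ.≤ δ
  open Close public

  close-mono : ∀ {δ ε x y} → δ ℚ.≤ ε → Close δ x y → Close ε x y
  close-mono δ≤ε (mkClose (N , h)) = mkClose (N , λ n N≤n → ℚ.≤-trans (h n N≤n) δ≤ε)

  close-refl : ∀ {δ} x → 0ℚ ℚ.< δ → Close δ x x
  close-refl {δ} x δ>0 = mkClose (0 , λ n _ → subst (ℚ._≤ δ)
    (sym (cong ℚ.∣_∣ (ℚ.+-inverseʳ (seq x n)))) (ℚ.<⇒≤ δ>0))

  ≈⇒close : ∀ {δ x y} → 0ℚ ℚ.< δ → x ≈ y → Close δ x y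
  ≈⇒close {δ} δ>0 x≈y = let N , h = ≈⇒≃ x≈y δ δ>0 in mkClose (N , λ n N≤n → ℚ.<⇒≤ (h n N≤n))

  close⇒≈ : ∀ {x y} → (∀ δ → 0ℚ ℚ.< δ → Close δ x y) → x ≈ y
  close⇒≈ h = mk≈ λ ε ε>0 → let mkClose (N , k) = h (½ ℚ.* ε) (half>0 ε>0) in
    N , λ n N≤n → ℚ.≤-<-trans (k n N≤n) (half< ε ε>0)

  ⊓-pos : ∀ {p q} → 0ℚ ℚ.< p → 0ℚ ℚ.< q → 0ℚ ℚ.< p ℚ.⊓ q
  ⊓-pos {p} {q} p>0 q>0 with ℚ.≤-total p q
  ... | inj₁ p≤q = subst (0ℚ ℚ.<_) (sym (ℚ.p≤q⇒p⊓q≡p p≤q)) p>0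
  ... | inj₂ q≤p = subst (0ℚ ℚ.<_) (sym (ℚ.p≥q⇒p⊓q≡q q≤p)) q>0

  opaque
    unfolding _+_ 1/1+∣_∣

    close-+ : ∀ {δ ε} a b c d → Close δ a b → Close ε c d → Close (δ ℚ.+ ε) (a + c) (b + d)
    close-+ {δ} {ε} a b c d (mkClose (M , h)) (mkClose (N , k)) = mkClose (M ℕ.⊔ N , λ n ≤n → subst (ℚ._≤ δ ℚ.+ ε)
      (cong ℚ.∣_∣ (solve 4 (λ a b c d → a :- b :+ (c :- d) := a :+ c :- (b :+ d)) refl
        (seq a n) (seq b n) (seq c n) (seq d n)))
      (ℚ.≤-trans (ℚ.∣p+q∣≤∣p∣+∣q∣ (seq a n ℚ.- seq b n) (seq c n ℚ.- seq d n))
        (ℚ.+-mono-≤ (h n (⊔≤ˡ ≤n)) (k n (⊔≤ʳ {M} ≤n)))))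
      where open ℚ.+-*-Solver

    close-neg : ∀ {δ} a b → Close δ a b → Close δ (- a) (- b)
    close-neg a b (mkClose (N , h)) = mkClose (N , λ n N≤n → ℚ.≤-trans (neg-lip (seq a n) (seq b n)) (h n N≤n))

    close-∣∣ : ∀ {δ} a b → Close δ a b → Close δ ∣ a ∣ ∣ b ∣
    close-∣∣ a b (mkClose (N , h)) = mkClose (N , λ n N≤n → ℚ.≤-trans (∣∣-lip (seq a n) (seq b n)) (h n N≤n))

    close-1/ : ∀ {δ} a b → Close δ a b → Close δ 1/1+∣ a ∣ 1/1+∣ b ∣
    close-1/ a b (mkClose (N , h)) = mkClose (N , λ n N≤n → ℚ.≤-trans (reciprocal-lip (seq a n) (seq b n)) (h n N≤n))

    close-* : ∀ a c ε → 0ℚ ℚ.< ε → ∃[ δ ] 0ℚ ℚ.< δ ×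
              (∀ b d → Close δ a b → Close δ c d → Close ε (a * c) (b * d))
    close-* a c ε ε>0 =
      let A , A>0 , K , a≤A = eventualBound a
          C , C>0 , L , c≤C = eventualBound c
          C+1>0 = ℚ.positive (ℚ.+-mono-< (ℚ.positive⁻¹ C {{C>0}}) (ℚ.positive⁻¹ 1ℚ))
          α , α>0 , hA = scale A {{A>0}} (½ ℚ.* ε) (half>0 ε>0)
          β , β>0 , hC = scale (C ℚ.+ 1ℚ) {{C+1>0}} (½ ℚ.* ε) (half>0 ε>0)
          -- Halving makes γ strictly smaller than α and β, as `scale` wants strict bounds while
          -- `Close` gives weak ones. The cap by 1 in δ keeps |d| below C + 1, the bound for which β
          -- was chosen.
          γ = ½ ℚ.* (α ℚ.⊓ β)
          α⊓β>0 = ⊓-pos α>0 β>0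
          γ<α = ℚ.<-≤-trans (half< _ α⊓β>0) (ℚ.p⊓q≤p α β)
          γ<β = ℚ.<-≤-trans (half< _ α⊓β>0) (ℚ.p⊓q≤q α β)
          δ = γ ℚ.⊓ 1ℚ
      in δ , ⊓-pos (half>0 α⊓β>0) (ℚ.positive⁻¹ 1ℚ) ,
         λ { b d (mkClose (M , a~b)) (mkClose (N , c~d)) →
           mkClose ((K ℕ.⊔ L) ℕ.⊔ (M ℕ.⊔ N) , λ n ≤n →
             let δ-bound-ab = a~b n (⊔≤ˡ {M} (⊔≤ʳ {K ℕ.⊔ L} ≤n))
                 δ-bound-cd = c~d n (⊔≤ʳ {M} (⊔≤ʳ {K ℕ.⊔ L} ≤n))
             in ℚ.≤-trans (*-dist (seq a n) (seq c n) (seq b n) (seq d n))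
               (subst (_ ℚ.≤_) (half+half ε) (ℚ.+-mono-≤
                 (ℚ.<⇒≤ (hA _ _ (a≤A n (⊔≤ˡ {K} (⊔≤ˡ ≤n))) (ℚ.0≤∣p∣ (seq c n ℚ.- seq d n))
                   (ℚ.≤-<-trans δ-bound-cd (ℚ.≤-<-trans (ℚ.p⊓q≤p γ 1ℚ) γ<α))))
                 (ℚ.<⇒≤ (hC _ _
                   (bound (seq c n) (seq d n) (c≤C n (⊔≤ʳ {K} (⊔≤ˡ ≤n)))
                     (ℚ.≤-trans δ-bound-cd (ℚ.p⊓q≤q γ 1ℚ)))
                   (ℚ.0≤∣p∣ (seq a n ℚ.- seq b n))
                   (ℚ.≤-<-trans δ-bound-ab (ℚ.≤-<-trans (ℚ.p⊓q≤p γ 1ℚ) γ<β))))))) }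
      where
      open ℚ.+-*-Solver
      bound : ∀ c d {C} → ℚ.∣ c ∣ ℚ.≤ C → ℚ.∣ c ℚ.- d ∣ ℚ.≤ 1ℚ → ℚ.∣ d ∣ ℚ.≤ C ℚ.+ 1ℚ
      bound c d {C} c≤C c~d = ℚ.≤-trans
        (subst (λ z → ℚ.∣ z ∣ ℚ.≤ ℚ.∣ c ∣ ℚ.+ ℚ.∣ ℚ.- (c ℚ.- d) ∣)
          (solve 2 (λ c d → c :+ :- (c :- d) := d) refl c d)
          (ℚ.∣p+q∣≤∣p∣+∣q∣ c (ℚ.- (c ℚ.- d))))
        (ℚ.+-mono-≤ c≤C (ℚ.≤-trans (ℚ.≤-reflexive (ℚ.∣-p∣≡∣p∣ (c ℚ.- d))) c~d))

  Nearby : ∀ X → ℚ → Point X → Point X → Set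
  Nearby X δ x y = ∀ i → Close δ (coord X x i) (coord X y i)

  record Continuous (X : Space) (f : Point X → ℝ) : Set where
    constructor mkContinuous
    field modulus : ∀ x ε → 0ℚ ℚ.< ε → ∃[ δ ] 0ℚ ℚ.< δ × (∀ y → Nearby X δ x y → Close ε (f x) (f y))
  open Continuous public

  module _ {X : Space} where

    nearby-mono : ∀ {δ ε} {x y : Point X} → δ ℚ.≤ ε → Nearby X δ x y → Nearby X ε x y
    nearby-mono δ≤ε h i = close-mono δ≤ε (h i)

    const-continuous : ∀ c → Continuous X (λ _ → c)
    const-continuous c = mkContinuous λ x ε ε>0 → ε , ε>0 , λ y _ → close-refl c ε>0

    coord-continuous : ∀ i → Continuous X (λ x → coord X x i)
    coord-continuous i = mkContinuous λ x ε ε>0 → ε , ε>0 , λ y h → h i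

    +-continuous : ∀ {f g} → Continuous X f → Continuous X g → Continuous X (λ x → f x + g x)
    +-continuous {f} {g} hf hg = mkContinuous λ x ε ε>0 →
      let α , α>0 , kf = modulus hf x _ (half>0 ε>0)
          β , β>0 , kg = modulus hg x _ (half>0 ε>0)
      in α ℚ.⊓ β , ⊓-pos α>0 β>0 , λ y h → subst (λ e → Close e (f x + g x) (f y + g y)) (half+half ε)
           (close-+ (f x) (f y) (g x) (g y) (kf y (nearby-mono (ℚ.p⊓q≤p α β) h)) (kg y (nearby-mono (ℚ.p⊓q≤q α β) h)))

    *-continuous : ∀ {f g} → Continuous X f → Continuous X g → Continuous X (λ x → f x * g x)
    *-continuous {f} {g} hf hg = mkContinuous λ x ε ε>0 →
      let γ , γ>0 , k = close-* (f x) (g x) ε ε>0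
          α , α>0 , kf = modulus hf x γ γ>0
          β , β>0 , kg = modulus hg x γ γ>0
      in α ℚ.⊓ β , ⊓-pos α>0 β>0 , λ y h →
           k (f y) (g y) (kf y (nearby-mono (ℚ.p⊓q≤p α β) h)) (kg y (nearby-mono (ℚ.p⊓q≤q α β) h))

    private
      lipschitz : ∀ {f} (φ : ℝ → ℝ) → (∀ {δ} a b → Close δ a b → Close δ (φ a) (φ b)) →
                  Continuous X f → Continuous X (φ ∘ f)
      lipschitz {f} φ lip hf = mkContinuous λ x ε ε>0 → let δ , δ>0 , k = modulus hf x ε ε>0 in
        δ , δ>0 , λ y h → lip (f x) (f y) (k y h)

    neg-continuous : ∀ {f} → Continuous X f → Continuous X (λ x → - f x)
    neg-continuous = lipschitz -_ close-neg

    ∣∣-continuous : ∀ {f} → Continuous X f → Continuous X (λ x → ∣ f x ∣)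
    ∣∣-continuous = lipschitz ∣_∣ close-∣∣

    1/-continuous : ∀ {f} → Continuous X f → Continuous X (λ x → 1/1+∣ f x ∣)
    1/-continuous = lipschitz 1/1+∣_∣ close-1/

    sub-continuous : ∀ {f g} → Continuous X f → Continuous X g → Continuous X (λ x → f x - g x)
    sub-continuous hf hg = +-continuous hf (neg-continuous hg)

    sum-continuous : ∀ {n} {f : Point X → Vector ℝ n} → (∀ i → Continuous X (λ x → f x i)) →
                     Continuous X (λ x → sum (f x))
    sum-continuous {ℕ.zero}  h = const-continuous 0ℝ
    sum-continuous {ℕ.suc n} {f} h = +-continuous (h zero) (sum-continuous {n} {λ x → f x ∘ suc} (h ∘ suc))

  IsContinuous : ∀ X Y → (Point X → Point Y) → Set
  IsContinuous X Y f = ∀ i → Continuous X (λ x → coord Y (f x) i)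

  common-modulus : ∀ {X n} {f : Point X → Vector ℝ n} → (∀ i → Continuous X (λ x → f x i)) →
    ∀ x ε → 0ℚ ℚ.< ε → ∃[ δ ] 0ℚ ℚ.< δ × (∀ y → Nearby X δ x y → ∀ i → Close ε (f x i) (f y i))
  common-modulus {X} {n = ℕ.zero}  h x ε ε>0 = ε , ε>0 , λ y _ ()
  common-modulus {X} {n = ℕ.suc n} h x ε ε>0 =
    let α , α>0 , k = modulus (h zero) x ε ε>0
        β , β>0 , l = common-modulus (h ∘ suc) x ε ε>0
    in α ℚ.⊓ β , ⊓-pos α>0 β>0 , λ y near → λ where
         zero    → k y (nearby-mono {X} (ℚ.p⊓q≤p α β) near)
         (suc i) → l y (nearby-mono {X} (ℚ.p⊓q≤q α β) near) i

  ∘-continuous : ∀ {X Y} {g : Point X → Point Y} {f : Point Y → ℝ} →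
    Continuous Y f → IsContinuous X Y g → Continuous X (f ∘ g)
  ∘-continuous {g = g} hf hg = mkContinuous λ x ε ε>0 →
    let η , η>0 , kf = modulus hf (g x) ε ε>0
        δ , δ>0 , kg = common-modulus hg x η η>0
    in δ , δ>0 , λ y near → kf (g y) (kg y near)

  ++-continuous : ∀ {X m n} {f : Point X → Vector ℝ m} {g : Point X → Vector ℝ n} →
    (∀ i → Continuous X (λ x → f x i)) → (∀ j → Continuous X (λ x → g x j)) →
    ∀ k → Continuous X (λ x → (f x ++ g x) k)
  ++-continuous {m = m} hf hg k with splitAt m k
  ... | inj₁ i = hf i
  ... | inj₂ j = hg j

  proj₁-continuous : ∀ {X Y} → IsContinuous (X ×ˢ Y) X proj₁
  proj₁-continuous {X} {Y} i = mkContinuous λ x ε ε>0 → ε , ε>0 , λ y h → subst₂ (Close ε)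
    (lookup-++ˡ (coord X (proj₁ x)) (coord Y (proj₂ x)) i) (lookup-++ˡ (coord X (proj₁ y)) (coord Y (proj₂ y)) i)
    (h (i ↑ˡ dim Y))

  proj₂-continuous : ∀ {X Y} → IsContinuous (X ×ˢ Y) Y proj₂
  proj₂-continuous {X} {Y} i = mkContinuous λ x ε ε>0 → ε , ε>0 , λ y h → subst₂ (Close ε)
    (lookup-++ʳ (coord X (proj₁ x)) (coord Y (proj₂ x)) i) (lookup-++ʳ (coord X (proj₁ y)) (coord Y (proj₂ y)) i)
    (h (dim X ↑ʳ i))

  -- Maps, homeomorphisms and homotopy equivalences

  Same : ∀ X → Point X → Point X → Set
  Same X x y = ∀ i → coord X x i ≈ coord X y i

  same-× : ∀ X Y {x x' y y'} → Same X x x' → Same Y y y' → Same (X ×ˢ Y) (x , y) (x' , y')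
  same-× X Y h k i with splitAt (dim X) i
  ... | inj₁ j = h j
  ... | inj₂ j = k j

  infix 1 _⇾_
  record _⇾_ (X Y : Space) : Set where
    constructor mkMap
    field
      apply      : Point X → Point Y
      continuity : IsContinuous X Y apply
  open _⇾_ public

  -- Points with equal coordinates are nearby at every scale, so continuity makes their images close
  -- within every ε, that is, equal.
  apply-same : ∀ {X Y} (f : X ⇾ Y) {x x'} → Same X x x' → Same Y (apply f x) (apply f x')
  apply-same {X} {Y} f {x} {x'} h i = close⇒≈ λ ε ε>0 →
    let δ , δ>0 , k = modulus (continuity f i) x ε ε>0 in k x' (λ j → ≈⇒close δ>0 (h j))

  infixr 9 _⊚_
  _⊚_ : ∀ {X Y Z} → Y ⇾ Z → X ⇾ Y → X ⇾ Z
  g ⊚ f = mkMap (apply g ∘ apply f) λ i → ∘-continuous (continuity g i) (continuity f)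

  _⊗_ : ∀ {X X' Y Y'} → X ⇾ X' → Y ⇾ Y' → X ×ˢ Y ⇾ X' ×ˢ Y'
  _⊗_ {X} {X'} {Y} {Y'} f g = mkMap (λ (x , y) → apply f x , apply g y)
    (++-continuous {f = λ (x , y) → coord X' (apply f x)} {g = λ (x , y) → coord Y' (apply g y)}
      (λ i → ∘-continuous (continuity f i) (proj₁-continuous {X} {Y}))
      (λ j → ∘-continuous (continuity g j) (proj₂-continuous {X} {Y})))

  infix 1 _≅_
  record _≅_ (X Y : Space) : Set where
    field
      forth      : X ⇾ Y
      back       : Y ⇾ X
      back-forth : ∀ x → Same X (apply back (apply forth x)) x
      forth-back : ∀ y → Same Y (apply forth (apply back y)) y
  open _≅_ public

  same-trans : ∀ X {x y z} → Same X x y → Same X y z → Same X x z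
  same-trans X h k i = ≈-trans (h i) (k i)

  ≅-sym : ∀ {X Y} → X ≅ Y → Y ≅ X
  ≅-sym h = record { forth = back h ; back = forth h ; back-forth = forth-back h ; forth-back = back-forth h }

  ≅-trans : ∀ {X Y Z} → X ≅ Y → Y ≅ Z → X ≅ Z
  ≅-trans {X} {Y} {Z} h k = record
    { forth = forth k ⊚ forth h
    ; back  = back h ⊚ back k
    ; back-forth = λ x → same-trans X (apply-same (back h) (back-forth k (apply (forth h) x))) (back-forth h x)
    ; forth-back = λ z → same-trans Z (apply-same (forth k) (forth-back h (apply (back k) z))) (forth-back k z)
    }

  ≅-× : ∀ {X X' Y Y'} → X ≅ X' → Y ≅ Y' → X ×ˢ Y ≅ X' ×ˢ Y'
  ≅-× {X} {X'} {Y} {Y'} h k = record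
    { forth = forth h ⊗ forth k
    ; back  = back h ⊗ back k
    ; back-forth = λ (x , y) → same-× X Y (back-forth h x) (back-forth k y)
    ; forth-back = λ (x , y) → same-× X' Y' (forth-back h x) (forth-back k y)
    }

  opaque
    unfolding _+_

    continuous⇒ε-δ : ∀ {X Y} {f : Point X → Point Y} → IsContinuous X Y f → ∀ x ε → 0ℝ < ε →
      ∃[ δ ] 0ℝ < δ × (∀ y → Near X δ x y → Near Y ε (f x) (f y))
    continuous⇒ε-δ {X} {Y} cf x ε (ε₀ , ε₀>0 , M , ε₀≤ε) =
      -- Only half of the rational lower bound ε₀ of ε is spent on closeness; the other half
      -- witnesses the strict inequality in `Near`.
      let δ , δ>0 , k = common-modulus {X} cf x (½ ℚ.* ε₀) (half>0 ε₀>0) in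
      fromℚ δ , (δ , δ>0 , 0 , λ _ _ → ℚ.≤-reflexive (ℚ.+-identityˡ δ)) ,
      λ y near i → let gap = λ j n → ℚ.∣ seq (coord X x j) n ℚ.- seq (coord X y j) n ∣ in
        let mkClose (N , l) = k y (λ j → let η , η>0 , L , m = near j in
              mkClose (L , λ n L≤n → ℚ.≤-trans
                (ℚ.≤-trans (ℚ.≤-reflexive (sym (ℚ.+-identityʳ (gap j n)))) (ℚ.+-monoʳ-≤ (gap j n) (ℚ.<⇒≤ η>0)))
                (m n L≤n))) i
        in ½ ℚ.* ε₀ , half>0 ε₀>0 , M ℕ.⊔ N , λ n ≤n → ℚ.≤-trans
             (ℚ.+-monoˡ-≤ (½ ℚ.* ε₀) (l n (⊔≤ʳ {M} ≤n)))
             (ℚ.≤-trans (ℚ.≤-reflexive (trans (half+half ε₀) (sym (ℚ.+-identityˡ ε₀))))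
               (ε₀≤ε n (⊔≤ˡ ≤n)))

  ⇾⇒continuousMap : ∀ {X Y} → X ⇾ Y → ContinuousMap X Y
  ⇾⇒continuousMap {X} {Y} f = record { fun = apply f ; continuous = continuous⇒ε-δ {X} {Y} (continuity f) }

  record Deformation {X : Space} (f : X ⇾ X) : Set where
    field
      along  : X ×ˢ UnitInterval ⇾ X
      starts : ∀ x → Same X (apply along (x , I₀)) (apply f x)
      ends   : ∀ x → Same X (apply along (x , I₁)) x
  open Deformation public

  constant-deformation : ∀ {X} (f : X ⇾ X) → (∀ x → Same X (apply f x) x) → Deformation f
  constant-deformation {X} f h = record
    { along  = f ⊚ mkMap proj₁ (proj₁-continuous {X} {UnitInterval})
    ; starts = λ x i → ≈-refl
    ; ends   = h
    }

  deformation⇒≃ₕ : ∀ {X Y} (f : X ⇾ Y) (g : Y ⇾ X) → Deformation (g ⊚ f) → Deformation (f ⊚ g) → X ≃ₕ Y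
  deformation⇒≃ₕ {X} {Y} f g h k = record
    { to      = ⇾⇒continuousMap f
    ; from    = ⇾⇒continuousMap g
    ; from∘to = record
        { map      = ⇾⇒continuousMap (along h)
        ; startsAt = λ x i → ≈⇒≃ (starts h x i)
        ; endsAt   = λ x i → ≈⇒≃ (ends h x i) }
    ; to∘from = record
        { map      = ⇾⇒continuousMap (along k)
        ; startsAt = λ y i → ≈⇒≃ (starts k y i)
        ; endsAt   = λ y i → ≈⇒≃ (ends k y i) }
    }

  -- Inserting `forth k` and then `back k` between f and g changes nothing up to equality of points,
  -- so the given homotopy is reused and only its starting equation is adjusted. The composite on Z
  -- is already the identity.
  ≃ₕ-≅ : ∀ {X Y Z} (f : X ⇾ Y) (g : Y ⇾ X) → Deformation (g ⊚ f) → (∀ y → Same Y (apply f (apply g y)) y) →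
    Y ≅ Z → X ≃ₕ Z
  ≃ₕ-≅ {X} {Y} {Z} f g h same k = deformation⇒≃ₕ (forth k ⊚ f) (g ⊚ back k)
    (record
      { along  = along h
      ; starts = λ x → same-trans X (starts h x)
          (apply-same g (λ i → ≈-sym (back-forth k (apply f x) i)))
      ; ends   = ends h })
    (constant-deformation ((forth k ⊚ f) ⊚ (g ⊚ back k)) λ z →
      same-trans Z (apply-same (forth k) (same (apply (back k) z))) (forth-back k z))

  -- Cycles

  Edge : ∀ m → Fin m → Fin m → Set
  Edge m i j = toℕ j ≡ ℕ.suc (toℕ i) ⊎ (toℕ j ≡ 0 × ℕ.suc (toℕ i) ≡ m)

  SupportedOn : ∀ {m} → Vector ℝ m → Fin m → Fin m → Set
  SupportedOn α i j = ∀ v → v ≢ i → v ≢ j → α v ≈ 0ℝ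

  -- For m ≥ 3 this is the geometric realization of the m-cycle. The carrying edge is asserted only
  -- under a double negation, because it cannot be computed from the coordinates of a point.
  Cycle : ℕ → Space
  Cycle m = record
    { Point = Σ[ α ∈ Vector ℝ m ] (∀ v → NonNeg (α v)) × sum α ≈ 1ℝ ×
                ¬ ¬ (∃[ i ] ∃[ j ] Edge m i j × SupportedOn α i j)
    ; dim   = m
    ; coord = proj₁
    }

  min : ℝ → ℝ → ℝ
  min x y = ½ℝ * (x + y - ∣ x - y ∣)

  min-continuous : ∀ {X f g} → Continuous X f → Continuous X g → Continuous X (λ x → min (f x) (g x))
  min-continuous hf hg = *-continuous (const-continuous ½ℝ)
    (sub-continuous (+-continuous hf hg) (∣∣-continuous (sub-continuous hf hg)))

  min-left : ∀ {x y} → NonNeg (y - x) → min x y ≈ x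
  min-left {x} {y} h = by-eq (- ½ℝ)
    (solve 3 (λ x y a → con ½ :* (x :+ y :- a) := x :+ (:- con ½) :* (a :- :- (x :- y))) ≈-refl x y ∣ x - y ∣)
    (nonPos⇒∣∣ (nonNeg-resp-≈ (solve 2 (λ x y → y :- x := :- (x :- y)) ≈-refl x y) h))
    where open ℝ-Solver

  min-right : ∀ {x y} → NonNeg (x - y) → min x y ≈ y
  min-right {x} {y} h = by-eq (- ½ℝ)
    (solve 3 (λ x y a → con ½ :* (x :+ y :- a) := y :+ (:- con ½) :* (a :- (x :- y))) ≈-refl x y ∣ x - y ∣)
    (nonNeg⇒∣∣ h)
    where open ℝ-Solver

  min-cases : ∀ x y → ¬ ¬ ((NonNeg (y - x) × min x y ≈ x) ⊎ (NonNeg (x - y) × min x y ≈ y))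
  min-cases x y = ¬¬-map (λ where
      (inj₁ h) → inj₂ (h , min-right h)
      (inj₂ h) → let h' = nonNeg-resp-≈ (solve 2 (λ x y → :- (x :- y) := y :- x) ≈-refl x y) h in
                 inj₁ (h' , min-left h'))
    (nonNeg-total (x - y))
    where open ℝ-Solver

  nonNeg-zero : ∀ {x} → x ≈ 0ℝ → NonNeg x
  nonNeg-zero x≈0 = ∣∣⇒nonNeg (≈-trans (∣∣-cong x≈0) (≈-trans ∣∣-zero (≈-sym x≈0)))

  min-nonNeg : ∀ {x y} → NonNeg x → NonNeg y → NonNeg (min x y)
  min-nonNeg {x} {y} hx hy = nonNeg-stable (¬¬-map (λ where
      (inj₁ (_ , e)) → nonNeg-resp-≈ (≈-sym e) hx
      (inj₂ (_ , e)) → nonNeg-resp-≈ (≈-sym e) hy)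
    (min-cases x y))

  min≤left : ∀ x y → NonNeg (x - min x y)
  min≤left x y = nonNeg-stable (¬¬-map (λ where
      (inj₁ (_ , e)) → nonNeg-zero (≈-trans (+-cong ≈-refl (neg-cong e)) (+-inverseʳ x))
      (inj₂ (h , e)) → nonNeg-resp-≈ (+-cong ≈-refl (neg-cong (≈-sym e))) h)
    (min-cases x y))

  min≤right : ∀ x y → NonNeg (y - min x y)
  min≤right x y = nonNeg-stable (¬¬-map (λ where
      (inj₁ (h , e)) → nonNeg-resp-≈ (+-cong ≈-refl (neg-cong (≈-sym e))) h
      (inj₂ (_ , e)) → nonNeg-zero (≈-trans (+-cong ≈-refl (neg-cong e)) (+-inverseʳ y)))
    (min-cases x y))

  sub-zero : ∀ {x y} → y ≈ 0ℝ → x - y ≈ x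
  sub-zero {x} e = ≈-trans (+-cong ≈-refl (neg-cong e)) (solve 1 (λ x → x :- con 0ℚ := x) ≈-refl x)
    where open ℝ-Solver

  zero-min-left : ∀ {x y} → x ≈ 0ℝ → NonNeg y → min x y ≈ 0ℝ
  zero-min-left x≈0 hy = ≈-trans (min-left (nonNeg-resp-≈ (≈-sym (sub-zero x≈0)) hy)) x≈0

  zero-min-right : ∀ {x y} → y ≈ 0ℝ → NonNeg x → min x y ≈ 0ℝ
  zero-min-right y≈0 hx = ≈-trans (min-right (nonNeg-resp-≈ (≈-sym (sub-zero y≈0)) hx)) y≈0

  -- The subdivision of the edge {0,1}, with 1 as the new vertex.
  module Subdivision (r : ℕ) where
    private
      m : ℕ
      m = 3 ℕ.+ r

    -- With c the smaller of the weights at 0 and 1, the point is rewritten by trading c of each for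
    -- 2c at the midpoint. At least one end weight is then exhausted, which selects the half edge;
    -- off the edge c is 0, so one formula serves the whole cycle.
    subdivide : Vector ℝ m → Vector ℝ (1 ℕ.+ m)
    subdivide α zero                = α zero - min (α zero) (α (suc zero))
    subdivide α (suc zero)          = min (α zero) (α (suc zero)) + min (α zero) (α (suc zero))
    subdivide α (suc (suc zero))    = α (suc zero) - min (α zero) (α (suc zero))
    subdivide α (suc (suc (suc v))) = α (suc (suc v))

    -- The affine map sending the new vertex to the midpoint of the divided edge.
    join : Vector ℝ (1 ℕ.+ m) → Vector ℝ m
    join β zero          = β zero + ½ℝ * β (suc zero)
    join β (suc zero)    = β (suc (suc zero)) + ½ℝ * β (suc zero)
    join β (suc (suc v)) = β (suc (suc (suc v)))

    -- On the divided edge `min-cases` tells which half carries the image. On any other edge one of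
    -- the two end weights is 0, so the minimum vanishes and nonzero indices merely shift by one.
    subdivide-support : ∀ α → (∀ v → NonNeg (α v)) → ∀ i j → Edge m i j → SupportedOn α i j →
      ¬ ¬ (∃[ i ] ∃[ j ] Edge (1 ℕ.+ m) i j × SupportedOn (subdivide α) i j)
    subdivide-support α 0≤α zero (suc zero) (inj₁ refl) s = ¬¬-map (λ where
        (inj₁ (_ , c)) → suc zero , suc (suc zero) , inj₁ refl , λ where
          zero                _ _ → ≈-trans (+-cong ≈-refl (neg-cong c)) (+-inverseʳ _)
          (suc zero)          p _ → contradiction refl p
          (suc (suc zero))    _ p → contradiction refl p
          (suc (suc (suc v))) _ _ → s (suc (suc v)) (λ ()) (λ ())
        (inj₂ (_ , c)) → zero , suc zero , inj₁ refl , λ where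
          zero                p _ → contradiction refl p
          (suc zero)          _ p → contradiction refl p
          (suc (suc zero))    _ _ → ≈-trans (+-cong ≈-refl (neg-cong c)) (+-inverseʳ _)
          (suc (suc (suc v))) _ _ → s (suc (suc v)) (λ ()) (λ ()))
      (min-cases (α zero) (α (suc zero)))
    subdivide-support α 0≤α (suc (suc i)) zero (inj₂ (_ , e)) s k =
      k (suc (suc (suc i)) , zero , inj₂ (refl , cong ℕ.suc e) , λ where
          zero                _ p → contradiction refl p
          (suc zero)          _ _ → zero-sum c≈0 c≈0
          (suc (suc zero))    _ _ → zero-sub α₁≈0 c≈0
          (suc (suc (suc v))) p _ → s (suc (suc v)) (p ∘ cong suc) (λ ()))
      where
      α₁≈0 : α (suc zero) ≈ 0ℝ
      α₁≈0 = s (suc zero) (λ ()) (λ ())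
      c≈0 : min (α zero) (α (suc zero)) ≈ 0ℝ
      c≈0 = zero-min-right α₁≈0 (0≤α zero)
    subdivide-support α 0≤α (suc i) (suc j) (inj₁ e) s k =
      k (suc (suc i) , suc (suc j) , inj₁ (cong ℕ.suc e) , λ where
          zero                _ _ → zero-sub α₀≈0 c≈0
          (suc zero)          _ _ → zero-sum c≈0 c≈0
          (suc (suc zero))    p q → ≈-trans (sub-zero c≈0) (s (suc zero) (p ∘ cong suc) (q ∘ cong suc))
          (suc (suc (suc v))) p q → s (suc (suc v)) (p ∘ cong suc) (q ∘ cong suc))
      where
      α₀≈0 : α zero ≈ 0ℝ
      α₀≈0 = s zero (λ ()) (λ ())
      c≈0 : min (α zero) (α (suc zero)) ≈ 0ℝ
      c≈0 = zero-min-left α₀≈0 (0≤α (suc zero))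

    subdivide-sum : ∀ α → sum (subdivide α) ≈ sum α
    subdivide-sum α = solve 4 (λ x y c R → x :- c :+ (c :+ c :+ (y :- c :+ R)) := x :+ (y :+ R)) ≈-refl
      (α zero) (α (suc zero)) (min (α zero) (α (suc zero))) (sum (λ v → α (suc (suc v))))
      where open ℝ-Solver

    subdivide-map : Cycle m ⇾ Cycle (1 ℕ.+ m)
    subdivide-map = mkMap
      (λ (α , 0≤α , ∑α , sup) → subdivide α ,
        (λ where
          zero                → min≤left (α zero) (α (suc zero))
          (suc zero)          → nonNeg-+ (min-nonNeg (0≤α zero) (0≤α (suc zero))) (min-nonNeg (0≤α zero) (0≤α (suc zero)))
          (suc (suc zero))    → min≤right (α zero) (α (suc zero))
          (suc (suc (suc v))) → 0≤α (suc (suc v))) ,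
        ≈-trans (subdivide-sum α) ∑α ,
        λ k → sup λ (i , j , e , s) → subdivide-support α 0≤α i j e s k)
      (λ where
          zero                → sub-continuous (coord-continuous zero) c
          (suc zero)          → +-continuous c c
          (suc (suc zero))    → sub-continuous (coord-continuous (suc zero)) c
          (suc (suc (suc v))) → coord-continuous (suc (suc v)))
      where
      c : Continuous (Cycle m) (λ (α , _) → min (α zero) (α (suc zero)))
      c = min-continuous (coord-continuous zero) (coord-continuous (suc zero))

    zero-half : ∀ {x y} → x ≈ 0ℝ → y ≈ 0ℝ → x + ½ℝ * y ≈ 0ℝ
    zero-half x≈0 y≈0 = zero-sum x≈0 (zero-product ½ℝ y≈0)

    join-support : ∀ β i j → Edge (1 ℕ.+ m) i j → SupportedOn β i j →
      ∃[ i ] ∃[ j ] Edge m i j × SupportedOn (join β) i j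
    join-support β zero (suc zero) (inj₁ refl) s = zero , suc zero , inj₁ refl , λ where
      zero          p _ → contradiction refl p
      (suc zero)    _ p → contradiction refl p
      (suc (suc v)) _ _ → s (suc (suc (suc v))) (λ ()) (λ ())
    join-support β (suc zero) (suc (suc zero)) (inj₁ refl) s = zero , suc zero , inj₁ refl , λ where
      zero          p _ → contradiction refl p
      (suc zero)    _ p → contradiction refl p
      (suc (suc v)) _ _ → s (suc (suc (suc v))) (λ ()) (λ ())
    join-support β (suc (suc i)) zero (inj₂ (_ , e)) s = suc i , zero , inj₂ (refl , ℕ.suc-injective e) , λ where
      zero          _ p → contradiction refl p
      (suc zero)    p _ → zero-half (s (suc (suc zero)) (p ∘ suc-injective) (λ ())) (s (suc zero) (λ ()) (λ ()))
      (suc (suc v)) p _ → s (suc (suc (suc v))) (p ∘ suc-injective) (λ ())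
    join-support β (suc (suc i)) (suc (suc j)) (inj₁ e) s = suc i , suc j , inj₁ (ℕ.suc-injective e) , λ where
      zero          _ _ → zero-half (s zero (λ ()) (λ ())) (s (suc zero) (λ ()) (λ ()))
      (suc zero)    p q → zero-half (s (suc (suc zero)) (p ∘ suc-injective) (q ∘ suc-injective)) (s (suc zero) (λ ()) (λ ()))
      (suc (suc v)) p q → s (suc (suc (suc v))) (p ∘ suc-injective) (q ∘ suc-injective)

    join-sum : ∀ β → sum (join β) ≈ sum β
    join-sum β = solve 4 (λ x y z R → x :+ con ½ :* y :+ (z :+ con ½ :* y :+ R) := x :+ (y :+ (z :+ R))) ≈-refl
      (β zero) (β (suc zero)) (β (suc (suc zero))) (sum (λ v → β (suc (suc (suc v)))))
      where open ℝ-Solver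

    join-map : Cycle (1 ℕ.+ m) ⇾ Cycle m
    join-map = mkMap
      (λ (β , 0≤β , ∑β , sup) → join β ,
        (λ where
          zero          → nonNeg-+ (0≤β zero) (½≥0 (0≤β (suc zero)))
          (suc zero)    → nonNeg-+ (0≤β (suc (suc zero))) (½≥0 (0≤β (suc zero)))
          (suc (suc v)) → 0≤β (suc (suc (suc v)))) ,
        ≈-trans (join-sum β) ∑β ,
        ¬¬-map (λ (i , j , e , s) → join-support β i j e s) sup)
      (λ where
          zero          → +-continuous (coord-continuous zero) c
          (suc zero)    → +-continuous (coord-continuous (suc (suc zero))) c
          (suc (suc v)) → coord-continuous (suc (suc (suc v))))
      where
      ½≥0 : ∀ {x} → NonNeg x → NonNeg (½ℝ * x)
      ½≥0 = nonNeg-* (positive⇒nonNeg {½ℝ} (½ , ℚ.positive⁻¹ ½ , 0 , λ _ _ → ℚ.≤-refl))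
      c : Continuous (Cycle (1 ℕ.+ m)) (λ (β , _) → ½ℝ * β (suc zero))
      c = *-continuous (const-continuous ½ℝ) (coord-continuous (suc zero))

    -- Vertices 0 and 2 are not adjacent in a cycle of length 1 + m ≥ 4; in the closing edge the
    -- last vertex has index at least 3.
    outer-zero : ∀ β i j → Edge (1 ℕ.+ m) i j → SupportedOn β i j → β zero ≈ 0ℝ ⊎ β (suc (suc zero)) ≈ 0ℝ
    outer-zero β (suc i) (suc j) e s = inj₁ (s zero (λ ()) (λ ()))
    outer-zero β zero (suc zero) (inj₁ refl) s = inj₂ (s (suc (suc zero)) (λ ()) (λ ()))
    outer-zero β (suc (suc (suc i))) zero (inj₂ _) s = inj₂ (s (suc (suc zero)) (λ ()) (λ ()))

    -- Since one outer weight vanishes, the minimum formed after `join` recovers exactly the half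
    -- weight that was distributed, so subdividing again returns the original point.
    min-join : ∀ {x y z} → NonNeg x → NonNeg z → x ≈ 0ℝ ⊎ z ≈ 0ℝ → min (x + ½ℝ * y) (z + ½ℝ * y) ≈ ½ℝ * y
    min-join {x} {y} {z} hx hz (inj₁ x≈0) = ≈-trans
      (min-left (nonNeg-resp-≈ (by-eq 1ℝ
        (solve 3 (λ x y z → z :=
            z :+ con ½ :* y :- (x :+ con ½ :* y) :+ con ℚ.1ℚ :* (x :- con 0ℚ)) ≈-refl x y z) x≈0) hz))
      (≈-trans (+-cong x≈0 ≈-refl) (+-identityˡ _))
      where open ℝ-Solver
    min-join {x} {y} {z} hx hz (inj₂ z≈0) = ≈-trans
      (min-right (nonNeg-resp-≈ (by-eq 1ℝ
        (solve 3 (λ x y z → x :=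
            x :+ con ½ :* y :- (z :+ con ½ :* y) :+ con ℚ.1ℚ :* (z :- con 0ℚ)) ≈-refl x y z) z≈0) hx))
      (≈-trans (+-cong z≈0 ≈-refl) (+-identityˡ _))
      where open ℝ-Solver

    subdivision : Cycle m ≅ Cycle (1 ℕ.+ m)
    subdivision = record
      { forth = subdivide-map
      ; back  = join-map
      ; back-forth = λ (α , _) → λ where
          zero          → restore (α zero) (min (α zero) (α (suc zero)))
          (suc zero)    → restore (α (suc zero)) (min (α zero) (α (suc zero)))
          (suc (suc v)) → ≈-refl
      ; forth-back = λ (β , 0≤β , _ , sup) →
          let c≈ = ≈-stable (¬¬-map (λ (i , j , e , s) →
                     min-join (0≤β zero) (0≤β (suc (suc zero))) (outer-zero β i j e s)) sup)
          in λ where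
          zero                → remove c≈
          (suc zero)          → ≈-trans (+-cong c≈ c≈) (solve 1 (λ y → con ½ :* y :+ con ½ :* y := y) ≈-refl _)
          (suc (suc zero))    → remove c≈
          (suc (suc (suc v))) → ≈-refl
      }
      where
      open ℝ-Solver
      restore : ∀ x c → x - c + ½ℝ * (c + c) ≈ x
      restore = solve 2 (λ x c → x :- c :+ con ½ :* (c :+ c) := x) ≈-refl
      remove : ∀ {x y c} → c ≈ y → x + y - c ≈ x
      remove {x} {y} {c} c≈y = by-eq (- 1ℝ)
        (solve 3 (λ x y c → x :+ y :- c := x :+ (:- con 1ℚ) :* (c :- y)) ≈-refl x y c) c≈y

  opaque
    unfolding _+_

    ≈⇒on-circle : ∀ {x y} → x * x + y * y ≈ 1ℝ → x D.* x D.+ y D.* y ≃ 1ℝ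
    ≈⇒on-circle = ≈⇒≃

    on-circle⇒≈ : ∀ {x y} → x D.* x D.+ y D.* y ≃ 1ℝ → x * x + y * y ≈ 1ℝ
    on-circle⇒≈ = mk≈

  -- The circle

  four : ℚ
  four = 1ℚ ℚ.+ 1ℚ ℚ.+ 1ℚ ℚ.+ 1ℚ

  -- The 4-cycle is the join of the two-point sets {0,2} and {1,3}: its edges pick one vertex from
  -- each, so lying on an edge means that each opposite pair contains a zero.
  OppositeZeros : Vector ℝ 4 → Set
  OppositeZeros α = (α 0F ≈ 0ℝ ⊎ α 2F ≈ 0ℝ) × (α 1F ≈ 0ℝ ⊎ α 3F ≈ 0ℝ)

  supported⇒oppositeZeros : ∀ α → ∃[ i ] ∃[ j ] Edge 4 i j × SupportedOn α i j → OppositeZeros α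
  supported⇒oppositeZeros α (0F , 1F , inj₁ refl , s) = inj₂ (s 2F (λ ()) (λ ())) , inj₂ (s 3F (λ ()) (λ ()))
  supported⇒oppositeZeros α (1F , 2F , inj₁ refl , s) = inj₁ (s 0F (λ ()) (λ ())) , inj₂ (s 3F (λ ()) (λ ()))
  supported⇒oppositeZeros α (2F , 3F , inj₁ refl , s) = inj₁ (s 0F (λ ()) (λ ())) , inj₁ (s 1F (λ ()) (λ ()))
  supported⇒oppositeZeros α (3F , 0F , inj₁ () , s)
  supported⇒oppositeZeros α (3F , 1F , inj₁ () , s)
  supported⇒oppositeZeros α (3F , 2F , inj₁ () , s)
  supported⇒oppositeZeros α (3F , 3F , inj₁ () , s)
  supported⇒oppositeZeros α (3F , 0F , inj₂ (refl , refl) , s) = inj₂ (s 2F (λ ()) (λ ())) , inj₁ (s 1F (λ ()) (λ ()))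

  oppositeZeros⇒supported : ∀ α → OppositeZeros α → ∃[ i ] ∃[ j ] Edge 4 i j × SupportedOn α i j
  oppositeZeros⇒supported α (inj₂ z , inj₂ w) = 0F , 1F , inj₁ refl , λ where
    0F p q → contradiction refl p
    1F p q → contradiction refl q
    2F p q → z
    3F p q → w
  oppositeZeros⇒supported α (inj₁ z , inj₂ w) = 1F , 2F , inj₁ refl , λ where
    0F p q → z
    1F p q → contradiction refl p
    2F p q → contradiction refl q
    3F p q → w
  oppositeZeros⇒supported α (inj₁ z , inj₁ w) = 2F , 3F , inj₁ refl , λ where
    0F p q → z
    1F p q → w
    2F p q → contradiction refl p
    3F p q → contradiction refl q
  oppositeZeros⇒supported α (inj₂ z , inj₁ w) = 3F , 0F , inj₂ (refl , refl) , λ where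
    0F p q → contradiction refl q
    1F p q → w
    2F p q → z
    3F p q → contradiction refl p

  module _ {u v : ℝ} (0≤u : NonNeg u) (0≤v : NonNeg v) (disjoint : ¬ ¬ (u ≈ 0ℝ ⊎ v ≈ 0ℝ)) where

    -- The two squares differ by 4uv, and one of the factors is 0.
    disjoint-square : (u - v) * (u - v) ≈ (u + v) * (u + v)
    disjoint-square = ≈-stable (¬¬-map (λ where
        (inj₁ u≈0) → by-eq (v * fromℚ four) (solve 2 (λ u v → (u :- v) :* (u :- v) :=
            (u :+ v) :* (u :+ v) :+ v :* con four :* (con 0ℚ :- u)) ≈-refl u v) (≈-sym u≈0)
        (inj₂ v≈0) → by-eq (u * fromℚ four) (solve 2 (λ u v → (u :- v) :* (u :- v) :=
            (u :+ v) :* (u :+ v) :+ u :* con four :* (con 0ℚ :- v)) ≈-refl u v) (≈-sym v≈0))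
      disjoint)
      where open ℝ-Solver

    disjoint-∣∣ : ∣ u - v ∣ ≈ u + v
    disjoint-∣∣ = ≈-stable (¬¬-map (λ where
        (inj₁ u≈0) → ≈-trans (∣∣-cong (+-cong u≈0 ≈-refl)) (≈-trans
          (nonPos⇒∣∣ (nonNeg-resp-≈ (solve 1 (λ v → v := :- (con 0ℚ :- v)) ≈-refl v) 0≤v))
          (≈-trans (solve 1 (λ v → :- (con 0ℚ :- v) := con 0ℚ :+ v) ≈-refl v) (+-cong (≈-sym u≈0) ≈-refl)))
        (inj₂ v≈0) → ≈-trans (∣∣-cong (sub-zero v≈0)) (≈-trans (nonNeg⇒∣∣ 0≤u)
          (≈-trans (solve 1 (λ u → u := u :+ con 0ℚ) ≈-refl u) (+-cong ≈-refl (≈-sym v≈0)))))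
      disjoint)
      where open ℝ-Solver

  ∣∣-square : ∀ x → ∣ x ∣ * ∣ x ∣ ≈ x * x
  ∣∣-square x = ≈-stable (¬¬-map (λ where
      (inj₁ h) → *-cong (nonNeg⇒∣∣ h) (nonNeg⇒∣∣ h)
      (inj₂ h) → ≈-trans (*-cong (nonPos⇒∣∣ h) (nonPos⇒∣∣ h)) (solve 1 (λ x → (:- x) :* (:- x) := x :* x) ≈-refl x))
    (nonNeg-total x))
    where open ℝ-Solver

  ∣square∣ : ∀ x → ∣ x * x ∣ ≈ x * x
  ∣square∣ x = ≈-trans (∣∣-* x x) (∣∣-square x)

  ∣∣±-zero : ∀ x → ¬ ¬ ((∣ x ∣ + x ≈ 0ℝ) ⊎ (∣ x ∣ - x ≈ 0ℝ))
  ∣∣±-zero x = ¬¬-map (λ where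
      (inj₁ h) → inj₂ (≈-trans (+-cong (nonNeg⇒∣∣ h) ≈-refl) (+-inverseʳ x))
      (inj₂ h) → inj₁ (≈-trans (+-cong (nonPos⇒∣∣ h) ≈-refl) (+-inverseˡ x)))
    (nonNeg-total x)

  ∣∣+-nonNeg : ∀ x → NonNeg (∣ x ∣ + x)
  ∣∣+-nonNeg x = nonNeg-stable (¬¬-map (λ where
      (inj₁ h) → nonNeg-+ (∣∣-nonNeg x) h
      (inj₂ h) → nonNeg-zero (≈-trans (+-cong (nonPos⇒∣∣ h) ≈-refl) (+-inverseˡ x)))
    (nonNeg-total x))

  ∣∣--nonNeg : ∀ x → NonNeg (∣ x ∣ - x)
  ∣∣--nonNeg x = nonNeg-resp-≈ (+-cong (∣∣-neg x) ≈-refl) (∣∣+-nonNeg (- x))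

  ½-nonNeg : NonNeg ½ℝ
  ½-nonNeg = nonNeg-const (ℚ.<⇒≤ (ℚ.positive⁻¹ ½))

  -- With a = α₀ - α₂ and b = α₁ - α₃, so that ∣ a ∣ + ∣ b ∣ = 1, the point is
  -- (a (1 + ∣ b ∣), 2 b) / (1 + b²); for a ≥ 0 this is the stereographic
  -- parametrisation ((1 - b²), 2 b) / (1 + b²).
  module ToCircle (α : Vector ℝ 4) where
    a b B r x y : ℝ
    a = α 0F - α 2F
    b = α 1F - α 3F
    B = α 1F + α 3F
    r = 1/1+∣ b * b ∣
    x = a * (1ℝ + B) * r
    y = (b + b) * r

  -- In terms of a and b: a = 2 x / (1 + ∣ x ∣ + ∣ y ∣) and b = y / (1 + ∣ x ∣).
  module FromCircle (x y : ℝ) where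
    i k : ℝ
    i = 1/1+∣ x ∣
    k = 1/1+∣ ∣ x ∣ + ∣ y ∣ ∣

    β : Vector ℝ 4
    β 0F = (∣ x ∣ + x) * k
    β 1F = ½ℝ * (∣ y ∣ + y) * i
    β 2F = (∣ x ∣ - x) * k
    β 3F = ½ℝ * (∣ y ∣ - y) * i

  module _ (α : Vector ℝ 4) (0≤α : ∀ v → NonNeg (α v)) (∑α : sum α ≈ 1ℝ) (zeros : ¬ ¬ OppositeZeros α) where
    open ToCircle α
    open ≈-Reasoning
    open ℝ-Solver

    private
      A : ℝ
      A = α 0F + α 2F

      A≈1-B : A ≈ 1ℝ - B
      A≈1-B = by-eq 1ℝ (solve 4 (λ α₀ α₁ α₂ α₃ → α₀ :+ α₂ :=
        con 1ℚ :- (α₁ :+ α₃) :+ con 1ℚ :* (α₀ :+ (α₁ :+ (α₂ :+ (α₃ :+ con 0ℚ))) :- con 1ℚ)) ≈-refl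
        (α 0F) (α 1F) (α 2F) (α 3F)) ∑α

      a²≈ : a * a ≈ (1ℝ - B) * (1ℝ - B)
      a²≈ = ≈-trans (disjoint-square (0≤α 0F) (0≤α 2F) (¬¬-map proj₁ zeros)) (*-cong A≈1-B A≈1-B)

      b²≈ : b * b ≈ B * B
      b²≈ = disjoint-square (0≤α 1F) (0≤α 3F) (¬¬-map proj₂ zeros)

      inverse-r : (1ℝ + B * B) * r ≈ 1ℝ
      inverse-r = ≈-trans (*-cong (+-cong ≈-refl (≈-trans (≈-sym b²≈) (≈-sym (∣square∣ b)))) ≈-refl)
        (1/1+∣∣-inverse (b * b))

    -- Because a² = (1 - B)² and b² = B², this is the identity (1 - B²)² + 4B² = (1 + B²)² divided
    -- by the right-hand side.
    toCircle-norm : x * x + y * y ≈ 1ℝ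
    toCircle-norm = begin
      x * x + y * y
        ≈⟨ solve 4 (λ a b B r → a :* (con 1ℚ :+ B) :* r :* (a :* (con 1ℚ :+ B) :* r) :+ (b :+ b) :* r :* ((b :+ b) :* r) :=
             ((a :* a) :* ((con 1ℚ :+ B) :* (con 1ℚ :+ B)) :+ con four :* (b :* b)) :* (r :* r)) ≈-refl a b B r ⟩
      ((a * a) * ((1ℝ + B) * (1ℝ + B)) + fromℚ four * (b * b)) * (r * r)
        ≈⟨ *-cong (+-cong (*-cong a²≈ ≈-refl) (*-cong ≈-refl b²≈)) ≈-refl ⟩
      ((1ℝ - B) * (1ℝ - B) * ((1ℝ + B) * (1ℝ + B)) + fromℚ four * (B * B)) * (r * r)
        ≈⟨ solve 2 (λ B r → ((con 1ℚ :- B) :* (con 1ℚ :- B) :* ((con 1ℚ :+ B) :* (con 1ℚ :+ B)) :+ con four :* (B :* B)) :* (r :* r) :=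
             (con 1ℚ :+ B :* B) :* r :* ((con 1ℚ :+ B :* B) :* r)) ≈-refl B r ⟩
      (1ℝ + B * B) * r * ((1ℝ + B * B) * r)
        ≈⟨ *-cong inverse-r inverse-r ⟩
      1ℝ * 1ℝ
        ≈⟨ *-identityˡ 1ℝ ⟩
      1ℝ ∎

    private
      0≤B : NonNeg B
      0≤B = nonNeg-+ (0≤α 1F) (0≤α 3F)

      0≤r : NonNeg r
      0≤r = 1/1+∣∣-nonNeg (b * b)

      0≤1+B : NonNeg (1ℝ + B)
      0≤1+B = nonNeg-+ (nonNeg-const (ℚ.<⇒≤ (ℚ.positive⁻¹ 1ℚ))) 0≤B

      ∣x∣≈ : ∣ x ∣ ≈ A * (1ℝ + B) * r
      ∣x∣≈ = begin
        ∣ a * (1ℝ + B) * r ∣       ≈⟨ ∣∣-* (a * (1ℝ + B)) r ⟩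
        ∣ a * (1ℝ + B) ∣ * ∣ r ∣    ≈⟨ *-cong (∣∣-* a (1ℝ + B)) (nonNeg⇒∣∣ 0≤r) ⟩
        ∣ a ∣ * ∣ 1ℝ + B ∣ * r      ≈⟨ *-cong (*-cong (disjoint-∣∣ (0≤α 0F) (0≤α 2F) (¬¬-map proj₁ zeros)) (nonNeg⇒∣∣ 0≤1+B)) ≈-refl ⟩
        A * (1ℝ + B) * r           ∎

      ∣y∣≈ : ∣ y ∣ ≈ (B + B) * r
      ∣y∣≈ = begin
        ∣ (b + b) * r ∣    ≈⟨ ∣∣-cong (solve 2 (λ b r → (b :+ b) :* r := b :* (r :+ r)) ≈-refl b r) ⟩
        ∣ b * (r + r) ∣    ≈⟨ ∣∣-* b (r + r) ⟩
        ∣ b ∣ * ∣ r + r ∣   ≈⟨ *-cong (disjoint-∣∣ (0≤α 1F) (0≤α 3F) (¬¬-map proj₂ zeros)) (nonNeg⇒∣∣ (nonNeg-+ 0≤r 0≤r)) ⟩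
        B * (r + r)       ≈⟨ solve 2 (λ b r → b :* (r :+ r) := (b :+ b) :* r) ≈-refl B r ⟩
        (B + B) * r       ∎

      -- Here |x| = (1 - B²) / (1 + B²) and r = 1 / (1 + B²). The sum has a monomial form, which
      -- makes `i` a polynomial in B.
      1+∣x∣≈ : 1ℝ + ∣ x ∣ ≈ r + r
      1+∣x∣≈ = begin
        1ℝ + ∣ x ∣                                  ≈⟨ +-cong (≈-sym inverse-r) (≈-trans ∣x∣≈ (*-cong (*-cong A≈1-B ≈-refl) ≈-refl)) ⟩
        (1ℝ + B * B) * r + (1ℝ - B) * (1ℝ + B) * r  ≈⟨ solve 2 (λ B r → (con 1ℚ :+ B :* B) :* r :+ (con 1ℚ :- B) :* (con 1ℚ :+ B) :* r :=
            r :+ r) ≈-refl B r ⟩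
        r + r                                      ∎

      h : ℝ
      h = 1/1+∣ B ∣

      inverse-h : (1ℝ + B) * h ≈ 1ℝ
      inverse-h = ≈-trans (*-cong (+-cong ≈-refl (≈-sym (nonNeg⇒∣∣ 0≤B))) ≈-refl) (1/1+∣∣-inverse B)

      open FromCircle x y using (i; k; β)

      i≈ : i ≈ ½ℝ * (1ℝ + B * B)
      i≈ = 1/1+∣∣-unique (begin
        (1ℝ + ∣ x ∣) * (½ℝ * (1ℝ + B * B))  ≈⟨ *-cong 1+∣x∣≈ ≈-refl ⟩
        (r + r) * (½ℝ * (1ℝ + B * B))      ≈⟨ solve 2 (λ B r → (r :+ r) :* (con ½ :* (con 1ℚ :+ B :* B)) :=
            (con 1ℚ :+ B :* B) :* r) ≈-refl B r ⟩
        (1ℝ + B * B) * r                   ≈⟨ inverse-r ⟩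
        1ℝ                                 ∎)

      -- The denominator 1 + |x| + |y| equals 2r + 2Br = 2r(1 + B); inverting it brings in h = 1 /
      -- (1 + B).
      k≈ : k ≈ ½ℝ * (1ℝ + B * B) * h
      k≈ = 1/1+∣∣-unique (begin
        (1ℝ + ∣ ∣ x ∣ + ∣ y ∣ ∣) * (½ℝ * (1ℝ + B * B) * h)
          ≈⟨ *-cong (≈-trans (+-cong ≈-refl (nonNeg⇒∣∣ (nonNeg-+ (∣∣-nonNeg x) (∣∣-nonNeg y)))) (≈-sym (+-assoc 1ℝ ∣ x ∣ ∣ y ∣))) ≈-refl ⟩
        (1ℝ + ∣ x ∣ + ∣ y ∣) * (½ℝ * (1ℝ + B * B) * h)
          ≈⟨ *-cong (+-cong 1+∣x∣≈ ∣y∣≈) ≈-refl ⟩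
        (r + r + (B + B) * r) * (½ℝ * (1ℝ + B * B) * h)
          ≈⟨ solve 3 (λ B r h → (r :+ r :+ (B :+ B) :* r) :* (con ½ :* (con 1ℚ :+ B :* B) :* h) :=
               (con 1ℚ :+ B :* B) :* r :* ((con 1ℚ :+ B) :* h)) ≈-refl B r h ⟩
        (1ℝ + B * B) * r * ((1ℝ + B) * h)
          ≈⟨ *-cong inverse-r inverse-h ⟩
        1ℝ * 1ℝ
          ≈⟨ *-identityˡ 1ℝ ⟩
        1ℝ ∎)

      -- Applied to z = |x| + x or |x| - x: as |a| is the sum of the weights at 0 and 2 and a their
      -- difference, z is twice one of these weights times (1 + B) r. `odd-term` does the same for y
      -- and the vertices 1 and 3.
      even-term : ∀ {z} w → z ≈ (w + w) * (1ℝ + B) * r → z * k ≈ w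
      even-term {z} w e = begin
        z * k
          ≈⟨ *-cong e k≈ ⟩
        (w + w) * (1ℝ + B) * r * (½ℝ * (1ℝ + B * B) * h)
          ≈⟨ solve 4 (λ w B r h → (w :+ w) :* (con 1ℚ :+ B) :* r :* (con ½ :* (con 1ℚ :+ B :* B) :* h) :=
               w :* ((con 1ℚ :+ B :* B) :* r :* ((con 1ℚ :+ B) :* h))) ≈-refl w B r h ⟩
        w * ((1ℝ + B * B) * r * ((1ℝ + B) * h))
          ≈⟨ *-cong ≈-refl (*-cong inverse-r inverse-h) ⟩
        w * (1ℝ * 1ℝ)
          ≈⟨ solve 1 (λ w → w :* (con 1ℚ :* con 1ℚ) := w) ≈-refl w ⟩
        w ∎

      odd-term : ∀ {z} w → z ≈ (w + w + (w + w)) * r → ½ℝ * z * i ≈ w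
      odd-term {z} w e = begin
        ½ℝ * z * i
          ≈⟨ *-cong (*-cong ≈-refl e) i≈ ⟩
        ½ℝ * ((w + w + (w + w)) * r) * (½ℝ * (1ℝ + B * B))
          ≈⟨ solve 3 (λ w B r → con ½ :* ((w :+ w :+ (w :+ w)) :* r) :* (con ½ :* (con 1ℚ :+ B :* B)) :=
              w :* ((con 1ℚ :+ B :* B) :* r)) ≈-refl w B r ⟩
        w * ((1ℝ + B * B) * r)
          ≈⟨ *-cong ≈-refl inverse-r ⟩
        w * 1ℝ
          ≈⟨ *-identityʳ w ⟩
        w ∎

    fromCircle-toCircle : ∀ v → β v ≈ α v
    fromCircle-toCircle 0F = even-term (α 0F) (≈-trans (+-cong ∣x∣≈ ≈-refl)
      (solve 4 (λ u v B r → (u :+ v) :* (con 1ℚ :+ B) :* r :+ (u :- v) :* (con 1ℚ :+ B) :* r :=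
          (u :+ u) :* (con 1ℚ :+ B) :* r) ≈-refl (α 0F) (α 2F) B r))
    fromCircle-toCircle 1F = odd-term (α 1F) (≈-trans (+-cong ∣y∣≈ ≈-refl)
      (solve 3 (λ u v r → (u :+ v :+ (u :+ v)) :* r :+ (u :- v :+ (u :- v)) :* r :=
          (u :+ u :+ (u :+ u)) :* r) ≈-refl (α 1F) (α 3F) r))
    fromCircle-toCircle 2F = even-term (α 2F) (≈-trans (+-cong ∣x∣≈ ≈-refl)
      (solve 4 (λ u v B r → (u :+ v) :* (con 1ℚ :+ B) :* r :- (u :- v) :* (con 1ℚ :+ B) :* r :=
          (v :+ v) :* (con 1ℚ :+ B) :* r) ≈-refl (α 0F) (α 2F) B r))
    fromCircle-toCircle 3F = odd-term (α 3F) (≈-trans (+-cong ∣y∣≈ ≈-refl)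
      (solve 3 (λ u v r → (u :+ v :+ (u :+ v)) :* r :- (u :- v :+ (u :- v)) :* r :=
          (v :+ v :+ (v :+ v)) :* r) ≈-refl (α 1F) (α 3F) r))

  module _ {x y : ℝ} (norm : x * x + y * y ≈ 1ℝ) where
    open FromCircle x y
    open ≈-Reasoning
    open ℝ-Solver

    private
      u v : ℝ
      u = ∣ x ∣
      v = ∣ y ∣

      u²+v²≈1 : u * u + v * v ≈ 1ℝ
      u²+v²≈1 = ≈-trans (+-cong (∣∣-square x) (∣∣-square y)) norm

      inverse-i : (1ℝ + u) * i ≈ 1ℝ
      inverse-i = 1/1+∣∣-inverse x

      inverse-k : (1ℝ + u + v) * k ≈ 1ℝ
      inverse-k = ≈-trans
        (*-cong (≈-trans (+-assoc 1ℝ u v) (+-cong ≈-refl (≈-sym (nonNeg⇒∣∣ (nonNeg-+ (∣∣-nonNeg x) (∣∣-nonNeg y)))))) ≈-refl)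
        (1/1+∣∣-inverse (u + v))

    fromCircle-nonNeg : ∀ j → NonNeg (β j)
    fromCircle-nonNeg 0F = nonNeg-* (∣∣+-nonNeg x) (1/1+∣∣-nonNeg (u + v))
    fromCircle-nonNeg 1F = nonNeg-* (nonNeg-* ½-nonNeg (∣∣+-nonNeg y)) (1/1+∣∣-nonNeg x)
    fromCircle-nonNeg 2F = nonNeg-* (∣∣--nonNeg x) (1/1+∣∣-nonNeg (u + v))
    fromCircle-nonNeg 3F = nonNeg-* (nonNeg-* ½-nonNeg (∣∣--nonNeg y)) (1/1+∣∣-nonNeg x)

    -- The sum is 2uk + vi with k = 1 / (1 + u + v) and i = 1 / (1 + u). Over the common denominator
    -- the numerator exceeds the denominator by u² + v² - 1, which vanishes on the circle.
    fromCircle-sum : sum β ≈ 1ℝ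
    fromCircle-sum = begin
      sum β
        ≈⟨ solve 6 (λ x y u v i k → (u :+ x) :* k :+ (con ½ :* (v :+ y) :* i :+ ((u :- x) :* k :+ (con ½ :* (v :- y) :* i :+ con 0ℚ))) :=
             (u :+ u) :* k :* con 1ℚ :+ v :* i :* con 1ℚ) ≈-refl x y u v i k ⟩
      (u + u) * k * 1ℝ + v * i * 1ℝ
        ≈⟨ +-cong (*-cong ≈-refl (≈-sym inverse-i)) (*-cong ≈-refl (≈-sym inverse-k)) ⟩
      (u + u) * k * ((1ℝ + u) * i) + v * i * ((1ℝ + u + v) * k)
        ≈⟨ by-eq (i * k) (solve 4 (λ u v i k → (u :+ u) :* k :* ((con 1ℚ :+ u) :* i) :+ v :* i :* ((con 1ℚ :+ u :+ v) :* k) :=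
             (con 1ℚ :+ u) :* i :* ((con 1ℚ :+ u :+ v) :* k) :+ i :* k :* (u :* u :+ v :* v :- con 1ℚ)) ≈-refl u v i k) u²+v²≈1 ⟩
      (1ℝ + u) * i * ((1ℝ + u + v) * k)
        ≈⟨ *-cong inverse-i inverse-k ⟩
      1ℝ * 1ℝ
        ≈⟨ *-identityˡ 1ℝ ⟩
      1ℝ ∎

    fromCircle-support : ¬ ¬ OppositeZeros β
    fromCircle-support h = ∣∣±-zero x λ hx → ∣∣±-zero y λ hy → h (even hx , odd hy)
      where
      vanish : ∀ {z} w → z ≈ 0ℝ → z * w ≈ 0ℝ
      vanish {z} w e = ≈-trans (*-comm z w) (zero-product w e)
      even : (u + x ≈ 0ℝ) ⊎ (u - x ≈ 0ℝ) → β 0F ≈ 0ℝ ⊎ β 2F ≈ 0ℝ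
      even (inj₁ e) = inj₁ (vanish k e)
      even (inj₂ e) = inj₂ (vanish k e)
      odd : (v + y ≈ 0ℝ) ⊎ (v - y ≈ 0ℝ) → β 1F ≈ 0ℝ ⊎ β 3F ≈ 0ℝ
      odd (inj₁ e) = inj₁ (vanish i (zero-product ½ℝ e))
      odd (inj₂ e) = inj₂ (vanish i (zero-product ½ℝ e))

    private
      module T = ToCircle β

      b≈ : T.b ≈ y * i
      b≈ = solve 3 (λ y v i → con ½ :* (v :+ y) :* i :- con ½ :* (v :- y) :* i := y :* i) ≈-refl y v i

      -- With b = y / (1 + u), the circle equation gives (1 + u)² + y² = 2(1 + u), hence 1 + b² = 2
      -- / (1 + u).
      r≈ : T.r ≈ ½ℝ * (1ℝ + u)
      r≈ = 1/1+∣∣-unique (begin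
        (1ℝ + ∣ T.b * T.b ∣) * (½ℝ * (1ℝ + u))
          ≈⟨ *-cong (+-cong ≈-refl (≈-trans (∣square∣ T.b) (*-cong b≈ b≈))) ≈-refl ⟩
        (1ℝ + y * i * (y * i)) * (½ℝ * (1ℝ + u))
          ≈⟨ *-cong (+-cong (≈-sym (≈-trans (*-cong inverse-i inverse-i) (*-identityˡ 1ℝ))) ≈-refl) ≈-refl ⟩
        ((1ℝ + u) * i * ((1ℝ + u) * i) + y * i * (y * i)) * (½ℝ * (1ℝ + u))
          ≈⟨ by-eq (i * i * (½ℝ * (1ℝ + u))) (solve 3 (λ y u i →
               ((con 1ℚ :+ u) :* i :* ((con 1ℚ :+ u) :* i) :+ y :* i :* (y :* i)) :* (con ½ :* (con 1ℚ :+ u)) :=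
               (con 1ℚ :+ u) :* i :* ((con 1ℚ :+ u) :* i) :+ i :* i :* (con ½ :* (con 1ℚ :+ u)) :* (u :* u :+ y :* y :- con 1ℚ)) ≈-refl y u i)
               (≈-trans (+-cong (∣∣-square x) ≈-refl) norm) ⟩
        (1ℝ + u) * i * ((1ℝ + u) * i)
          ≈⟨ *-cong inverse-i inverse-i ⟩
        1ℝ * 1ℝ
          ≈⟨ *-identityˡ 1ℝ ⟩
        1ℝ ∎)

    toCircle-fromCircle-x : T.x ≈ x
    toCircle-fromCircle-x = begin
      T.a * (1ℝ + T.B) * T.r
        ≈⟨ *-cong ≈-refl r≈ ⟩
      T.a * (1ℝ + T.B) * (½ℝ * (1ℝ + u))
        ≈⟨ solve 6 (λ x y u v i k → ((u :+ x) :* k :- (u :- x) :* k) :* (con 1ℚ :+ (con ½ :* (v :+ y) :* i :+ con ½ :* (v :- y) :* i)) :* (con ½ :* (con 1ℚ :+ u)) :=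
             x :* k :* (con 1ℚ :+ u :+ v :* ((con 1ℚ :+ u) :* i))) ≈-refl x y u v i k ⟩
      x * k * (1ℝ + u + v * ((1ℝ + u) * i))
        ≈⟨ *-cong ≈-refl (+-cong ≈-refl (*-cong ≈-refl inverse-i)) ⟩
      x * k * (1ℝ + u + v * 1ℝ)
        ≈⟨ solve 4 (λ x u v k → x :* k :* (con 1ℚ :+ u :+ v :* con 1ℚ) :=
            x :* ((con 1ℚ :+ u :+ v) :* k)) ≈-refl x u v k ⟩
      x * ((1ℝ + u + v) * k)
        ≈⟨ *-cong ≈-refl inverse-k ⟩
      x * 1ℝ
        ≈⟨ *-identityʳ x ⟩
      x ∎

    toCircle-fromCircle-y : T.y ≈ y
    toCircle-fromCircle-y = begin
      (T.b + T.b) * T.r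
        ≈⟨ *-cong (+-cong b≈ b≈) r≈ ⟩
      (y * i + y * i) * (½ℝ * (1ℝ + u))
        ≈⟨ solve 3 (λ y u i → (y :* i :+ y :* i) :* (con ½ :* (con 1ℚ :+ u)) :=
            y :* ((con 1ℚ :+ u) :* i)) ≈-refl y u i ⟩
      y * ((1ℝ + u) * i)
        ≈⟨ *-cong ≈-refl inverse-i ⟩
      y * 1ℝ
        ≈⟨ *-identityʳ y ⟩
      y ∎

  Cycle4≅Circle : Cycle 4 ≅ Circle
  Cycle4≅Circle = record
    { forth = mkMap
        (λ (α , 0≤α , ∑α , sup) → (ToCircle.x α , ToCircle.y α) ,
          ≈⇒on-circle (toCircle-norm α 0≤α ∑α (¬¬-map (supported⇒oppositeZeros α) sup)))
        (λ where
          zero       → *-continuous (*-continuous a (+-continuous (const-continuous 1ℝ) B)) r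
          (suc zero) → *-continuous (+-continuous b b) r)
    ; back = mkMap
        (λ ((x , y) , norm) → FromCircle.β x y , fromCircle-nonNeg (on-circle⇒≈ norm) ,
          fromCircle-sum (on-circle⇒≈ norm) ,
          ¬¬-map (oppositeZeros⇒supported (FromCircle.β x y)) (fromCircle-support (on-circle⇒≈ norm)))
        (λ where
          0F → *-continuous (+-continuous ∣x∣ x) k
          1F → *-continuous (*-continuous (const-continuous ½ℝ) (+-continuous ∣y∣ y)) i
          2F → *-continuous (sub-continuous ∣x∣ x) k
          3F → *-continuous (*-continuous (const-continuous ½ℝ) (sub-continuous ∣y∣ y)) i)
    ; back-forth = λ (α , 0≤α , ∑α , sup) →
        fromCircle-toCircle α 0≤α ∑α (¬¬-map (supported⇒oppositeZeros α) sup)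
    ; forth-back = λ (_ , norm) → λ where
        zero       → toCircle-fromCircle-x (on-circle⇒≈ norm)
        (suc zero) → toCircle-fromCircle-y (on-circle⇒≈ norm)
    }
    where
    coordinate : ∀ v → Continuous (Cycle 4) (λ (α , _) → α v)
    coordinate = coord-continuous {Cycle 4}
    a = sub-continuous (coordinate 0F) (coordinate 2F)
    b = sub-continuous (coordinate 1F) (coordinate 3F)
    B = +-continuous (coordinate 1F) (coordinate 3F)
    r = 1/-continuous (*-continuous b b)
    x = coord-continuous {Circle} zero
    y = coord-continuous {Circle} (suc zero)
    ∣x∣ = ∣∣-continuous x
    ∣y∣ = ∣∣-continuous y
    i = 1/-continuous x
    k = 1/-continuous (+-continuous ∣x∣ ∣y∣)

  -- Longer cycles descend, one subdivision at a time, to the triangle; its own subdivision is the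
  -- 4-cycle, for which the explicit formula is available.
  Cycle≅Circle : ∀ {m} → 3 ℕ.≤ m → Cycle m ≅ Circle
  Cycle≅Circle 3≤m = let r , e = ℕ.m≤n⇒∃[o]m+o≡n 3≤m in subst (λ m → Cycle m ≅ Circle) e (from-4 r)
    where
    from-4 : ∀ r → Cycle (3 ℕ.+ r) ≅ Circle
    from-4 ℕ.zero    = ≅-trans (Subdivision.subdivision 0) Cycle4≅Circle
    from-4 (ℕ.suc r) = ≅-trans (≅-sym (Subdivision.subdivision r)) (from-4 r)

  -- Products of cycles

  module ∑ = Algebra.Properties.CommutativeMonoid.Sum (CommutativeRing.+-commutativeMonoid ℝ-ring)
  module ∑* = Algebra.Properties.Semiring.Sum (CommutativeRing.semiring ℝ-ring)

  -- Double negation commutes with finite conjunctions. This allows the positivity of all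
  -- coordinates of a point to be decided simultaneously inside a stable argument.
  ¬¬-finite : ∀ {n} {P : Fin n → Set} → (∀ i → ¬ ¬ P i) → ¬ ¬ (∀ i → P i)
  ¬¬-finite {ℕ.zero}  h k = k λ ()
  ¬¬-finite {ℕ.suc n} h k = h zero λ p₀ → ¬¬-finite (h ∘ suc) λ p → k λ where
    zero    → p₀
    (suc i) → p i

  indicator : ∀ {P : Set} → Dec P → ℝ
  indicator (yes _) = 1ℝ
  indicator (no _)  = 0ℝ

  δ : ∀ {n} → Fin n → Fin n → ℝ
  δ i j = indicator (i ≟ j)

  δ-cong : ∀ {m n} {i j : Fin m} {k l : Fin n} → (i ≡ j → k ≡ l) → (k ≡ l → i ≡ j) → δ i j ≈ δ k l
  δ-cong {i = i} {j} {k} {l} f g with i ≟ j | k ≟ l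
  ... | yes _ | yes _ = ≈-refl
  ... | no _  | no _  = ≈-refl
  ... | yes e | no ¬e = contradiction (f e) ¬e
  ... | no ¬e | yes e = contradiction (g e) ¬e

  sum-δ : ∀ {n} (i : Fin n) (f : Vector ℝ n) → sum (λ j → δ i j * f j) ≈ f i
  sum-δ {ℕ.suc n} zero f = ≈-trans
    (+-cong (*-identityˡ (f zero)) (sum-zero {v = λ j → 0ℝ * f (suc j)} λ j → zeroˡ (f (suc j))))
    (+-identityʳ (f zero))
    where open CommutativeRing ℝ-ring using (zeroˡ)
  sum-δ {ℕ.suc n} (suc i) f = ≈-trans
    (+-cong (zeroˡ (f zero)) (≈-trans
      (sum-cong {u = λ j → δ (suc i) (suc j) * f (suc j)} λ j → *-cong (δ-cong suc-injective (cong suc)) ≈-refl) (sum-δ i (f ∘ suc))))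
    (+-identityˡ (f (suc i)))
    where
    open CommutativeRing ℝ-ring using (zeroˡ)

  -- The three maps form a bijection of Fin n with Fin a × Fin b. Everything topological depends on
  -- this bijection alone, not on the arithmetic producing it.
  module GridComplex {n a b : ℕ} (row : Fin n → Fin a) (col : Fin n → Fin b) (cell : Fin a → Fin b → Fin n)
    (row-cell : ∀ i j → row (cell i j) ≡ i) (col-cell : ∀ i j → col (cell i j) ≡ j)
    (cell-row-col : ∀ v → cell (row v) (col v) ≡ v) where

    open ℝ-Solver
    open ≈-Reasoning

    δ-cell : ∀ v i j → δ (row v) i * δ (col v) j ≈ δ (cell i j) v
    δ-cell v i j with row v ≟ i | col v ≟ j | cell i j ≟ v
    ... | yes _ | yes _ | yes _ = *-identityˡ 1ℝ
    ... | yes e | yes f | no ¬g = contradiction (trans (cong₂ cell (sym e) (sym f)) (cell-row-col v)) ¬g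
    ... | yes _ | no ¬f | yes g = contradiction (trans (cong col (sym g)) (col-cell i j)) ¬f
    ... | no ¬e | _     | yes g = contradiction (trans (cong row (sym g)) (row-cell i j)) ¬e
    ... | yes _ | no _  | no _     = *-identityˡ 0ℝ
    ... | no _  | yes _ | no _     = *-identityʳ 0ℝ
    ... | no _  | no _  | no _     = solve 0 (con 0ℚ :* con 0ℚ := con 0ℚ) ≈-refl

    -- Reindexing by Kronecker deltas: each summand is expanded as a double sum of deltas over the
    -- grid, the sums are interchanged, and the sum over v collapses because exactly one v equals
    -- `cell i j`.
    sum-grid : ∀ (F : Fin a → Fin b → ℝ) → sum (λ v → F (row v) (col v)) ≈ sum (λ i → sum (λ j → F i j))
    sum-grid F = begin
      sum (λ v → F (row v) (col v))
        ≈⟨ sum-cong (λ v → ≈-sym (≈-trans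
             (sum-cong λ i → *-cong (≈-refl {δ (row v) i}) (sum-δ (col v) (F i)))
             (sum-δ (row v) (λ i → F i (col v))))) ⟩
      sum (λ v → sum (λ i → δ (row v) i * sum (λ j → δ (col v) j * F i j)))
        ≈⟨ sum-cong (λ v → sum-cong λ i → ≈-trans (∑*.*-distribˡ-sum (δ (row v) i) (λ j → δ (col v) j * F i j))
             (sum-cong λ j → ≈-trans (≈-sym (*-assoc _ _ _)) (*-cong (δ-cell v i j) ≈-refl))) ⟩
      sum (λ v → sum (λ i → sum (λ j → δ (cell i j) v * F i j)))
        ≈⟨ ∑.∑-comm (λ v i → sum (λ j → δ (cell i j) v * F i j)) ⟩
      sum (λ i → sum (λ v → sum (λ j → δ (cell i j) v * F i j)))
        ≈⟨ sum-cong (λ i → ∑.∑-comm (λ v j → δ (cell i j) v * F i j)) ⟩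
      sum (λ i → sum (λ j → sum (λ v → δ (cell i j) v * F i j)))
        ≈⟨ sum-cong (λ i → sum-cong λ j → sum-δ (cell i j) (λ _ → F i j)) ⟩
      sum (λ i → sum (λ j → F i j)) ∎

    sum-cells : ∀ (α : Vector ℝ n) → sum α ≈ sum (λ i → sum (λ j → α (cell i j)))
    sum-cells α = ≈-trans (sum-cong λ v → ≡⇒≈ (cong α (sym (cell-row-col v)))) (sum-grid (λ i j → α (cell i j)))

    rowSum : Vector ℝ n → Vector ℝ a
    rowSum α i = sum (λ j → α (cell i j))

    colSum : Vector ℝ n → Vector ℝ b
    colSum α j = sum (λ i → α (cell i j))

    product : Vector ℝ a → Vector ℝ b → Vector ℝ n
    product μ ν v = μ (row v) * ν (col v)

    rowSum-sum : ∀ α → sum (rowSum α) ≈ sum α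
    rowSum-sum α = ≈-sym (sum-cells α)

    colSum-sum : ∀ α → sum (colSum α) ≈ sum α
    colSum-sum α = ≈-trans (≈-sym (∑.∑-comm (λ i j → α (cell i j)))) (rowSum-sum α)

    rowSum-product : ∀ μ ν → sum ν ≈ 1ℝ → ∀ i → rowSum (product μ ν) i ≈ μ i
    rowSum-product μ ν ∑ν i = begin
      sum (λ j → μ (row (cell i j)) * ν (col (cell i j)))
        ≈⟨ sum-cong (λ j → ≡⇒≈ (cong₂ (λ i j → μ i * ν j) (row-cell i j) (col-cell i j))) ⟩
      sum (λ j → μ i * ν j)
        ≈⟨ ≈-sym (∑*.*-distribˡ-sum (μ i) ν) ⟩
      μ i * sum ν
        ≈⟨ *-cong ≈-refl ∑ν ⟩
      μ i * 1ℝ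
        ≈⟨ *-identityʳ (μ i) ⟩
      μ i ∎

    colSum-product : ∀ μ ν → sum μ ≈ 1ℝ → ∀ j → colSum (product μ ν) j ≈ ν j
    colSum-product μ ν ∑μ j = begin
      sum (λ i → μ (row (cell i j)) * ν (col (cell i j)))
        ≈⟨ sum-cong (λ i → ≡⇒≈ (cong₂ (λ i j → μ i * ν j) (row-cell i j) (col-cell i j))) ⟩
      sum (λ i → μ i * ν j)
        ≈⟨ ≈-sym (∑*.*-distribʳ-sum (ν j) μ) ⟩
      sum μ * ν j
        ≈⟨ *-cong ∑μ ≈-refl ⟩
      1ℝ * ν j
        ≈⟨ *-identityˡ (ν j) ⟩
      ν j ∎

    product-sum : ∀ μ ν → sum μ ≈ 1ℝ → sum ν ≈ 1ℝ → sum (product μ ν) ≈ 1ℝ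
    product-sum μ ν ∑μ ∑ν = begin
      sum (product μ ν)            ≈⟨ ≈-sym (rowSum-sum (product μ ν)) ⟩
      sum (rowSum (product μ ν))   ≈⟨ sum-cong (rowSum-product μ ν ∑ν) ⟩
      sum μ                        ≈⟨ ∑μ ⟩
      1ℝ                           ∎

    OnEdge : ∀ {m} → Fin m → Fin m → Fin m → Set
    OnEdge i j v = v ≡ i ⊎ v ≡ j

    record Square : Set where
      field
        {r r'} : Fin a
        {c c'} : Fin b
        rowEdge : Edge a r r'
        colEdge : Edge b c c'
    open Square

    _∈□_ : Fin n → Square → Set
    v ∈□ s = OnEdge (r s) (r' s) (row v) × OnEdge (c s) (c' s) (col v)

    CarriedBy : Vector ℝ n → Square → Set
    CarriedBy α s = ∀ v → v ∈□ s ⊎ α v ≈ 0ℝ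

    -- The last two hypotheses say that the simplices are exactly the vertex sets contained in a
    -- square. Stability lets the support condition of a point be proved from a merely
    -- not-not-existing carrier.
    module _ (K : SimplicialComplex n)
      (simplex-stable : ∀ σ → ¬ ¬ Simplex K σ → Simplex K σ)
      (simplex⇒square : ∀ σ → Simplex K σ → ∃[ s ] (∀ v → v ∈ₛ σ → v ∈□ s))
      (square⇒simplex : ∀ s σ → (∀ v → v ∈ₛ σ → v ∈□ s) → Simplex K σ) where

      -- Under the double negation the set σ of vertices with positive weight can be formed. The
      -- support condition makes it a simplex, hence it lies in a square, and a nonnegative weight
      -- that is not positive is 0.
      carrier : ∀ (α : Vector ℝ n) → (∀ v → NonNeg (α v)) →
        (∀ σ → (∀ v → v ∈ₛ σ → 0ℝ < α v) → Simplex K σ) → ¬ ¬ (∃[ s ] CarriedBy α s)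
      carrier α 0≤α sup = ¬¬-map choose (¬¬-finite λ v → ¬¬-excluded-middle {A = 0ℝ < α v})
        where
        choose : (∀ v → Dec (0ℝ < α v)) → ∃[ s ] CarriedBy α s
        -- Passing `refl` keeps the analysed decision tied to the one from which σ is tabulated, so
        -- a positive answer yields membership in σ.
        choose positive? = s , λ v → by-cases v (positive? v) refl
          where
          σ : Subset n
          σ = Vec.tabulate (does ∘ positive?)
          positive : ∀ v → (d : Dec (0ℝ < α v)) → does d ≡ true → 0ℝ < α v
          positive v (yes p) _ = p
          σ-simplex : Simplex K σ
          σ-simplex = sup σ λ v v∈σ → positive v (positive? v)
            (trans (sym (lookup∘tabulate (does ∘ positive?) v)) ([]=⇒lookup v∈σ))
          s : Square
          s = proj₁ (simplex⇒square σ σ-simplex)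
          by-cases : ∀ v (d : Dec (0ℝ < α v)) → positive? v ≡ d → v ∈□ s ⊎ α v ≈ 0ℝ
          by-cases v (yes p) e = inj₁ (proj₂ (simplex⇒square σ σ-simplex) v
            (lookup⇒[]= v σ (trans (lookup∘tabulate (does ∘ positive?) v) (cong does e))))
          by-cases v (no ¬p) e = inj₂ (not-positive⇒≈0 (0≤α v) ¬p)

      -- A positive weight is not 0, so every vertex of σ must lie on the carrying square.
      carried⇒support : ∀ (α : Vector ℝ n) → ¬ ¬ (∃[ s ] CarriedBy α s) →
        ∀ σ → (∀ v → v ∈ₛ σ → 0ℝ < α v) → Simplex K σ
      carried⇒support α h σ pos = simplex-stable σ (¬¬-map (λ (s , carried) →
        square⇒simplex s σ λ v v∈σ → on-square {s} (pos v v∈σ) (carried v)) h)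
        where
        on-square : ∀ {s v} → 0ℝ < α v → v ∈□ s ⊎ α v ≈ 0ℝ → v ∈□ s
        on-square p (inj₁ v∈s) = v∈s
        on-square {v = v} p (inj₂ z) = contradiction z (<⇒≉0 {α v} p)

      private
        X : Space
        X = ∥ K ∥

        total : ∀ {m} (α : Vector ℝ m) → D.sum α ≃ 1ℝ → sum α ≈ 1ℝ
        total α h = subst (_≈ 1ℝ) (sym (sum-def α)) (mk≈ h)

        total⁻¹ : ∀ {m} (α : Vector ℝ m) → sum α ≈ 1ℝ → D.sum α ≃ 1ℝ
        total⁻¹ α h = ≈⇒≃ (subst (_≈ 1ℝ) (sum-def α) h)

      off-edge : ∀ {m} {i j v : Fin m} → v ≢ i → v ≢ j → ¬ OnEdge i j v
      off-edge p q (inj₁ e) = p e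
      off-edge p q (inj₂ e) = q e

      rowSum-support : ∀ α s → CarriedBy α s → SupportedOn (rowSum α) (r s) (r' s)
      rowSum-support α s h i p q = sum-zero λ j → vanish j (h (cell i j))
        where
        vanish : ∀ j → cell i j ∈□ s ⊎ α (cell i j) ≈ 0ℝ → α (cell i j) ≈ 0ℝ
        vanish j (inj₁ (on , _)) = contradiction (subst (OnEdge (r s) (r' s)) (row-cell i j) on) (off-edge p q)
        vanish j (inj₂ z)        = z

      colSum-support : ∀ α s → CarriedBy α s → SupportedOn (colSum α) (c s) (c' s)
      colSum-support α s h j p q = sum-zero λ i → vanish i (h (cell i j))
        where
        vanish : ∀ i → cell i j ∈□ s ⊎ α (cell i j) ≈ 0ℝ → α (cell i j) ≈ 0ℝ
        vanish i (inj₁ (_ , on)) = contradiction (subst (OnEdge (c s) (c' s)) (col-cell i j) on) (off-edge p q)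
        vanish i (inj₂ z)        = z

      on-or-zero : ∀ {m} {α : Vector ℝ m} {i j} → SupportedOn α i j → ∀ v → OnEdge i j v ⊎ α v ≈ 0ℝ
      on-or-zero {i = i} {j} h v with v ≟ i | v ≟ j
      ... | yes e | _     = inj₁ (inj₁ e)
      ... | no _  | yes e = inj₁ (inj₂ e)
      ... | no p  | no q  = inj₂ (h v p q)

      product-support : ∀ μ ν s → SupportedOn μ (r s) (r' s) → SupportedOn ν (c s) (c' s) → CarriedBy (product μ ν) s
      product-support μ ν s h k v with on-or-zero h (row v) | on-or-zero k (col v)
      ... | inj₁ e | inj₁ f = inj₁ (e , f)
      ... | _      | inj₂ z = inj₂ (zero-product (μ (row v)) z)
      ... | inj₂ z | inj₁ _ = inj₂ (≈-trans (*-comm _ _) (zero-product (ν (col v)) z))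

      marginals : X ⇾ Cycle a ×ˢ Cycle b
      marginals = mkMap
        (λ (α , 0≤α , ∑α , sup) → let
            0≤ = λ v → mkNonNeg (0≤α v)
            sup' = carrier α 0≤ sup in
          (rowSum α , (λ i → nonNeg-sum (λ j → α (cell i j)) (λ j → 0≤ (cell i j))) , ≈-trans (rowSum-sum α) (total α ∑α) ,
            ¬¬-map (λ (s , h) → r s , r' s , rowEdge s , rowSum-support α s h) sup') ,
          (colSum α , (λ j → nonNeg-sum (λ i → α (cell i j)) (λ i → 0≤ (cell i j))) , ≈-trans (colSum-sum α) (total α ∑α) ,
            ¬¬-map (λ (s , h) → c s , c' s , colEdge s , colSum-support α s h) sup'))
        (++-continuous {X}
          {f = λ (α , _) → rowSum α} {g = λ (α , _) → colSum α}
          (λ i → sum-continuous λ j → coord-continuous {X} (cell i j))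
          (λ j → sum-continuous λ i → coord-continuous {X} (cell i j)))

      multiply : Cycle a ×ˢ Cycle b ⇾ X
      multiply = mkMap
        (λ ((μ , 0≤μ , ∑μ , supμ) , (ν , 0≤ν , ∑ν , supν)) →
          product μ ν ,
          (λ v → nonNeg⇒≤ (nonNeg-* (0≤μ (row v)) (0≤ν (col v)))) ,
          total⁻¹ (product μ ν) (product-sum μ ν ∑μ ∑ν) ,
          carried⇒support (product μ ν) λ k →
            supμ λ (i , i' , e , h) → supν λ (j , j' , e' , h') →
              let s = record { rowEdge = e ; colEdge = e' } in k (s , product-support μ ν s h h'))
        (λ v → *-continuous
          (∘-continuous {g = proj₁} (coord-continuous {Cycle a} (row v)) (proj₁-continuous {Cycle a} {Cycle b}))
          (∘-continuous {g = proj₂} (coord-continuous {Cycle b} (col v)) (proj₂-continuous {Cycle a} {Cycle b})))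

      marginals-multiply : ∀ x → Same (Cycle a ×ˢ Cycle b) (apply marginals (apply multiply x)) x
      marginals-multiply x@((μ , _ , ∑μ , _) , (ν , _ , ∑ν , _)) =
        let x' = apply marginals (apply multiply x) in
        same-× (Cycle a) (Cycle b) {proj₁ x'} {proj₁ x} {proj₂ x'} {proj₂ x} (rowSum-product μ ν ∑ν) (colSum-product μ ν ∑μ)

      private
        mix : ℝ → ℝ → ℝ → ℝ
        mix t x y = (1ℝ - t) * x + t * y

        mix-sum : ∀ t (u v : Vector ℝ n) → sum u ≈ 1ℝ → sum v ≈ 1ℝ → sum (λ i → mix t (u i) (v i)) ≈ 1ℝ
        mix-sum t u v ∑u ∑v = begin
          sum (λ i → mix t (u i) (v i))
            ≈⟨ ∑.∑-distrib-+ (λ i → (1ℝ - t) * u i) (λ i → t * v i) ⟩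
          sum (λ i → (1ℝ - t) * u i) + sum (λ i → t * v i)
            ≈⟨ +-cong (≈-sym (∑*.*-distribˡ-sum (1ℝ - t) u)) (≈-sym (∑*.*-distribˡ-sum t v)) ⟩
          (1ℝ - t) * sum u + t * sum v
            ≈⟨ +-cong (*-cong ≈-refl ∑u) (*-cong ≈-refl ∑v) ⟩
          (1ℝ - t) * 1ℝ + t * 1ℝ
            ≈⟨ solve 1 (λ t → (con 1ℚ :- t) :* con 1ℚ :+ t :* con 1ℚ := con 1ℚ) ≈-refl t ⟩
          1ℝ ∎

        -- The marginals of α are supported on the two edges whose product is the square, so both
        -- ends of the segment vanish off that same square.
        mix-carried : ∀ t α s → CarriedBy α s → CarriedBy (λ v → mix t (product (rowSum α) (colSum α) v) (α v)) s
        mix-carried t α s h v with h v | product-support (rowSum α) (colSum α) s (rowSum-support α s h) (colSum-support α s h) v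
        ... | inj₁ on | _       = inj₁ on
        ... | inj₂ _  | inj₁ on = inj₁ on
        ... | inj₂ z  | inj₂ z' = inj₂ (zero-sum (zero-product (1ℝ - t) z') (zero-product t z))

      straight-line : Deformation (multiply ⊚ marginals)
      straight-line = record
        { along = mkMap
            (λ (x@(α , 0≤α , ∑α , sup) , (t , 0≤t , t≤1)) → let
                0≤ = λ v → mkNonNeg (0≤α v)
                μν , 0≤μν , ∑μν , _ = apply multiply (apply marginals x) in
              (λ v → mix t (μν v) (α v)) ,
              (λ v → nonNeg⇒≤ (nonNeg-+ (nonNeg-* (≤⇒nonNeg t≤1) (mkNonNeg (0≤μν v)))
                                        (nonNeg-* (mkNonNeg 0≤t) (0≤ v)))) ,
              total⁻¹ (λ v → mix t (μν v) (α v)) (mix-sum t μν α (total μν ∑μν) (total α ∑α)) ,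
              carried⇒support (λ v → mix t (μν v) (α v)) (¬¬-map (λ (s , h) → s , mix-carried t α s h) (carrier α 0≤ sup)))
            (λ v → +-continuous
              (*-continuous (sub-continuous (const-continuous 1ℝ) time)
                (∘-continuous {g = proj₁} (continuity (multiply ⊚ marginals) v) (proj₁-continuous {X} {UnitInterval})))
              (*-continuous time (∘-continuous {g = proj₁} (coord-continuous {X} v) (proj₁-continuous {X} {UnitInterval}))))
        ; starts = λ x v → solve 2 (λ x y → (con 1ℚ :- con 0ℚ) :* x :+ con 0ℚ :* y := x) ≈-refl _ _
        ; ends   = λ x v → solve 2 (λ x y → (con 1ℚ :- con 1ℚ) :* x :+ con 1ℚ :* y := y) ≈-refl _ _
        }
        where
        time : Continuous (X ×ˢ UnitInterval) (λ (_ , t , _) → t)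
        time = ∘-continuous {g = proj₂} (coord-continuous {UnitInterval} zero) (proj₂-continuous {X} {UnitInterval})

      ≃ₕ-product : ∀ {Y Z} → Cycle a ≅ Y → Cycle b ≅ Z → ∥ K ∥ ≃ₕ (Y ×ˢ Z)
      ≃ₕ-product h k = ≃ₕ-≅ marginals multiply straight-line marginals-multiply (≅-× h k)

open import Defs using (∥_∥; neighborhoodComplex; circulant; _≃ₕ_; Torus; SimpleGraph; SimplicialComplex; connections)
open import Data.Integer.Base as ℤ using (ℤ; +_; _+_; _-_; _*_; -_; _^_; ∣_∣)
open import Data.Integer.Divisibility using (_∣_)
open import Data.Rational.Base using (_/_)
open import Data.Nat.DivMod as ℕ using ()
open import Data.Nat.Divisibility as ℕ using ()
open import Data.Nat.GCD as ℕ using (gcd; gcd-greatest; module Bézout)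
open import Data.Nat.Primality using (euclidsLemma; prime[2])
open import Data.Integer.Properties as ℤ using ()
open import Data.Integer.DivMod as ℤ using (_%ℕ_; _/ℕ_; n%ℕd<d; a≡a%ℕn+[a/ℕn]*n)
open import Data.Integer.Solver using (module +-*-Solver)
open import Data.List.Membership.Propositional using (_∈_)
open import Data.List.Membership.DecPropositional ℕ._≟_ using (_∈?_)
open import Data.List.Relation.Unary.Any using (here; there)
open import Data.Rational.Properties using (/-injective-≃)
open import Data.Rational.Unnormalised.Base using (mkℚᵘ; *≡*)
open import Data.Empty using (⊥)

open RealSpaces using (Edge; module GridComplex; Cycle≅Circle)

-- Congruences

record Congruent (m a b : ℤ) : Set where
  constructor mkCong
  field
    quotient : ℤ
    equation : a - b ≡ quotient * m

module _ {m : ℤ} where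
  open +-*-Solver

  ≡⇒cong : ∀ {a b} → a ≡ b → Congruent m a b
  ≡⇒cong {a} refl = mkCong (+ 0) (solve 2 (λ a m → a :- a := con (+ 0) :* m) refl a m)

  cong-sym : ∀ {a b} → Congruent m a b → Congruent m b a
  cong-sym {a} {b} (mkCong k e) = mkCong (- k)
    (trans (solve 2 (λ a b → b :- a := :- (a :- b)) refl a b)
      (trans (cong -_ e) (solve 2 (λ k m → :- (k :* m) := (:- k) :* m) refl k m)))

  cong-trans : ∀ {a b c} → Congruent m a b → Congruent m b c → Congruent m a c
  cong-trans {a} {b} {c} (mkCong k e) (mkCong l f) = mkCong (k + l)
    (trans (solve 3 (λ a b c → a :- c := (a :- b) :+ (b :- c)) refl a b c)
      (trans (cong₂ _+_ e f) (solve 3 (λ k l m → k :* m :+ l :* m := (k :+ l) :* m) refl k l m)))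

  cong-+ : ∀ {a b c d} → Congruent m a b → Congruent m c d → Congruent m (a + c) (b + d)
  cong-+ {a} {b} {c} {d} (mkCong k e) (mkCong l f) = mkCong (k + l)
    (trans (solve 4 (λ a b c d → a :+ c :- (b :+ d) := (a :- b) :+ (c :- d)) refl a b c d)
      (trans (cong₂ _+_ e f) (solve 3 (λ k l m → k :* m :+ l :* m := (k :+ l) :* m) refl k l m)))

  cong-* : ∀ {a b} c → Congruent m a b → Congruent m (a * c) (b * c)
  cong-* {a} {b} c (mkCong k e) = mkCong (k * c)
    (trans (solve 3 (λ a b c → a :* c :- b :* c := (a :- b) :* c) refl a b c)
      (trans (cong (_* c) e) (solve 3 (λ k m c → k :* m :* c := k :* c :* m) refl k m c)))

  cong-modulus : ∀ {a b} l → Congruent (l * m) a b → Congruent m a b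
  cong-modulus l (mkCong k e) = mkCong (k * l) (trans e (sym (ℤ.*-assoc k l m)))

-- The difference has absolute value below m and is divisible by m, hence is 0.
cong-unique : ∀ {m x y} → x ℕ.< m → y ℕ.< m → Congruent (+ m) (+ x) (+ y) → x ≡ y
cong-unique {m} {x} {y} x<m y<m (mkCong k e) = ℤ.+-injective (ℤ.i-j≡0⇒i≡j (+ x) (+ y) (ℤ.∣i∣≡0⇒i≡0 (small ∣ + x - + y ∣ ∣x-y∣<m m∣x-y)))
  where
  ∣x-y∣<m : ∣ + x - + y ∣ ℕ.< m
  ∣x-y∣<m = ℕ.≤-<-trans (subst (λ z → ∣ z ∣ ℕ.≤ x ℕ.⊔ y) (sym (ℤ.m-n≡m⊖n x y)) (ℤ.∣m⊝n∣≤m⊔n x y))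
    (ℕ.⊔-lub x<m y<m)
  m∣x-y : m ℕ.∣ ∣ + x - + y ∣
  m∣x-y = ℕ.divides ∣ k ∣ (trans (cong ∣_∣ e) (ℤ.abs-* k (+ m)))
  small : ∀ z → z ℕ.< m → m ℕ.∣ z → z ≡ 0
  small ℕ.zero    _   _   = refl
  small (ℕ.suc z) z<m m∣z = contradiction (ℕ.∣⇒≤ m∣z) (ℕ.<⇒≱ z<m)

%ℕ-cong : ∀ a m .{{_ : NonZero m}} → Congruent (+ m) (+ (a %ℕ m)) a
%ℕ-cong a m = cong-sym (mkCong (a /ℕ m) (trans (cong (_- + (a %ℕ m)) (a≡a%ℕn+[a/ℕn]*n a m))
  (solve 2 (λ r k → r :+ k :- r := k) refl (+ (a %ℕ m)) ((a /ℕ m) * + m))))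
  where open +-*-Solver

module _ (m : ℕ) .{{_ : NonZero m}} where

  residue : ℤ → Fin m
  residue a = fromℕ< (n%ℕd<d a m)

  residue-cong : ∀ a → Congruent (+ m) (+ toℕ (residue a)) a
  residue-cong a = subst (λ r → Congruent (+ m) (+ r) a) (sym (toℕ-fromℕ< (n%ℕd<d a m))) (%ℕ-cong a m)

  residue-unique : ∀ {i : Fin m} {a} → Congruent (+ m) (+ toℕ i) a → residue a ≡ i
  residue-unique {i} {a} h = toℕ-injective (cong-unique (toℕ<n (residue a)) (toℕ<n i)
    (cong-trans (residue-cong a) (cong-sym h)))

  residue-≡ : ∀ {a b} → Congruent (+ m) a b → residue a ≡ residue b
  residue-≡ {a} {b} h = residue-unique (cong-trans (residue-cong b) (cong-sym h))

edge⇒cong : ∀ {m} {i j : Fin m} → Edge m i j → Congruent (+ m) (+ toℕ j) (+ toℕ i + + 1)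
edge⇒cong {m} {i} {j} (inj₁ e) = ≡⇒cong (trans (cong +_ (trans e (ℕ.+-comm 1 (toℕ i)))) (ℤ.pos-+ (toℕ i) 1))
edge⇒cong {m} {i} {j} (inj₂ (e , f)) = mkCong (- + 1) (begin
  + toℕ j - (+ toℕ i + + 1)   ≡⟨ cong (λ z → + z - (+ toℕ i + + 1)) e ⟩
  + 0 - (+ toℕ i + + 1)       ≡⟨ cong (λ z → + 0 - z) (trans (sym (ℤ.pos-+ (toℕ i) 1)) (cong +_ (trans (ℕ.+-comm (toℕ i) 1) f))) ⟩
  + 0 - + m                   ≡⟨ solve 1 (λ m → con (+ 0) :- m := (:- con (+ 1)) :* m) refl (+ m) ⟩
  - + 1 * + m                 ∎)
  where
  open ≡-Reasoning
  open +-*-Solver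

next-edge : ∀ m .{{_ : NonZero m}} a → Edge m (residue m a) (residue m (a + + 1))
next-edge m a = cases (ℕ.m≤n⇒m<n∨m≡n (toℕ<n i))
  where
  i j : Fin m
  i = residue m a
  j = residue m (a + + 1)
  j≡i+1 : Congruent (+ m) (+ toℕ j) (+ ℕ.suc (toℕ i))
  j≡i+1 = cong-trans (residue-cong m (a + + 1)) (cong-trans
    (cong-+ (cong-sym (residue-cong m a)) (≡⇒cong refl))
    (≡⇒cong (trans (sym (ℤ.pos-+ (toℕ i) 1)) (cong +_ (ℕ.+-comm (toℕ i) 1)))))
  cases : ℕ.suc (toℕ i) ℕ.< m ⊎ ℕ.suc (toℕ i) ≡ m → Edge m i j
  cases (inj₁ i+1<m) = inj₁ (cong-unique (toℕ<n j) i+1<m j≡i+1)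
  cases (inj₂ i+1≡m) = inj₂ (cong-unique (toℕ<n j) (ℕ.≤-<-trans ℕ.z≤n (toℕ<n i))
    (cong-trans j≡i+1 (mkCong (+ 1) (trans (ℤ.+-identityʳ _) (trans (cong +_ i+1≡m) (sym (ℤ.*-identityˡ (+ m)))))))
    , i+1≡m)

bezout : ∀ p q → gcd p q ≡ 1 → ∃₂ λ x y → x * + p + y * + q ≡ + 1
bezout p q g = from (subst (λ d → Bézout.Identity d p q) g (Bézout.identity (ℕ.gcd-GCD p q)))
  where
  open +-*-Solver
  lift : ∀ x y {c d} → 1 ℕ.+ y ℕ.* d ≡ x ℕ.* c → + x * + c - + y * + d ≡ + 1
  lift x y {c} {d} e = begin
    + x * + c - + y * + d          ≡⟨ cong₂ _-_ (sym (ℤ.pos-* x c)) (sym (ℤ.pos-* y d)) ⟩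
    + (x ℕ.* c) - + (y ℕ.* d)      ≡⟨ cong (λ z → + z - + (y ℕ.* d)) (sym e) ⟩
    + (1 ℕ.+ y ℕ.* d) - + (y ℕ.* d) ≡⟨ cong (_- + (y ℕ.* d)) (ℤ.pos-+ 1 (y ℕ.* d)) ⟩
    + 1 + + (y ℕ.* d) - + (y ℕ.* d) ≡⟨ solve 1 (λ z → con (+ 1) :+ z :- z := con (+ 1)) refl (+ (y ℕ.* d)) ⟩
    + 1                            ∎
    where open ≡-Reasoning
  from : Bézout.Identity 1 p q → ∃₂ λ x y → x * + p + y * + q ≡ + 1
  from (Bézout.+- x y e) = + x , - + y , trans
    (solve 4 (λ x p y q → x :* p :+ (:- y) :* q := x :* p :- y :* q) refl (+ x) (+ p) (+ y) (+ q)) (lift x y e)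
  from (Bézout.-+ x y e) = - + x , + y , trans
    (solve 4 (λ x p y q → (:- x) :* p :+ y :* q := y :* q :- x :* p) refl (+ x) (+ p) (+ y) (+ q)) (lift y x e)

-- Adjacency to x means lying in x - t + {0, P} + {0, q} with P = s + t and
-- q = t - s: by the Chinese remainder theorem these are the four corners of
-- a unit square of the grid ℤ/q × ℤ/p.
module Circulant (p q : ℕ) .{{_ : NonZero p}} .{{_ : NonZero q}}
  (x y : ℤ) (bezout-xy : x * + p + y * + q ≡ + 1)
  (P P⁻¹ l k : ℤ) (P≡l*p : P ≡ l * + p) (P-inverse : P * P⁻¹ - + 1 ≡ k * + q)
  (s t : ℕ) (s+t≡P : + s + + t ≡ P) (t≡s+q : + t ≡ + s + + q)
  (1≤s : 1 ℕ.≤ s) (s<n : s ℕ.< p ℕ.* q) (1≤t : 1 ℕ.≤ t) (t<n : t ℕ.< p ℕ.* q) where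

  open +-*-Solver

  n : ℕ
  n = p ℕ.* q

  private instance
    n≢0 : NonZero n
    n≢0 = >-nonZero (ℕ.≤-<-trans ℕ.z≤n s<n)

  +n : + n ≡ + p * + q
  +n = ℤ.pos-* p q

  -- Multiply a - b by 1 = xp + yq: in the first term write a - b as a multiple of q, in the second
  -- as a multiple of p, and pq divides both.
  chinese : ∀ {a b} → Congruent (+ p) a b → Congruent (+ q) a b → Congruent (+ n) a b
  chinese {a} {b} (mkCong i e) (mkCong j f) = subst (λ n → Congruent n a b) (sym +n) (mkCong (j * x + i * y) (begin
    a - b                                        ≡⟨ sym (ℤ.*-identityʳ (a - b)) ⟩
    (a - b) * + 1                                ≡⟨ cong ((a - b) *_) (sym bezout-xy) ⟩
    (a - b) * (x * + p + y * + q)                ≡⟨ ℤ.*-distribˡ-+ (a - b) (x * + p) (y * + q) ⟩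
    (a - b) * (x * + p) + (a - b) * (y * + q)    ≡⟨ cong₂ (λ u v → u * (x * + p) + v * (y * + q)) f e ⟩
    j * + q * (x * + p) + i * + p * (y * + q)    ≡⟨ solve 6 (λ i j x y p q → j :* q :* (x :* p) :+ i :* p :* (y :* q) :=
        (j :* x :+ i :* y) :* (p :* q)) refl i j x y (+ p) (+ q) ⟩
    (j * x + i * y) * (+ p * + q)                ∎))
    where open ≡-Reasoning

  P≡0 : Congruent (+ p) P (+ 0)
  P≡0 = mkCong l (trans (ℤ.+-identityʳ P) P≡l*p)

  q≡0 : Congruent (+ q) (+ q) (+ 0)
  q≡0 = mkCong (+ 1) (trans (ℤ.+-identityʳ (+ q)) (sym (ℤ.*-identityˡ (+ q))))

  PP⁻¹≡1 : Congruent (+ q) (P * P⁻¹) (+ 1)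
  PP⁻¹≡1 = mkCong k P-inverse

  qy≡1 : Congruent (+ p) (+ q * y) (+ 1)
  qy≡1 = mkCong (- x) (begin
    + q * y - + 1                        ≡⟨ cong (λ z → + q * y - z) (sym bezout-xy) ⟩
    + q * y - (x * + p + y * + q)        ≡⟨ solve 4 (λ x y p q → q :* y :- (x :* p :+ y :* q) :=
        (:- x) :* p) refl x y (+ p) (+ q) ⟩
    - x * + p                            ∎)
    where open ≡-Reasoning

  mod-p : ∀ {a b} → Congruent (+ n) a b → Congruent (+ p) a b
  mod-p {a} {b} h = cong-modulus (+ q) (subst (λ n → Congruent n a b) (trans +n (ℤ.*-comm (+ p) (+ q))) h)

  mod-q : ∀ {a b} → Congruent (+ n) a b → Congruent (+ q) a b
  mod-q {a} {b} h = cong-modulus (+ p) (subst (λ n → Congruent n a b) +n h)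

  -- Grid coordinates: P vanishes mod p and is a unit mod q, while q vanishes mod q and has inverse
  -- y mod p. Multiplying by `P⁻¹` mod q reads off i, multiplying by y mod p reads off j.
  position : ℤ → ℤ → ℤ
  position i j = i * P + j * + q

  position-mod-q : ∀ i j → Congruent (+ q) (position i j * P⁻¹) i
  position-mod-q i j = cong-trans
    (≡⇒cong (solve 5 (λ i j P Q q → (i :* P :+ j :* q) :* Q := P :* Q :* i :+ q :* (j :* Q)) refl i j P P⁻¹ (+ q)))
    (cong-trans (cong-+ (cong-* i PP⁻¹≡1) (cong-* (j * P⁻¹) q≡0))
      (≡⇒cong (solve 2 (λ i z → con (+ 1) :* i :+ con (+ 0) :* z := i) refl i (j * P⁻¹))))

  position-mod-p : ∀ i j → Congruent (+ p) (position i j * y) j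
  position-mod-p i j = cong-trans
    (≡⇒cong (solve 5 (λ i j P y q → (i :* P :+ j :* q) :* y := P :* (i :* y) :+ q :* y :* j) refl i j P y (+ q)))
    (cong-trans (cong-+ (cong-* (i * y) P≡0) (cong-* j qy≡1))
      (≡⇒cong (solve 2 (λ j z → con (+ 0) :* z :+ con (+ 1) :* j := j) refl j (i * y))))

  position-cong : ∀ {i i' j j'} → Congruent (+ q) i i' → Congruent (+ p) j j' →
    Congruent (+ n) (position i j) (position i' j')
  position-cong {i} {i'} {j} {j'} h h' = chinese
    (cong-+ (cong-trans (P-multiple i) (cong-sym (P-multiple i'))) (cong-* (+ q) h'))
    (cong-+ (cong-* P h) (cong-trans (q-multiple j) (cong-sym (q-multiple j'))))
    where
    P-multiple : ∀ i → Congruent (+ p) (i * P) (+ 0)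
    P-multiple i = cong-trans (≡⇒cong (ℤ.*-comm i P)) (cong-* i P≡0)
    q-multiple : ∀ j → Congruent (+ q) (j * + q) (+ 0)
    q-multiple j = cong-trans (≡⇒cong (ℤ.*-comm j (+ q))) (cong-* j q≡0)

  position-surjective : ∀ a → Congruent (+ n) (position (a * P⁻¹) (a * y)) a
  position-surjective a = chinese
    (cong-trans (cong-+ (≡⇒cong (solve 3 (λ a Q P → a :* Q :* P :=
        P :* (a :* Q)) refl a P⁻¹ P)) (≡⇒cong (solve 3 (λ a y q → a :* y :* q := q :* y :* a) refl a y (+ q))))
      (cong-trans (cong-+ (cong-* (a * P⁻¹) P≡0) (cong-* a qy≡1)) (≡⇒cong (solve 2 (λ a z → con (+ 0) :* z :+ con (+ 1) :* a :=
          a) refl a (a * P⁻¹)))))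
    (cong-trans (cong-+ (≡⇒cong (solve 3 (λ a Q P → a :* Q :* P :=
        P :* Q :* a) refl a P⁻¹ P)) (≡⇒cong (solve 3 (λ a y q → a :* y :* q := q :* (a :* y)) refl a y (+ q))))
      (cong-trans (cong-+ (cong-* a PP⁻¹≡1) (cong-* (a * y) q≡0)) (≡⇒cong (solve 2 (λ a z → con (+ 1) :* a :+ con (+ 0) :* z :=
          a) refl a (a * y)))))

  row : Fin n → Fin q
  row v = residue q (+ toℕ v * P⁻¹)

  col : Fin n → Fin p
  col v = residue p (+ toℕ v * y)

  cell : Fin q → Fin p → Fin n
  cell i j = residue n (position (+ toℕ i) (+ toℕ j))

  row-cell : ∀ i j → row (cell i j) ≡ i
  row-cell i j = residue-unique q (cong-sym (cong-trans
    (cong-* P⁻¹ (mod-q (residue-cong n (position (+ toℕ i) (+ toℕ j))))) (position-mod-q (+ toℕ i) (+ toℕ j))))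

  col-cell : ∀ i j → col (cell i j) ≡ j
  col-cell i j = residue-unique p (cong-sym (cong-trans
    (cong-* y (mod-p (residue-cong n (position (+ toℕ i) (+ toℕ j))))) (position-mod-p (+ toℕ i) (+ toℕ j))))

  cell-cong : ∀ v → Congruent (+ n) (position (+ toℕ (row v)) (+ toℕ (col v))) (+ toℕ v)
  cell-cong v = cong-trans (position-cong (residue-cong q (+ toℕ v * P⁻¹)) (residue-cong p (+ toℕ v * y)))
    (position-surjective (+ toℕ v))

  cell-row-col : ∀ v → cell (row v) (col v) ≡ v
  cell-row-col v = residue-unique n (cong-sym (cell-cong v))

  open GridComplex row col cell row-cell col-cell cell-row-col

  G : SimpleGraph n
  G = circulant n s t 1≤s s<n 1≤t t<n

  K : SimplicialComplex n
  K = neighborhoodComplex G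

  open SimpleGraph G using (Adj)
  open SimplicialComplex K using (Simplex)

  -- Offsets of the corners of a unit square. From s + t = P and t = s + q, subtracting t from 0, q,
  -- P and P + q gives -t, -s, s and t, so 00, 01, 10 and 11 stand for these connections.
  data Corner : ℤ → ℤ → Set where
    00# : Corner (+ 0) (+ 0)
    01# : Corner (+ 0) (+ 1)
    10# : Corner (+ 1) (+ 0)
    11# : Corner (+ 1) (+ 1)

  n-s-cong : ∀ u → u ℕ.< n → Congruent (+ n) (+ (n ℕ.∸ u)) (- + u)
  n-s-cong u u<n = mkCong (+ 1) (trans (cong (_- - + u) (trans (sym (ℤ.⊖-≥ (ℕ.<⇒≤ u<n))) (sym (ℤ.m-n≡m⊖n n u))))
    (solve 2 (λ n u → n :- u :- (:- u) := con (+ 1) :* n) refl (+ n) (+ u)))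

  s-position : + s ≡ position (+ 1) (+ 0) - + t
  s-position = trans (solve 2 (λ s t → s := s :+ t :- t) refl (+ s) (+ t)) (trans (cong (_- + t) s+t≡P)
    (solve 3 (λ P q t → P :- t := con (+ 1) :* P :+ con (+ 0) :* q :- t) refl P (+ q) (+ t)))

  -s-position : - + s ≡ position (+ 0) (+ 1) - + t
  -s-position = trans (solve 2 (λ s q → :- s :=
      q :- (s :+ q)) refl (+ s) (+ q)) (trans (cong (λ z → + q - z) (sym t≡s+q))
    (solve 3 (λ P q t → q :- t := con (+ 0) :* P :+ con (+ 1) :* q :- t) refl P (+ q) (+ t)))

  t-position : + t ≡ position (+ 1) (+ 1) - + t
  t-position = trans t≡s+q (trans (cong (_+ + q) (trans (solve 2 (λ s t → s :=
      s :+ t :- t) refl (+ s) (+ t)) (cong (_- + t) s+t≡P)))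
    (solve 3 (λ P q t → P :- t :+ q := con (+ 1) :* P :+ con (+ 1) :* q :- t) refl P (+ q) (+ t)))

  -t-position : - + t ≡ position (+ 0) (+ 0) - + t
  -t-position = solve 3 (λ P q t → :- t := con (+ 0) :* P :+ con (+ 0) :* q :- t) refl P (+ q) (+ t)

  connection⇒corner : ∀ {r} → r ∈ connections n s t →
    ∃₂ λ ε η → Corner ε η × Congruent (+ n) (+ r) (position ε η - + t)
  connection⇒corner (here refl)                         = _ , _ , 10# , ≡⇒cong s-position
  connection⇒corner (there (here refl))                 = _ , _ , 11# , ≡⇒cong t-position
  connection⇒corner (there (there (here refl)))         = _ , _ , 01# , cong-trans (n-s-cong s s<n) (≡⇒cong -s-position)
  connection⇒corner (there (there (there (here refl)))) = _ , _ , 00# , cong-trans (n-s-cong t t<n) (≡⇒cong -t-position)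

  corner⇒connection : ∀ {r ε η} → r ℕ.< n → Corner ε η → Congruent (+ n) (+ r) (position ε η - + t) →
    r ∈ connections n s t
  corner⇒connection r<n 10# h = here (cong-unique r<n s<n (cong-trans h (≡⇒cong (sym s-position))))
  corner⇒connection r<n 11# h = there (here (cong-unique r<n t<n (cong-trans h (≡⇒cong (sym t-position)))))
  -- The bound 1 ≤ s puts n ∸ s strictly below n, making it the canonical residue of -s; likewise
  -- for t in the last clause.
  corner⇒connection r<n 01# h = there (there (here (cong-unique r<n (ℕ.∸-monoʳ-< 1≤s (ℕ.<⇒≤ s<n))
    (cong-trans h (cong-trans (≡⇒cong (sym -s-position)) (cong-sym (n-s-cong s s<n)))))))
  corner⇒connection r<n 00# h = there (there (there (here (cong-unique r<n (ℕ.∸-monoʳ-< 1≤t (ℕ.<⇒≤ t<n))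
    (cong-trans h (cong-trans (≡⇒cong (sym -t-position)) (cong-sym (n-s-cong t t<n))))))))

  adj⇒corner : ∀ {v w} → Adj v w →
    ∃₂ λ ε η → Corner ε η × Congruent (+ n) (+ toℕ v) (+ toℕ w - + t + position ε η)
  adj⇒corner {v} {w} adj = let ε , η , corner , h = connection⇒corner adj in ε , η , corner ,
    cong-trans (≡⇒cong (solve 2 (λ v w → v := v :- w :+ w) refl (+ toℕ v) (+ toℕ w)))
      (cong-trans (cong-+ (cong-trans (cong-sym (%ℕ-cong (+ toℕ v - + toℕ w) n {{n≢0}})) h) (≡⇒cong refl))
        (≡⇒cong (solve 3 (λ z t w → z :- t :+ w := w :- t :+ z) refl (position ε η) (+ t) (+ toℕ w))))

  corner⇒adj : ∀ {v w ε η} → Corner ε η → Congruent (+ n) (+ toℕ v) (+ toℕ w - + t + position ε η) → Adj v w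
  corner⇒adj {v} {w} {ε} {η} corner h = corner⇒connection (n%ℕd<d (+ toℕ v - + toℕ w) n {{n≢0}}) corner
    (cong-trans (%ℕ-cong (+ toℕ v - + toℕ w) n {{n≢0}}) (cong-trans (cong-+ h (≡⇒cong refl))
      (≡⇒cong (solve 3 (λ z t w → w :- t :+ z :- w := z :- t) refl (position ε η) (+ t) (+ toℕ w)))))

  position-+ : ∀ a ε η → Congruent (+ n) (a + position ε η) (position (a * P⁻¹ + ε) (a * y + η))
  position-+ a ε η = cong-trans (cong-+ (cong-sym (position-surjective a)) (≡⇒cong refl))
    (≡⇒cong (solve 6 (λ i j ε η P q → i :* P :+ j :* q :+ (ε :* P :+ η :* q) := (i :+ ε) :* P :+ (j :+ η) :* q) refl
      (a * P⁻¹) (a * y) ε η P (+ q)))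

  row-position : ∀ v i j → Congruent (+ n) (+ toℕ v) (position i j) → row v ≡ residue q i
  row-position v i j h = residue-≡ q (cong-trans (cong-* P⁻¹ (mod-q h)) (position-mod-q i j))

  col-position : ∀ v i j → Congruent (+ n) (+ toℕ v) (position i j) → col v ≡ residue p j
  col-position v i j h = residue-≡ p (cong-trans (cong-* y (mod-p h)) (position-mod-p i j))

  -- The neighbours of w form the square whose lower corner is w - t.
  square-at : Fin n → Square
  square-at w = record { rowEdge = next-edge q (a * P⁻¹) ; colEdge = next-edge p (a * y) }
    where
    a : ℤ
    a = + toℕ w - + t

  adj⇒∈□ : ∀ {v w} → Adj v w → v ∈□ square-at w
  adj⇒∈□ {v} {w} adj = let ε , η , corner , h = adj⇒corner {v} {w} adj in
    on corner (cong-trans h (position-+ (+ toℕ w - + t) ε η))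
    where
    a : ℤ
    a = + toℕ w - + t
    i j : ℤ
    i = a * P⁻¹
    j = a * y
    +0 : ∀ m .{{_ : NonZero m}} b → residue m (b + + 0) ≡ residue m b
    +0 m b = cong (residue m) (ℤ.+-identityʳ b)
    on : ∀ {ε η} → Corner ε η → Congruent (+ n) (+ toℕ v) (position (i + ε) (j + η)) → v ∈□ square-at w
    on 00# h = inj₁ (trans (row-position v (i + + 0) (j + + 0) h) (+0 q i)) ,
               inj₁ (trans (col-position v (i + + 0) (j + + 0) h) (+0 p j))
    on 01# h = inj₁ (trans (row-position v (i + + 0) (j + + 1) h) (+0 q i)) ,
               inj₂ (col-position v (i + + 0) (j + + 1) h)
    on 10# h = inj₂ (row-position v (i + + 1) (j + + 0) h) ,
               inj₁ (trans (col-position v (i + + 1) (j + + 0) h) (+0 p j))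
    on 11# h = inj₂ (row-position v (i + + 1) (j + + 1) h) ,
               inj₂ (col-position v (i + + 1) (j + + 1) h)

  simplex⇒square : ∀ σ → Simplex σ → ∃[ s ] (∀ v → v ∈ₛ σ → v ∈□ s)
  simplex⇒square σ (w , h) = square-at w , λ v v∈σ → adj⇒∈□ {v} {w} (h v v∈σ)

  -- The common neighbour is the lower corner shifted by t, so that subtracting t leads back to that
  -- corner.
  square⇒simplex : ∀ s σ → (∀ v → v ∈ₛ σ → v ∈□ s) → Simplex σ
  square⇒simplex sq σ h = w , λ v v∈σ → adjacent v (h v v∈σ)
    where
    open Square sq
    b : ℤ
    b = position (+ toℕ r) (+ toℕ c)
    w : Fin n
    w = residue n (b + + t)
    w-t : Congruent (+ n) b (+ toℕ w - + t)
    w-t = cong-sym (cong-trans (cong-+ (residue-cong n (b + + t)) (≡⇒cong refl))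
      (≡⇒cong (solve 2 (λ b t → b :+ t :- t := b) refl b (+ t))))
    shift : ∀ {v} ε η → Congruent (+ q) (+ toℕ (row v)) (+ toℕ r + ε) → Congruent (+ p) (+ toℕ (col v)) (+ toℕ c + η) →
      Congruent (+ n) (+ toℕ v) (+ toℕ w - + t + position ε η)
    shift {v} ε η h h' = cong-trans (cong-sym (cell-cong v)) (cong-trans (position-cong h h') (cong-trans
      (≡⇒cong (solve 6 (λ i j ε η P q → (i :+ ε) :* P :+ (j :+ η) :* q := i :* P :+ j :* q :+ (ε :* P :+ η :* q)) refl
        (+ toℕ r) (+ toℕ c) ε η P (+ q)))
      (cong-+ w-t (≡⇒cong refl))))
    same : ∀ {m m' : ℕ} {i j : Fin m} → i ≡ j → Congruent (+ m') (+ toℕ i) (+ toℕ j + + 0)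
    same e = ≡⇒cong (trans (cong (λ i → + toℕ i) e) (sym (ℤ.+-identityʳ _)))
    next : ∀ {m} {i j k : Fin m} → Edge m i j → k ≡ j → Congruent (+ m) (+ toℕ k) (+ toℕ i + + 1)
    next e refl = edge⇒cong e
    adjacent : ∀ v → v ∈□ sq → Adj v w
    adjacent v (inj₁ e , inj₁ f) = corner⇒adj {v} {w} 00# (shift {v} (+ 0) (+ 0) (same e) (same f))
    adjacent v (inj₁ e , inj₂ f) = corner⇒adj {v} {w} 01# (shift {v} (+ 0) (+ 1) (same e) (next colEdge f))
    adjacent v (inj₂ e , inj₁ f) = corner⇒adj {v} {w} 10# (shift {v} (+ 1) (+ 0) (next rowEdge e) (same f))
    adjacent v (inj₂ e , inj₂ f) = corner⇒adj {v} {w} 11# (shift {v} (+ 1) (+ 1) (next rowEdge e) (next colEdge f))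

  -- Being a simplex is decidable: a common neighbour is found or excluded by a finite search.
  simplex-stable : ∀ σ → ¬ ¬ Simplex σ → Simplex σ
  simplex-stable σ = decidable-stable
    (any? λ w → all? λ v → (v ∈ₛ? σ) →-dec ((+ toℕ v - + toℕ w) %ℕ n ∈? connections n s t))

  ≃ₕTorus : 3 ℕ.≤ p → 3 ℕ.≤ q → ∥ K ∥ ≃ₕ Torus
  ≃ₕTorus 3≤p 3≤q = ≃ₕ-product K simplex-stable simplex⇒square square⇒simplex
    (Cycle≅Circle 3≤q) (Cycle≅Circle 3≤p)

-- Parity, size and invertibility of the parameters

half⇒double : ∀ u i → + u / 1 ≡ i / 2 → + u + + u ≡ i
half⇒double u i e with /-injective-≃ (mkℚᵘ (+ u) 0) (mkℚᵘ i 1) e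
... | *≡* f = trans (solve 1 (λ u → u :+ u := u :* con (+ 2)) refl (+ u)) (trans f (ℤ.*-identityʳ i))
  where open +-*-Solver

double-injective : ∀ {i j} → i + i ≡ j + j → i ≡ j
double-injective {i} {j} e = ℤ.*-cancelʳ-≡ i j (+ 2)
  (trans (double i) (trans e (sym (double j))))
  where
  double : ∀ i → i * + 2 ≡ i + i
  double i = solve 1 (λ i → i :* con (+ 2) := i :+ i) refl i
    where open +-*-Solver

halves : ∀ {S T P Q : ℤ} → S + S ≡ P - Q → T + T ≡ P + Q → S + T ≡ P × T ≡ S + Q
halves {S} {T} {P} {Q} e f = double-injective (begin
    S + T + (S + T)    ≡⟨ solve 2 (λ S T → S :+ T :+ (S :+ T) := S :+ S :+ (T :+ T)) refl S T ⟩
    S + S + (T + T)    ≡⟨ cong₂ _+_ e f ⟩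
    P - Q + (P + Q)    ≡⟨ solve 2 (λ P Q → P :- Q :+ (P :+ Q) := P :+ P) refl P Q ⟩
    P + P              ∎) ,
  double-injective (begin
    T + T              ≡⟨ f ⟩
    P + Q              ≡⟨ solve 2 (λ P Q → P :+ Q := P :- Q :+ (Q :+ Q)) refl P Q ⟩
    P - Q + (Q + Q)    ≡⟨ cong (_+ (Q + Q)) (sym e) ⟩
    S + S + (Q + Q)    ≡⟨ solve 2 (λ S Q → S :+ S :+ (Q :+ Q) := S :+ Q :+ (S :+ Q)) refl S Q ⟩
    S + Q + (S + Q)    ∎)
  where
  open ≡-Reasoning
  open +-*-Solver

SelfOrSquare : ℕ → ℕ → Set
SelfOrSquare p P = P ≡ p ⊎ P ≡ p ℕ.* p

shape-divisible : ∀ {p P} → SelfOrSquare p P → p ℕ.∣ P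
shape-divisible     (inj₁ refl) = ℕ.∣-refl
shape-divisible {p} (inj₂ refl) = ℕ.m∣m*n p

shape-even : ∀ {p P} → SelfOrSquare p P → 2 ℕ.∣ P → 2 ℕ.∣ p
shape-even     (inj₁ refl) 2∣p  = 2∣p
shape-even {p} (inj₂ refl) 2∣pp = [ id , id ]′ (euclidsLemma p p prime[2] 2∣pp)

module _ {p q P s t : ℕ} (coprime : gcd p q ≡ 1) (P-shape : SelfOrSquare p P)
  (s+t≡P : s ℕ.+ t ≡ P) (t≡s+q : t ≡ s ℕ.+ q) where

  private
    P≡2s+q : P ≡ 2 ℕ.* s ℕ.+ q
    P≡2s+q = trans (sym s+t≡P) (trans (cong (s ℕ.+_) t≡s+q) (trans (sym (ℕ.+-assoc s s q))
      (cong (λ z → s ℕ.+ z ℕ.+ q) (sym (ℕ.+-identityʳ s)))))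

    not-both-even : 2 ℕ.∣ p → 2 ℕ.∣ q → ⊥
    not-both-even 2∣p 2∣q = contradiction (ℕ.∣⇒≤ (subst (2 ℕ.∣_) coprime (gcd-greatest 2∣p 2∣q))) λ { (ℕ.s≤s ()) }

    -- By P = 2s + q, the numbers P and q have the same parity, and P is even exactly when p is. So
    -- if one of p and q were even, both would be, against coprimality; `q-odd` is the other
    -- direction.
    p-odd : ¬ 2 ℕ.∣ p
    p-odd 2∣p = not-both-even 2∣p
      (ℕ.∣m+n∣m⇒∣n (subst (2 ℕ.∣_) P≡2s+q (ℕ.∣-trans 2∣p (shape-divisible P-shape))) (ℕ.m∣m*n s))

    q-odd : ¬ 2 ℕ.∣ q
    q-odd 2∣q = not-both-even
      (shape-even P-shape (subst (2 ℕ.∣_) (sym P≡2s+q) (ℕ.∣m∣n⇒∣m+n (ℕ.m∣m*n s) 2∣q))) 2∣q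

    odd⇒≥3 : ∀ {m} → 1 ℕ.≤ m → ¬ m ≡ 1 → ¬ 2 ℕ.∣ m → 3 ℕ.≤ m
    odd⇒≥3 {1} _ m≢1 _ = contradiction refl m≢1
    odd⇒≥3 {2} _ _ odd = contradiction ℕ.∣-refl odd
    odd⇒≥3 {ℕ.suc (ℕ.suc (ℕ.suc m))} _ _ _ = ℕ.s≤s (ℕ.s≤s (ℕ.s≤s ℕ.z≤n))

  -- For p = 1 both shapes give P = 1, whereas P = s + t is at least 2. Oddness excludes p = 2.
  p≥3 : 1 ℕ.≤ p → 1 ℕ.≤ s → 1 ℕ.≤ t → 3 ℕ.≤ p
  p≥3 1≤p 1≤s 1≤t = odd⇒≥3 1≤p p≢1 p-odd
    where
    P≢1 : ¬ P ≡ 1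
    P≢1 P≡1 = ℕ.<⇒≱ (ℕ.+-mono-≤ 1≤s 1≤t) (ℕ.≤-reflexive (trans s+t≡P P≡1))
    p≢1 : ¬ p ≡ 1
    p≢1 refl = P≢1 ([ id , id ]′ P-shape)

  -- For q = 1 the modulus n is p, which divides P and hence 2P. Oddness excludes q = 2.
  q≥3 : 1 ℕ.≤ q → ¬ (p ℕ.* q ℕ.∣ 2 ℕ.* P) → 3 ℕ.≤ q
  q≥3 1≤q n∤2P = odd⇒≥3 1≤q q≢1 q-odd
    where
    q≢1 : ¬ q ≡ 1
    q≢1 refl = n∤2P (subst (ℕ._∣ 2 ℕ.* P) (sym (ℕ.*-identityʳ p)) (ℕ.∣n⇒∣m*n 2 (shape-divisible P-shape)))

-- The Bézout coefficient x inverts p mod q, so x² inverts p². In the second case the quotient comes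
-- from (xp)² - 1 = (xp - 1)(1 + xp) with xp - 1 = -yq.
shape-inverse : ∀ {p q P : ℕ} {x y : ℤ} → SelfOrSquare p P → x * + p + y * + q ≡ + 1 →
  ∃₂ λ P⁻¹ k → + P * P⁻¹ - + 1 ≡ k * + q
shape-inverse {p} {q} {P} {x} {y} (inj₁ refl) e = x , - y , (begin
  + p * x - + 1                    ≡⟨ cong (λ z → + p * x - z) (sym e) ⟩
  + p * x - (x * + p + y * + q)    ≡⟨ solve 4 (λ p q x y → p :* x :- (x :* p :+ y :* q) :=
      (:- y) :* q) refl (+ p) (+ q) x y ⟩
  - y * + q                        ∎)
  where
  open ≡-Reasoning
  open +-*-Solver
shape-inverse {p} {q} {P} {x} {y} (inj₂ refl) e = x * x , - y * (+ 1 + x * + p) , (begin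
  + (p ℕ.* p) * (x * x) - + 1
    ≡⟨ cong (λ z → z * (x * x) - + 1) (ℤ.pos-* p p) ⟩
  + p * + p * (x * x) - + 1
    ≡⟨ solve 2 (λ p x → p :* p :* (x :* x) :- con (+ 1) :=
        (x :* p :- con (+ 1)) :* (con (+ 1) :+ x :* p)) refl (+ p) x ⟩
  (x * + p - + 1) * (+ 1 + x * + p)
    ≡⟨ cong (λ z → (x * + p - z) * (+ 1 + x * + p)) (sym e) ⟩
  (x * + p - (x * + p + y * + q)) * (+ 1 + x * + p)
    ≡⟨ solve 4 (λ p q x y → (x :* p :- (x :* p :+ y :* q)) :* (con (+ 1) :+ x :* p) :=
        (:- y) :* (con (+ 1) :+ x :* p) :* q) refl (+ p) (+ q) x y ⟩
  - y * (+ 1 + x * + p) * + q ∎)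
  where
  open ≡-Reasoning
  open +-*-Solver

^2≡* : ∀ p → (+ p) ^ 2 ≡ + (p ℕ.* p)
^2≡* p = trans (cong (+ p *_) (ℤ.*-identityʳ (+ p))) (sym (ℤ.pos-* p p))

parameters : ∀ p q s t →
  (+ s / 1 ≡ (+ p - + q) / 2 × + t / 1 ≡ (+ p + + q) / 2) ⊎
  (+ s / 1 ≡ ((+ p) ^ 2 - + q) / 2 × + t / 1 ≡ ((+ p) ^ 2 + + q) / 2) →
  ∃₂ λ P (_ : SelfOrSquare p P) → + s + + t ≡ + P × + t ≡ + s + + q
parameters p q s t (inj₁ (e , f)) = p , inj₁ refl ,
  halves {+ s} {+ t} {+ p} {+ q} (half⇒double s (+ p - + q) e) (half⇒double t (+ p + + q) f)
parameters p q s t (inj₂ (e , f)) = p ℕ.* p , inj₂ refl , halves {+ s} {+ t} {+ (p ℕ.* p)} {+ q}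
  (trans (half⇒double s ((+ p) ^ 2 - + q) e) (cong (_- + q) (^2≡* p)))
  (trans (half⇒double t ((+ p) ^ 2 + + q) f) (cong (_+ + q) (^2≡* p)))

theorem2p6 : ∀ (n p q : ℕ) → 1 ℕ.≤ p → 1 ℕ.≤ q → n ≡ p ℕ.* q → gcd p q ≡ 1 →
    ∀ (s t : ℕ) (1≤s : 1 ℕ.≤ s) (s<n : s ℕ.< n) (1≤t : 1 ℕ.≤ t) (t<n : t ℕ.< n) →
    ¬ (+ n ∣ + 2 * + s) →
    ¬ (+ n ∣ + 2 * + t) →
    ¬ (+ n ∣ + 2 * (+ s + + t)) →
    ¬ (+ n ∣ + 3 * + s - + t) →
    ¬ (+ n ∣ + 3 * + t - + s) →
    ¬ (+ n ∣ + 3 * + s + + t) →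
    ¬ (+ n ∣ + 3 * + t + + s) →
    ¬ (+ n ∣ + 4 * + s) →
    ¬ (+ n ∣ + 4 * + t) →
    (+ s / 1 ≡ (+ p - + q) / 2 × + t / 1 ≡ (+ p + + q) / 2) ⊎
    (+ s / 1 ≡ ((+ p) ^ 2 - + q) / 2 × + t / 1 ≡ ((+ p) ^ 2 + + q) / 2) →
    ∥ neighborhoodComplex (circulant n s t 1≤s s<n 1≤t t<n) ∥ ≃ₕ Torus
theorem2p6 n p q 1≤p 1≤q refl coprime s t 1≤s s<n 1≤t t<n _ _ n∤2[s+t] _ _ _ _ _ _ h =
  let P , P-shape , s+t≡P , t≡s+q = parameters p q s t h
      s+t≡P' = ℤ.+-injective (trans (ℤ.pos-+ s t) s+t≡P)
      t≡s+q' = ℤ.+-injective (trans t≡s+q (sym (ℤ.pos-+ s q)))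
      x , y , e = bezout p q coprime
      P⁻¹ , k , P-inverse = shape-inverse {q = q} {x = x} {y} P-shape e
      ℕ.divides l P≡l*p = shape-divisible P-shape
  in Circulant.≃ₕTorus p q {{>-nonZero 1≤p}} {{>-nonZero 1≤q}} x y e (+ P) P⁻¹ (+ l) k
       (trans (cong +_ P≡l*p) (ℤ.pos-* l p)) P-inverse s t s+t≡P t≡s+q 1≤s s<n 1≤t t<n
       (p≥3 coprime P-shape s+t≡P' t≡s+q' 1≤p 1≤s 1≤t)
       -- Divisibility of integers is divisibility of absolute values, so after rewriting s + t as P
       -- the hypothesis on 2(s + t) applies to a divisibility in ℕ.
       (q≥3 coprime P-shape s+t≡P' t≡s+q' 1≤q λ n∣2P → n∤2[s+t]
         (subst (λ z → + (p ℕ.* q) ∣ + 2 * z) (sym s+t≡P) (subst (p ℕ.* q ℕ.∣_) (cong ∣_∣ (ℤ.pos-* 2 P)) n∣2P)))
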